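{- Let $q,k \in \mathbb{N}$ with $2 \le q \le k/2$. The $q$-chorded $k$-cycle inequality \[ \sum_{i \in \mathbb{Z}_k} \left( x_{\{i,i+1\}} - x_{\{i,i+q\}} \right) \le k - \left\lceil \tfrac{k}{q} \right\rceil \] induces a facet of the clique partitioning polytope $\mathrm{CPP}_k$ if and only if both of the following hold: (i) $k \equiv 1 \pmod q$; (ii) if $k = 3q+1$, then $q = 3$ or $q$ is even.
   Context: For $n \in \mathbb{N}$, let $K_n=(V_n,E_n)$ be the complete graph with $E_n=\binom{V_n}{2}$; here the node set is identified with $\mathbb{Z}_k$ (integers modulo $k$), so indices like $i+1$, $i+q$ are taken modulo $k$. For a partition $\Pi$ of the node set, $x^\Pi \in \{0,1\}^{E_n}$ is defined by $x^\Pi_{\{i,j\}}=1$ iff $i,j$ lie in the same block of $\Pi$. The clique partitioning polytope $\mathrm{CPP}_n$ is the convex hull of all vectors $x^\Pi$ over partitions $\Pi$ of $V_n$ (equivalently, of all $x\in\{0,1\}^{E_n}$ with $x_{\{i,j\}}+x_{\{j,l\}}-x_{\{i,l\}}\le 1$ for all pairwise distinct $i,j,l$); it is full-dimensional in $\mathbb{R}^{E_n}$. An inequality induces a facet if it is valid for the polytope and the face of points attaining equality has dimension one less than the polytope. -}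

module Defs where

open import Data.Nat as ℕ using (ℕ; zero; suc)
open import Data.Nat.DivMod using (_/_; _mod_)
open import Data.Nat.Combinatorics using (_C_)
open import Data.Fin as Fin using (Fin; toℕ)
open import Data.Fin.Properties using (_≟_)
open import Data.Integer as ℤ using (ℤ; +_)
open import Data.Rational as ℚ using (ℚ; 0ℚ; 1ℚ)
open import Data.Product using (Σ; _×_; ∃)
open import Relation.Nullary using (¬_; yes; no)
open import Relation.Binary.PropositionalEquality using (_≡_)

sumℤ : ∀ {n} → (Fin n → ℤ) → ℤ
sumℤ {zero}  f = + 0
sumℤ {suc n} f = f Fin.zero ℤ.+ sumℤ (λ i → f (Fin.suc i))

sumℚ : ∀ {n} → (Fin n → ℚ) → ℚ
sumℚ {zero}  f = 0ℚ
sumℚ {suc n} f = f Fin.zero ℚ.+ sumℚ (λ i → f (Fin.suc i))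

_⊕_ : ∀ {k} → Fin k → ℕ → Fin k
_⊕_ {suc k} i q = (toℕ i ℕ.+ q) mod suc k

-- Ceiling of k / q (only meaningful for q ≥ 1).
⌈_/_⌉ : ℕ → ℕ → ℕ
⌈ k / zero ⌉ = zero
⌈ k / suc q ⌉ = (k ℕ.+ q) / suc q

-- A partition Π of V_k is given by a block-labelling L : V_k → V_k;
-- nodes i, j lie in the same block iff L i ≡ L j.  Every partition of a
-- k-element set arises this way.
Labelling : ℕ → Set
Labelling k = Fin k → Fin k

Edge : ℕ → Set
Edge k = Σ (Fin k) λ i → Σ (Fin k) λ j → i Fin.< j

xℤ : ∀ {k} → Labelling k → Fin k → Fin k → ℤ
xℤ L i j with L i ≟ L j
... | yes _ = + 1
... | no  _ = + 0

xℚ : ∀ {k} → Labelling k → Fin k → Fin k → ℚ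
xℚ L i j with L i ≟ L j
... | yes _ = 1ℚ
... | no  _ = 0ℚ

xvec : ∀ {k} → Labelling k → Edge k → ℚ
xvec L (i Data.Product., j Data.Product., _) = xℚ L i j

chordLHS : ∀ {k} → ℕ → Labelling k → ℤ
chordLHS q L = sumℤ λ i → xℤ L i (i ⊕ 1) ℤ.- xℤ L i (i ⊕ q)

chordRHS : ℕ → ℕ → ℤ
chordRHS k q = + k ℤ.- + ⌈ k / q ⌉

-- Validity for CPP_k (a linear inequality is valid on the convex hull of
-- the vectors x^Π iff it holds at every x^Π).
Valid : (k q : ℕ) → Set
Valid k q = (L : Labelling k) → chordLHS q L ℤ.≤ chordRHS k q

OnFace : (k q : ℕ) → Labelling k → Set
OnFace k q L = chordLHS q L ≡ chordRHS k q

AffinelyIndependent : ∀ {k m} → (Fin m → Edge k → ℚ) → Set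
AffinelyIndependent {k} {m} v =
  (λ′ : Fin m → ℚ) → sumℚ λ′ ≡ 0ℚ →
  ((e : Edge k) → sumℚ (λ t → λ′ t ℚ.* v t e) ≡ 0ℚ) →
  (t : Fin m) → λ′ t ≡ 0ℚ

-- The face contains m affinely independent points.  (The face is the
-- convex hull of the vertices x^Π on it, so its affine hull is spanned by
-- those vertices.)
FaceHasAffIndep : (k q m : ℕ) → Set
FaceHasAffIndep k q m =
  Σ (Fin m → Labelling k) λ Ls →
    ((t : Fin m) → OnFace k q (Ls t)) × AffinelyIndependent (λ t → xvec (Ls t))

FaceDim : (k q d : ℕ) → Set
FaceDim k q d = FaceHasAffIndep k q (suc d) × ¬ FaceHasAffIndep k q (suc (suc d))

-- The inequality induces a facet of CPP_k (dim CPP_k = |E_k| = k choose 2):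
-- valid, and the face has dimension |E_k| − 1.
InducesFacet : (k q : ℕ) → Set
InducesFacet k q = Valid k q × FaceDim k q ((k C 2) ℕ.∸ 1)

-- Read a labelling as a k-periodic function on ℕ. A window of q consecutive
-- edges of the cycle either contains a cut or has its chord joined; summed over
-- all windows this gives k ≤ q · cuts + chords, while the inequality itself reads
-- ⌈k/q⌉ ≤ cuts + chords. Unless q divides k - 1, a tight point has no chord at all,
-- so x_{0,q} vanishes on the face. If k = 3q + 1 with q odd and q ≠ 3, every tight
-- point satisfies Σ (-1)^z x_{z,z+q+2} = 0. In both cases the face lies in a second
-- hyperplane.
--
-- Otherwise let k = mq + 1 and take an affine functional that vanishes on the face
-- and has coefficient 0 at {0,1}. Cyclic sequences of m + 1 blocks of size at most q
-- are tight. Moving one node between two adjacent blocks kills the coefficients at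
-- cyclic distance at most q; merging two nonadjacent blocks shows that rectangles of
-- coefficients sum to 0, and differences of rectangles kill the rest. So only 0 is
-- orthogonal to the face and the normalisation, and affinely independent tight
-- points can be chosen greedily.

module Submission where

open import Defs
open import Algebra.Bundles using (CommutativeMonoid; CommutativeRing)
open import Algebra.Structures using (IsCommutativeMonoid; IsCommutativeRing)
import Algebra.Properties.CommutativeMonoid.Sum as CMSum
import Algebra.Properties.Ring as RingProperties
import Algebra.Properties.Semiring.Sum as SemiringSum
open import Data.Fin as Fin using (Fin; zero; suc; toℕ; fromℕ<; punchIn; combine; _↑ˡ_; _↑ʳ_; splitAt; quotient; remainder; finToFun; funToFin)
import Data.Fin.Properties as Finₚ
open import Data.Integer using (ℤ) renaming (+_ to pos)
import Data.Integer as ℤ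
import Data.Integer.Properties as ℤₚ
import Data.Integer.Tactic.RingSolver as ℤSolver
open import Data.List using (List; []; _∷_; _++_; length; map; upTo; filter; lookup)
open import Data.List.Membership.Propositional using (_∈_)
open import Data.List.Membership.Propositional.Properties using (∈-map⁺; ∈-++⁺ˡ; ∈-++⁺ʳ; ∈-upTo⁺; ∈-filter⁺)
open import Data.List.Properties using (length-map; length-++; length-upTo; filter-notAll)
open import Data.List.Relation.Unary.Any as Any using (here; there)
import Data.List.Relation.Unary.Any.Properties as Anyₚ
open import Data.Nat using (ℕ; zero; suc; pred; _+_; _*_; _∸_; _≤_; _<_; z≤n; s≤s; z<s; s<s; _≟_; _<?_; ≢-nonZero)
open import Data.Nat.Combinatorics using (_C_; nC1≡n; nCk+nC[k+1]≡[n+1]C[k+1])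
open import Data.Nat.Divisibility using (_∣_; divides; _∣?_)
open import Data.Nat.DivMod using (_/_; _%_; _mod_; m%n<n; m<n⇒m%n≡m; [m+n]%n≡m%n; n%n≡0; m*n/n≡m; m/n*n≤m; m/n≤m; m<n*o⇒m/o<n; m≥n⇒m/n>0; m<n⇒m/n≡0; /-monoˡ-≤; m≡m%n+[m/n]*n)
open import Data.Nat.Properties hiding (_≟_; _<?_)
open import Data.Nat.Tactic.RingSolver using (solve-∀)
open import Data.Product using (Σ; ∃; _×_; _,_; proj₁; proj₂)
open import Data.Product.Properties using (≡-dec)
open import Data.Rational using (ℚ; 0ℚ; 1ℚ)
import Data.Rational as ℚ
import Data.Rational.Properties as ℚₚ
open import Data.Sum as Sum using (_⊎_; inj₁; inj₂; [_,_]′)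
open import Data.Vec.Functional using (insertAt)
open import Data.Vec.Functional.Properties using (insertAt-lookup; insertAt-punchIn)
open import Function using (_∘_; id)
open import Function.Bundles using (_⇔_; mk⇔)
open import Level using (0ℓ)
open import Relation.Binary.Definitions using (DecidableEquality; tri<; tri≈; tri>)
open import Relation.Binary.PropositionalEquality
open import Relation.Nullary using (¬_; Dec; yes; no; contradiction; ¬?; _×-dec_)
open import Relation.Nullary.Decidable using (decidable-stable)

-- Sums and linear algebra

-- Condition (ii) is a matter of signs. For m = 3 the relations among the coefficients at distance
-- above q force invariance under translation by 2, so an alternating solution is the danger. The
-- sign (-1)^z lives on the cycle only if k = 3q + 1 is even, that is, q is odd. For q = 3 the
-- distance q + 2 is k / 2, so the alternating sum meets every edge from both ends with opposite
-- signs and is identically 0. For m ≥ 4 two merged blocks can have two or more blocks between them;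
-- that gap may then lose a node, and this freedom removes the obstruction.
--
-- Coefficient 0 at {0,1} is no loss: the equation of the face has a nonzero coefficient there, and
-- a multiple of it can be subtracted.
--
-- The greedy choice is constructive because there are finitely many labellings and equality of
-- rationals is decidable: a functional either misses some tight point or is found to kill them all.

module RangeSum {A : Set} {_∙_ : A → A → A} {ε : A}
                (isCM : IsCommutativeMonoid _≡_ _∙_ ε) where

  open IsCommutativeMonoid isCM using (identityˡ; identityʳ; assoc; comm)

  private
    M : CommutativeMonoid 0ℓ 0ℓ
    M = record { isCommutativeMonoid = isCM }

  open CMSum M public using (sum; sum-cong-≗; ∑-distrib-+; ∑-comm; sum-remove; sum-replicate-zero)

  -- Summands are functions on all of ℕ, so that a position on the cycle can be translated by
  -- addition and brought back by periodicity.
  ∑ : ℕ → (ℕ → A) → A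
  ∑ n f = sum {n} (λ i → f (toℕ i))

  ∑-cong : ∀ n {f g : ℕ → A} → (∀ i → i < n → f i ≡ g i) → ∑ n f ≡ ∑ n g
  ∑-cong zero    eq = refl
  ∑-cong (suc n) eq = cong₂ _∙_ (eq 0 z<s) (∑-cong n λ i i<n → eq (suc i) (s<s i<n))

  ∑-zero : ∀ n {f : ℕ → A} → (∀ i → i < n → f i ≡ ε) → ∑ n f ≡ ε
  ∑-zero n eq = trans (∑-cong n eq) (sum-replicate-zero n)

  ∑-split : ∀ m n (f : ℕ → A) → ∑ (m + n) f ≡ ∑ m f ∙ ∑ n (λ i → f (m + i))
  ∑-split zero    n f = sym (identityˡ _)
  ∑-split (suc m) n f = trans (cong (f 0 ∙_) (∑-split m n (f ∘ suc))) (sym (assoc _ _ _))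

  ∑-snoc : ∀ n (f : ℕ → A) → ∑ (suc n) f ≡ ∑ n f ∙ f n
  ∑-snoc zero    f = comm _ _
  ∑-snoc (suc n) f = trans (cong (f 0 ∙_) (∑-snoc n (f ∘ suc))) (sym (assoc _ _ _))

  ∑-add : ∀ n (f g : ℕ → A) → ∑ n (λ i → f i ∙ g i) ≡ ∑ n f ∙ ∑ n g
  ∑-add n f g = ∑-distrib-+ {n} (f ∘ toℕ) (g ∘ toℕ)

  ∑-swap : ∀ m n (f : ℕ → ℕ → A) → ∑ m (λ i → ∑ n (f i)) ≡ ∑ n (λ j → ∑ m (λ i → f i j))
  ∑-swap m n f = ∑-comm {m} {n} λ i j → f (toℕ i) (toℕ j)

  ∑-rotate₁ : ∀ k (f : ℕ → A) → f k ≡ f 0 → ∑ k (f ∘ suc) ≡ ∑ k f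
  ∑-rotate₁ zero    f eq = refl
  ∑-rotate₁ (suc k) f eq =
    trans (∑-snoc k (f ∘ suc)) (trans (cong (∑ k (f ∘ suc) ∙_) eq) (comm _ _))

  ∑-rotate : ∀ k (f : ℕ → A) → (∀ i → f (i + k) ≡ f i) → ∀ p → ∑ k (λ i → f (p + i)) ≡ ∑ k f
  ∑-rotate k f per zero    = refl
  ∑-rotate k f per (suc p) = trans
    (∑-cong k λ i _ → cong f (sym (+-suc p i)))
    (trans (∑-rotate₁ k (λ i → f (p + i)) (trans (per p) (cong f (sym (+-identityʳ p)))))
           (∑-rotate k f per p))

  ∑-single : ∀ n v (f : ℕ → A) → v < n → (∀ i → i < n → i ≢ v → f i ≡ ε) → ∑ n f ≡ f v
  ∑-single (suc n) zero f _ z =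
    trans (cong (f 0 ∙_) (∑-zero n λ i i<n → z (suc i) (s<s i<n) λ ())) (identityʳ _)
  ∑-single (suc n) (suc v) f (s<s v<n) z =
    trans (cong₂ _∙_ (z 0 z<s λ ()) (∑-single n v (f ∘ suc) v<n λ i i<n i≢v → z (suc i) (s<s i<n) (i≢v ∘ suc-injective)))
          (identityˡ _)

  ∑-interval : ∀ p s r (f : ℕ → A) → (∀ i → i < p → f i ≡ ε) →
               (∀ i → p + s ≤ i → i < (p + s) + r → f i ≡ ε) →
               ∑ ((p + s) + r) f ≡ ∑ s (λ i → f (p + i))
  ∑-interval p s r f lo hi = begin
    ∑ ((p + s) + r) f                               ≡⟨ ∑-split (p + s) r f ⟩
    ∑ (p + s) f ∙ ∑ r (λ i → f ((p + s) + i))        ≡⟨ cong₂ _∙_ (∑-split p s f)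
                                                        (∑-zero r λ i i<r → hi _ (m≤m+n (p + s) i) (+-monoʳ-< (p + s) i<r)) ⟩
    (∑ p f ∙ ∑ s (λ i → f (p + i))) ∙ ε             ≡⟨ identityʳ _ ⟩
    ∑ p f ∙ ∑ s (λ i → f (p + i))                   ≡⟨ cong (_∙ ∑ s (λ i → f (p + i))) (∑-zero p lo) ⟩
    ε ∙ ∑ s (λ i → f (p + i))                       ≡⟨ identityˡ _ ⟩
    ∑ s (λ i → f (p + i))                           ∎
    where open ≡-Reasoning

  sum-++ : ∀ m n (f : Fin (m + n) → A) → sum f ≡ sum (λ i → f (i ↑ˡ n)) ∙ sum (λ j → f (m ↑ʳ j))
  sum-++ zero    n f = sym (identityˡ _)
  sum-++ (suc m) n f = trans (cong (f zero ∙_) (sum-++ m n (f ∘ suc))) (sym (assoc _ _ _))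

  sum-combine : ∀ m n (f : Fin (m * n) → A) → sum f ≡ sum (λ i → sum (λ j → f (combine {m} {n} i j)))
  sum-combine zero    n f = refl
  sum-combine (suc m) n f = trans (sum-++ n (m * n) f) (cong (sum (λ i → f (i ↑ˡ (m * n))) ∙_) (sum-combine m n (λ t → f (n ↑ʳ t))))

module ℕ∑ = RangeSum +-0-isCommutativeMonoid

-- Decidable equality is needed to find pivots; `2≢0` turns the relations `x ⊞ x ≡ 𝟘`, in which the
-- coefficient argument ends, into `x ≡ 𝟘`.
record DecField : Set₁ where
  infixl 7 _·_
  infixl 6 _⊞_
  field
    K                 : Set
    _⊞_ _·_           : K → K → K
    ⊟_                : K → K
    𝟘 𝟙               : K
    isCommutativeRing : IsCommutativeRing _≡_ _⊞_ _·_ ⊟_ 𝟘 𝟙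
    _≟ᴷ_              : DecidableEquality K
    inverse           : ∀ x → x ≢ 𝟘 → ∃ λ y → y · x ≡ 𝟙
    2≢0               : 𝟙 ⊞ 𝟙 ≢ 𝟘

module Linear (F : DecField) where

  open DecField F public
  open IsCommutativeRing isCommutativeRing public
    using (zeroˡ; zeroʳ; distribˡ; distribʳ; +-isCommutativeMonoid)
    renaming (-‿inverseˡ to ⊟-inverseˡ; -‿inverseʳ to ⊟-inverseʳ;
              +-assoc to ⊞-assoc; +-comm to ⊞-comm; +-identityˡ to ⊞-identityˡ; +-identityʳ to ⊞-identityʳ;
              *-assoc to ·-assoc; *-comm to ·-comm; *-identityˡ to ·-identityˡ; *-identityʳ to ·-identityʳ)

  private
    R : CommutativeRing 0ℓ 0ℓ
    R = record { isCommutativeRing = isCommutativeRing }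

  open RingProperties (CommutativeRing.ring R) public
    using (-‿distribˡ-*; -‿involutive; -0#≈0#; -‿+-comm)
    renaming (+-cancelˡ to ⊞-cancelˡ; +-cancelʳ to ⊞-cancelʳ)
  open RangeSum +-isCommutativeMonoid public

  *-distribˡ-sum : ∀ {n} x (f : Fin n → K) → x · sum f ≡ sum (λ i → x · f i)
  *-distribˡ-sum = SemiringSum.*-distribˡ-sum (CommutativeRing.semiring R)

  *-distribʳ-sum : ∀ {n} x (f : Fin n → K) → sum f · x ≡ sum (λ i → f i · x)
  *-distribʳ-sum = SemiringSum.*-distribʳ-sum (CommutativeRing.semiring R)

  sum-zero : ∀ {n} {f : Fin n → K} → (∀ i → f i ≡ 𝟘) → sum f ≡ 𝟘
  sum-zero {n} eq = trans (sum-cong-≗ eq) (sum-replicate-zero n)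

  𝟙≢𝟘 : 𝟙 ≢ 𝟘
  𝟙≢𝟘 eq = 2≢0 (trans (cong₂ _⊞_ eq eq) (⊞-identityˡ 𝟘))

  ·-cancel-≢0 : ∀ {x y} → y ≢ 𝟘 → x · y ≡ 𝟘 → x ≡ 𝟘
  ·-cancel-≢0 {x} {y} y≢0 xy≡0 with inverse y y≢0
  ... | z , zy≡1 = begin
    x             ≡⟨ ·-identityʳ x ⟨
    x · 𝟙         ≡⟨ cong (x ·_) (trans (sym zy≡1) (·-comm z y)) ⟩
    x · (y · z)   ≡⟨ ·-assoc x y z ⟨
    (x · y) · z   ≡⟨ cong (_· z) xy≡0 ⟩
    𝟘 · z         ≡⟨ zeroˡ z ⟩
    𝟘             ∎
    where open ≡-Reasoning

  self-negative : ∀ {x} → x ⊞ x ≡ 𝟘 → x ≡ 𝟘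
  self-negative {x} eq = ·-cancel-≢0 2≢0
    (trans (distribˡ x 𝟙 𝟙) (trans (cong₂ _⊞_ (·-identityʳ x) (·-identityʳ x)) eq))

  infix 8 _∙_
  _∙_ : ∀ {n} → (Fin n → K) → (Fin n → K) → K
  c ∙ e = sum (λ i → c i · e i)

  -- Gaussian elimination, one equation per step. A zero row is dropped. Otherwise a pivot column
  -- `p` is cleared from the other rows, and the solution `c′` of the smaller system is extended by
  -- the value `cₚ` that solves the pivot row.
  solve-homogeneous : ∀ l n (E : Fin l → Fin n → K) → l < n →
    ∃ λ (c : Fin n → K) → (∃ λ i → c i ≢ 𝟘) × (∀ r → c ∙ E r ≡ 𝟘)
  solve-homogeneous zero (suc n) E _ = (λ _ → 𝟙) , (zero , 𝟙≢𝟘) , λ ()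
  solve-homogeneous (suc l) (suc n) E (s<s l<n) with Finₚ.any? (λ i → ¬? (E zero i ≟ᴷ 𝟘))
  ... | no row₀≡0 =
    let c , c≢0 , sol = solve-homogeneous l (suc n) (E ∘ suc) (m<n⇒m<1+n l<n)
    in  c , c≢0 , λ { zero    → sum-zero λ i → trans (cong (c i ·_) (zero-entry i)) (zeroʳ (c i))
                    ; (suc r) → sol r }
    where
    zero-entry : ∀ i → E zero i ≡ 𝟘
    zero-entry i = decidable-stable (E zero i ≟ᴷ 𝟘) λ e≢0 → row₀≡0 (i , e≢0)
  ... | yes (p , pivot≢0) =
    c , (punchIn p j₀ , λ eq → c′≢0 (trans (sym (insertAt-punchIn c′ p cₚ j₀)) eq)) , sol
    where
    open ≡-Reasoning
    y = proj₁ (inverse (E zero p) pivot≢0)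

    w : Fin l → K
    w r = ⊟ (E (suc r) p · y)

    E′ : Fin l → Fin n → K
    E′ r j = E (suc r) (punchIn p j) ⊞ w r · E zero (punchIn p j)

    rec = solve-homogeneous l n E′ l<n
    c′ = proj₁ rec
    j₀ = proj₁ (proj₁ (proj₂ rec))
    c′≢0 = proj₂ (proj₁ (proj₂ rec))

    T : Fin (suc l) → K
    T r = c′ ∙ (E r ∘ punchIn p)

    cₚ = ⊟ (y · T zero)
    c = insertAt c′ p cₚ

    expand : ∀ r → c ∙ E r ≡ cₚ · E r p ⊞ T r
    expand r = begin
      c ∙ E r                                                    ≡⟨ sum-remove {i = p} (λ i → c i · E r i) ⟩
      c p · E r p ⊞ sum (λ j → c (punchIn p j) · E r (punchIn p j))
        ≡⟨ cong₂ _⊞_ (cong (_· E r p) (insertAt-lookup c′ p cₚ))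
             (sum-cong-≗ λ j → cong (_· E r (punchIn p j)) (insertAt-punchIn c′ p cₚ j)) ⟩
      cₚ · E r p ⊞ T r                                           ∎

    sol : ∀ r → c ∙ E r ≡ 𝟘
    sol zero = begin
      c ∙ E zero                            ≡⟨ expand zero ⟩
      ⊟ (y · T zero) · E zero p ⊞ T zero    ≡⟨ cong (_⊞ T zero) (sym (-‿distribˡ-* _ _)) ⟩
      ⊟ (y · T zero · E zero p) ⊞ T zero    ≡⟨ cong (λ z → ⊟ z ⊞ T zero) (trans (cong (_· E zero p) (·-comm y _)) (·-assoc _ _ _)) ⟩
      ⊟ (T zero · (y · E zero p)) ⊞ T zero  ≡⟨ cong (λ z → ⊟ (T zero · z) ⊞ T zero) (proj₂ (inverse (E zero p) pivot≢0)) ⟩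
      ⊟ (T zero · 𝟙) ⊞ T zero               ≡⟨ cong (λ z → ⊟ z ⊞ T zero) (·-identityʳ _) ⟩
      ⊟ T zero ⊞ T zero                     ≡⟨ ⊟-inverseˡ _ ⟩
      𝟘                                     ∎
    sol (suc r) = begin
      c ∙ E (suc r)                                   ≡⟨ expand (suc r) ⟩
      ⊟ (y · T zero) · E (suc r) p ⊞ T (suc r)        ≡⟨ cong (_⊞ T (suc r)) move ⟩
      w r · T zero ⊞ T (suc r)                        ≡⟨ ⊞-comm _ _ ⟩
      T (suc r) ⊞ w r · T zero                        ≡⟨ cong (T (suc r) ⊞_) (*-distribˡ-sum (w r) (λ j → c′ j · E zero (punchIn p j))) ⟩
      T (suc r) ⊞ sum (λ j → w r · (c′ j · E zero (punchIn p j)))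
        ≡⟨ ∑-distrib-+ (λ j → c′ j · E (suc r) (punchIn p j)) _ ⟨
      sum (λ j → c′ j · E (suc r) (punchIn p j) ⊞ w r · (c′ j · E zero (punchIn p j)))
        ≡⟨ sum-cong-≗ (λ j → trans (cong (c′ j · E (suc r) (punchIn p j) ⊞_) (swap (w r) (c′ j) _)) (sym (distribˡ (c′ j) _ _))) ⟩
      c′ ∙ E′ r                                       ≡⟨ proj₂ (proj₂ rec) r ⟩
      𝟘                                               ∎
      where
      swap : ∀ a b d → a · (b · d) ≡ b · (a · d)
      swap a b d = trans (sym (·-assoc a b d)) (trans (cong (_· d) (·-comm a b)) (·-assoc b a d))
      move : ⊟ (y · T zero) · E (suc r) p ≡ w r · T zero
      move = begin
        ⊟ (y · T zero) · E (suc r) p   ≡⟨ -‿distribˡ-* _ _ ⟨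
        ⊟ (y · T zero · E (suc r) p)   ≡⟨ cong ⊟_ (trans (·-comm _ _) (sym (·-assoc _ _ _))) ⟩
        ⊟ (E (suc r) p · y · T zero)   ≡⟨ -‿distribˡ-* _ _ ⟩
        w r · T zero                   ∎

  LinearlyIndependent : ∀ {s n} → (Fin s → Fin n → K) → Set
  LinearlyIndependent v = ∀ μ → (∀ i → μ ∙ (λ t → v t i) ≡ 𝟘) → ∀ t → μ t ≡ 𝟘

  ∙-exchange : ∀ {s n} (d : Fin n → K) (μ : Fin s → K) (v : Fin s → Fin n → K) →
    d ∙ (λ i → μ ∙ (λ t → v t i)) ≡ μ ∙ (λ t → d ∙ v t)
  ∙-exchange d μ v = begin
    sum (λ i → d i · sum (λ t → μ t · v t i))    ≡⟨ sum-cong-≗ (λ i → *-distribˡ-sum (d i) (λ t → μ t · v t i)) ⟩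
    sum (λ i → sum (λ t → d i · (μ t · v t i)))  ≡⟨ ∑-comm (λ i t → d i · (μ t · v t i)) ⟩
    sum (λ t → sum (λ i → d i · (μ t · v t i)))  ≡⟨ sum-cong-≗ (λ t → trans (sum-cong-≗ λ i → swap (d i) (μ t) _) (sym (*-distribˡ-sum (μ t) (λ i → d i · v t i)))) ⟩
    sum (λ t → μ t · (d ∙ v t))                  ∎
    where
    open ≡-Reasoning
    swap : ∀ a b d → a · (b · d) ≡ b · (a · d)
    swap a b d = trans (sym (·-assoc a b d)) (trans (cong (_· d) (·-comm a b)) (·-assoc b a d))

  -- A nonzero functional killing E and the vectors chosen so far exists as long
  -- as these are fewer than n, and a vector it does not kill can be appended.
  extract-independent : ∀ {A : Set} {n} (V : A → Fin n → K) {l} (E : Fin l → Fin n → K) →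
    (∀ d → (∃ λ i → d i ≢ 𝟘) → (∀ r → d ∙ E r ≡ 𝟘) → ∃ λ a → d ∙ V a ≢ 𝟘) →
    ∀ s → l + s ≤ n → ∃ λ (g : Fin s → A) → LinearlyIndependent (V ∘ g)
  extract-independent V E separate zero _ = (λ ()) , λ _ _ ()
  extract-independent {A} {n} V {l} E separate (suc s) l+1+s≤n = g′ , independent
    where
    open ≡-Reasoning
    l+s<n = subst (_≤ n) (+-suc l s) l+1+s≤n
    rec = extract-independent V E separate s (<⇒≤ l+s<n)
    g = proj₁ rec
    rows : Fin (l + s) → Fin n → K
    rows r = [ E , V ∘ g ]′ (splitAt l r)
    hom = solve-homogeneous (l + s) n rows l+s<n
    d = proj₁ hom
    kill = proj₂ (proj₂ hom)
    sep = separate d (proj₁ (proj₂ hom)) λ r →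
      trans (sym (cong (λ z → d ∙ [ E , V ∘ g ]′ z) (Finₚ.splitAt-↑ˡ l r s))) (kill (r ↑ˡ s))
    a = proj₁ sep
    g′ : Fin (suc s) → A
    g′ zero    = a
    g′ (suc t) = g t
    killg : ∀ t → d ∙ V (g t) ≡ 𝟘
    killg t = trans (sym (cong (λ z → d ∙ [ E , V ∘ g ]′ z) (Finₚ.splitAt-↑ʳ l s t))) (kill (l ↑ʳ t))
    independent : LinearlyIndependent (V ∘ g′)
    independent μ eq = λ { zero → μ₀≡0 ; (suc t) → proj₂ rec (μ ∘ suc) eq′ t }
      where
      -- Applying `d` to the relation leaves only the term of the new vector, because `d` kills all
      -- earlier ones.
      μ₀≡0 : μ zero ≡ 𝟘
      μ₀≡0 = ·-cancel-≢0 (proj₂ sep) (begin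
        μ zero · (d ∙ V a)                                          ≡⟨ ⊞-identityʳ _ ⟨
        μ zero · (d ∙ V a) ⊞ 𝟘                                      ≡⟨ cong (μ zero · (d ∙ V a) ⊞_)
                                                                        (sum-zero λ t → trans (cong (μ (suc t) ·_) (killg t)) (zeroʳ _)) ⟨
        μ ∙ (λ t → d ∙ V (g′ t))                                    ≡⟨ ∙-exchange d μ (V ∘ g′) ⟨
        d ∙ (λ i → μ ∙ (λ t → V (g′ t) i))                          ≡⟨ sum-zero (λ i → trans (cong (d i ·_) (eq i)) (zeroʳ _)) ⟩
        𝟘                                                           ∎)
      eq′ : ∀ i → (μ ∘ suc) ∙ (λ t → V (g t) i) ≡ 𝟘
      eq′ i = begin
        (μ ∘ suc) ∙ (λ t → V (g t) i)                        ≡⟨ ⊞-identityˡ _ ⟨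
        𝟘 ⊞ (μ ∘ suc) ∙ (λ t → V (g t) i)                    ≡⟨ cong (_⊞ (μ ∘ suc) ∙ (λ t → V (g t) i)) (trans (cong (_· V a i) μ₀≡0) (zeroˡ _)) ⟨
        μ ∙ (λ t → V (g′ t) i)                               ≡⟨ eq i ⟩
        𝟘                                                    ∎

-- Cuts and chords of a cyclic labelling

-- Linear arithmetic by certificate: the hypotheses, scaled and added, form `A ≤ B`, and `w` is the
-- slack, so that the goal becomes a polynomial identity for the ring solver.
≤-certificate : ∀ {A B a b} w → A ≤ B → b + A ≡ a + B + w → a ≤ b
≤-certificate {A} {B} {a} {b} w A≤B eq = +-cancelʳ-≤ B a b (begin
  a + B      ≤⟨ m≤m+n (a + B) w ⟩
  a + B + w  ≡⟨ eq ⟨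
  b + A      ≤⟨ +-monoʳ-≤ b A≤B ⟩
  b + B      ∎)
  where open ≤-Reasoning

ind : ∀ {P : Set} → Dec P → ℕ
ind (yes _) = 1
ind (no  _) = 0

ind-yes : ∀ {P : Set} (P? : Dec P) → P → ind P? ≡ 1
ind-yes (yes _) _ = refl
ind-yes (no ¬p) p = contradiction p ¬p

ind-no : ∀ {P : Set} (P? : Dec P) → ¬ P → ind P? ≡ 0
ind-no (yes p) ¬p = contradiction p ¬p
ind-no (no _)  _  = refl

ind-cong : ∀ {P Q : Set} (P? : Dec P) (Q? : Dec Q) → (P → Q) → (Q → P) → ind P? ≡ ind Q?
ind-cong (yes p) Q? f g = sym (ind-yes Q? (f p))
ind-cong (no ¬p) Q? f g = sym (ind-no Q? (¬p ∘ g))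

δ : ℕ → ℕ → ℕ
δ x y = ind (x ≟ y)

δ-≡ : ∀ {x y} → x ≡ y → δ x y ≡ 1
δ-≡ = ind-yes (_ ≟ _)

δ-≢ : ∀ {x y} → x ≢ y → δ x y ≡ 0
δ-≢ = ind-no (_ ≟ _)

δ-sym : ∀ x y → δ x y ≡ δ y x
δ-sym x y = ind-cong (x ≟ y) (y ≟ x) sym sym

δ≡0⇒≢ : ∀ {x y} → δ x y ≡ 0 → x ≢ y
δ≡0⇒≢ δ≡0 x≡y with trans (sym (δ-≡ x≡y)) δ≡0
... | ()

cut : (ℕ → ℕ) → ℕ → ℕ
cut ℓ i = 1 ∸ δ (ℓ i) (ℓ (suc i))

cutsIn : (ℕ → ℕ) → ℕ → ℕ → ℕ
cutsIn ℓ i n = ℕ∑.∑ n (λ t → cut ℓ (i + t))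

cuts : (ℕ → ℕ) → ℕ → ℕ
cuts ℓ k = ℕ∑.∑ k (cut ℓ)

chords : (ℕ → ℕ) → ℕ → ℕ → ℕ
chords ℓ k q = ℕ∑.∑ k (λ i → δ (ℓ i) (ℓ (i + q)))

Periodic : (ℕ → ℕ) → ℕ → Set
Periodic ℓ k = ∀ i → ℓ (i + k) ≡ ℓ i

module Cuts (ℓ : ℕ → ℕ) where

  cut-≡ : ∀ {i} → ℓ i ≡ ℓ (suc i) → cut ℓ i ≡ 0
  cut-≡ eq rewrite δ-≡ eq = refl

  cut-≢ : ∀ {i} → ℓ i ≢ ℓ (suc i) → cut ℓ i ≡ 1
  cut-≢ neq rewrite δ-≢ neq = refl

  cut≡0⇒≡ : ∀ {i} → cut ℓ i ≡ 0 → ℓ i ≡ ℓ (suc i)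
  cut≡0⇒≡ {i} eq with ℓ i ≟ ℓ (suc i)
  ... | yes p = p
  cut≡0⇒≡ () | no _

  cut+δ : ∀ i → cut ℓ i + δ (ℓ i) (ℓ (suc i)) ≡ 1
  cut+δ i with ℓ i ≟ ℓ (suc i)
  ... | yes _ = refl
  ... | no  _ = refl

  cutsIn-suc : ∀ i n → cutsIn ℓ i (suc n) ≡ cut ℓ i + cutsIn ℓ (suc i) n
  cutsIn-suc i n = cong₂ _+_ (cong (cut ℓ) (+-identityʳ i)) (ℕ∑.∑-cong n λ t _ → cong (cut ℓ) (+-suc i t))

  cutsIn-+ : ∀ i m n → cutsIn ℓ i (m + n) ≡ cutsIn ℓ i m + cutsIn ℓ (i + m) n
  cutsIn-+ i m n = trans (ℕ∑.∑-split m n (λ t → cut ℓ (i + t)))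
    (cong (cutsIn ℓ i m +_) (ℕ∑.∑-cong n λ t _ → cong (cut ℓ) (sym (+-assoc i m t))))

  cutsIn-1 : ∀ i → cutsIn ℓ i 1 ≡ cut ℓ i
  cutsIn-1 i = trans (+-identityʳ _) (cong (cut ℓ) (+-identityʳ i))

  cutsIn≡0⇒≡ : ∀ n i → cutsIn ℓ i n ≡ 0 → ℓ i ≡ ℓ (i + n)
  cutsIn≡0⇒≡ zero    i _  = cong ℓ (sym (+-identityʳ i))
  cutsIn≡0⇒≡ (suc n) i eq = trans (cut≡0⇒≡ (m+n≡0⇒m≡0 _ eq′))
    (trans (cutsIn≡0⇒≡ n (suc i) (m+n≡0⇒n≡0 (cut ℓ i) eq′)) (cong ℓ (sym (+-suc i n))))
    where eq′ = trans (sym (cutsIn-suc i n)) eq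

  -- The labels are constant before the only cut and constant after it, so the ends carry the two
  -- labels that differ there. Hence equal ends with a cut between them force two cuts.
  cutsIn≡1⇒≢ : ∀ n i → cutsIn ℓ i n ≡ 1 → ℓ i ≢ ℓ (i + n)
  cutsIn≡1⇒≢ (suc n) i eq same with ℓ i ≟ ℓ (suc i)
  ... | yes p = cutsIn≡1⇒≢ n (suc i)
    (trans (cong (_+ cutsIn ℓ (suc i) n) (sym (cut-≡ p))) (trans (sym (cutsIn-suc i n)) eq))
    (trans (sym p) (trans same (cong ℓ (+-suc i n))))
  ... | no ¬p = ¬p (trans same (trans (cong ℓ (+-suc i n)) (sym (cutsIn≡0⇒≡ n (suc i)
    (suc-injective (trans (cong (_+ cutsIn ℓ (suc i) n) (sym (cut-≢ ¬p))) (trans (sym (cutsIn-suc i n)) eq)))))))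

  cut-or-joined : ∀ i q → 1 ≤ cutsIn ℓ i q + δ (ℓ i) (ℓ (i + q))
  cut-or-joined i q with cutsIn ℓ i q in eq
  ... | zero  = ≤-reflexive (sym (δ-≡ (cutsIn≡0⇒≡ q i eq)))
  ... | suc _ = s≤s z≤n

  cutsIn-≥2 : ∀ i n → ℓ i ≡ ℓ (i + n) → 1 ≤ cutsIn ℓ i n → 2 ≤ cutsIn ℓ i n
  cutsIn-≥2 i n same 1≤ with cutsIn ℓ i n in eq
  ... | suc zero    = contradiction same (cutsIn≡1⇒≢ n i eq)
  ... | suc (suc _) = s≤s (s≤s z≤n)

  cuts+joins : ∀ k → cuts ℓ k + ℕ∑.∑ k (λ i → δ (ℓ i) (ℓ (i + 1))) ≡ k
  cuts+joins k = begin
    cuts ℓ k + ∑ k (λ i → δ (ℓ i) (ℓ (i + 1)))          ≡⟨ ∑-add k (cut ℓ) (λ i → δ (ℓ i) (ℓ (i + 1))) ⟨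
    ∑ k (λ i → cut ℓ i + δ (ℓ i) (ℓ (i + 1)))           ≡⟨ ∑-cong k (λ i _ → trans (cong (λ j → cut ℓ i + δ (ℓ i) (ℓ j)) (+-comm i 1)) (cut+δ i)) ⟩
    ∑ k (λ _ → 1)                                       ≡⟨ ∑-one k ⟩
    k                                                   ∎
    where
    open ≡-Reasoning
    open ℕ∑
    ∑-one : ∀ n → ∑ n (λ _ → 1) ≡ n
    ∑-one zero    = refl
    ∑-one (suc n) = cong suc (∑-one n)

  module _ {k : ℕ} (per : Periodic ℓ k) where

    cut-periodic : ∀ i → cut ℓ (i + k) ≡ cut ℓ i
    cut-periodic i = cong₂ (λ x y → 1 ∸ δ x y) (per i) (per (suc i))

    cutsIn-cycle : ∀ i → cutsIn ℓ i k ≡ cuts ℓ k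
    cutsIn-cycle = ℕ∑.∑-rotate k (cut ℓ) cut-periodic

    chord-periodic : ∀ q i → δ (ℓ (i + k)) (ℓ (i + k + q)) ≡ δ (ℓ i) (ℓ (i + q))
    chord-periodic q i = cong₂ δ (per i) (trans (cong ℓ (e i k q)) (per (i + q)))
      where e : ∀ i k q → i + k + q ≡ i + q + k
            e = solve-∀

    cut-count : ∀ q → k ≤ q * cuts ℓ k + chords ℓ k q
    cut-count q = begin
      k                                                        ≡⟨ ∑-one k ⟨
      ∑ k (λ _ → 1)                                            ≤⟨ ∑-mono k (λ i → cut-or-joined i q) ⟩
      ∑ k (λ i → cutsIn ℓ i q + δ (ℓ i) (ℓ (i + q)))           ≡⟨ ∑-add k (λ i → cutsIn ℓ i q) (λ i → δ (ℓ i) (ℓ (i + q))) ⟩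
      ∑ k (λ i → cutsIn ℓ i q) + chords ℓ k q                  ≡⟨ cong (_+ chords ℓ k q) (∑-swap k q (λ i t → cut ℓ (i + t))) ⟩
      -- As the window moves, its position `t` runs once through the whole cycle; each of the `q`
      -- positions therefore sees every cut.
      ∑ q (λ t → ∑ k (λ i → cut ℓ (i + t))) + chords ℓ k q     ≡⟨ cong (_+ chords ℓ k q) (∑-cong q λ t _ →
                                                                    trans (∑-cong k λ i _ → cong (cut ℓ) (+-comm i t)) (cutsIn-cycle t)) ⟩
      ∑ q (λ _ → cuts ℓ k) + chords ℓ k q                      ≡⟨ cong (_+ chords ℓ k q) (∑-const q) ⟩
      q * cuts ℓ k + chords ℓ k q                              ∎
      where
      open ≤-Reasoning
      open ℕ∑
      ∑-const : ∀ n {x} → ∑ n (λ _ → x) ≡ n * x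
      ∑-const zero    = refl
      ∑-const (suc n) = cong (_ +_) (∑-const n)
      ∑-one : ∀ n → ∑ n (λ _ → 1) ≡ n
      ∑-one n = trans (∑-const n) (*-identityʳ n)
      ∑-mono : ∀ n {f g : ℕ → ℕ} → (∀ i → f i ≤ g i) → ∑ n f ≤ ∑ n g
      ∑-mono zero    le = z≤n
      ∑-mono (suc n) le = +-mono-≤ (le 0) (∑-mono n (le ∘ suc))

-- Tight points for k = 3q + 1

module ThreeBlocks (r : ℕ) (ℓ : ℕ → ℕ) (per : Periodic ℓ (suc (3 * suc (suc r)))) where

  open Cuts ℓ

  q k : ℕ
  q = suc (suc r)
  k = suc (3 * q)

  -- On the face, z and z+q+2 are joined exactly if P z or Q z holds. In the
  -- alternating sum P z meets Q (z + 3q); what is left of them is U z and V z.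
  P Q U V : ℕ → Set
  P z = ℓ z ≡ ℓ (z + suc q) × ℓ (z + suc q) ≡ ℓ (z + suc (suc q))
  Q z = ℓ (suc z) ≡ ℓ (suc z + suc q) × ℓ z ≡ ℓ (suc z)
  U z = ℓ z ≡ ℓ (z + suc q) × ℓ (z + suc q) ≡ ℓ (z + suc (suc q)) × ℓ (z + 3 * q) ≢ ℓ z
  V z = ℓ z ≡ ℓ (z + suc q) × ℓ (z + suc q) ≢ ℓ (z + suc (suc q)) × ℓ (z + 3 * q) ≡ ℓ z

  P? : ∀ z → Dec (P z)
  P? z = (ℓ z ≟ _) ×-dec (_ ≟ _)
  Q? : ∀ z → Dec (Q z)
  Q? z = (ℓ (suc z) ≟ _) ×-dec (_ ≟ _)
  U? : ∀ z → Dec (U z)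
  U? z = (ℓ z ≟ _) ×-dec ((_ ≟ _) ×-dec ¬? (_ ≟ _))
  V? : ∀ z → Dec (V z)
  V? z = (ℓ z ≟ _) ×-dec (¬? (_ ≟ _) ×-dec (_ ≟ _))

  long : ℕ → ℕ
  long z = δ (ℓ z) (ℓ (z + suc (suc q)))

  at : ∀ {a b} → a ≡ b → ℓ a ≡ ℓ b
  at = cong ℓ

  -- Let Y be `ℓ z ≡ ℓ (z + suc q)`, C the second clause of `P z`, and A the equation
  -- `ℓ (z + 3 * q) ≡ ℓ z`. Since `z + 3 * q` is the node before `z`, `Q (z + 3 * q)` says Y ∧ A.
  -- Both sides count Y ∧ (C ∨ A), split once by C and once by A.
  P+V≡Q+U : ∀ z → ind (P? z) + ind (V? z) ≡ ind (Q? (z + 3 * q)) + ind (U? z)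
  P+V≡Q+U z = trans (lem (ℓ z ≟ _) (_ ≟ _) (_ ≟ _))
    (cong (_+ ind (U? z)) (ind-cong ((ℓ z ≟ ℓ (z + suc q)) ×-dec (ℓ (z + 3 * q) ≟ ℓ z)) (Q? (z + 3 * q))
      (λ (y , a) → trans wrap₀ (trans y (sym wrap₁)) , trans a (sym wrap₀))
      (λ (y , a) → trans (sym wrap₀) (trans y wrap₁) , trans a wrap₀)))
    where
    wrap₀ : ℓ (suc (z + 3 * q)) ≡ ℓ z
    wrap₀ = trans (at (sym (+-suc z (3 * q)))) (per z)
    wrap₁ : ℓ (suc (z + 3 * q) + suc q) ≡ ℓ (z + suc q)
    wrap₁ = trans (at (e z q)) (per (z + suc q))
      where e : ∀ z q → suc (z + 3 * q) + suc q ≡ z + suc q + suc (3 * q)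
            e = solve-∀
    lem : ∀ {Y C A : Set} (Y? : Dec Y) (C? : Dec C) (A? : Dec A) →
          ind (Y? ×-dec C?) + ind (Y? ×-dec (¬? C? ×-dec A?)) ≡ ind (Y? ×-dec A?) + ind (Y? ×-dec (C? ×-dec ¬? A?))
    lem (yes _) (yes _) (yes _) = refl
    lem (yes _) (yes _) (no  _) = refl
    lem (yes _) (no  _) (yes _) = refl
    lem (yes _) (no  _) (no  _) = refl
    lem (no  _) (yes _) (yes _) = refl
    lem (no  _) (yes _) (no  _) = refl
    lem (no  _) (no  _) (yes _) = refl
    lem (no  _) (no  _) (no  _) = refl

  1≤long-arc : ∀ z → 1 ≤ cutsIn ℓ z q → 1 ≤ cutsIn ℓ z (q + suc r)
  1≤long-arc z 1≤ = ≤-trans 1≤ (≤-trans (m≤m+n _ _) (≤-reflexive (sym (cutsIn-+ z q (suc r)))))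

  cycle-split : ∀ z m n → m + n ≡ k → cutsIn ℓ z m + cutsIn ℓ (z + m) n ≡ cuts ℓ k
  cycle-split z m n eq = trans (sym (cutsIn-+ z m n)) (trans (cong (cutsIn ℓ z) eq) (cutsIn-cycle per z))

  wrap : ∀ z → ℓ (z + suc (suc q) + (q + suc r)) ≡ ℓ z
  wrap z = trans (at (e z r)) (per z)
    where e : ∀ z r → z + suc (suc (suc (suc r))) + (suc (suc r) + suc r) ≡ z + suc (3 * suc (suc r))
          e = solve-∀

  arc-sum : suc (suc q) + (q + suc r) ≡ k
  arc-sum = e r
    where e : ∀ r → suc (suc (suc (suc r))) + (suc (suc r) + suc r) ≡ suc (3 * suc (suc r))
          e = solve-∀

  module Chordless (chordless : ∀ i → ℓ i ≢ ℓ (i + q)) (four : cuts ℓ k ≡ 4) where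

    window : ∀ i → 1 ≤ cutsIn ℓ i q
    window i = subst (1 ≤_) (trans (cong (cutsIn ℓ i q +_) (δ-≢ (chordless i))) (+-identityʳ _)) (cut-or-joined i q)

    -- If the first and the last edge of the arc from z to z + q + 2 were both cut, the window
    -- between them would supply a third cut. The complementary arc has equal end labels and
    -- contains a window, hence has two cuts. That makes five, but there are only four.
    long⇒P⊎Q : ∀ z → ℓ z ≡ ℓ (z + suc (suc q)) → P z ⊎ Q z
    long⇒P⊎Q z same with ℓ z ≟ ℓ (suc z) | ℓ (z + suc q) ≟ ℓ (z + suc (suc q))
    ... | yes a | _     = inj₂ (trans (sym a) (trans same (at (+-suc z (suc q)))) , a)
    ... | no ¬a | yes c = inj₁ (trans same (sym c) , c)
    ... | no ¬a | no ¬c = contradiction (cycle-split z (suc (suc q)) (q + suc r) arc-sum) λ total →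
      <⇒≢ (≤-certificate 0 (+-mono-≤ near far) (e (cutsIn ℓ z (suc (suc q))) (cutsIn ℓ (z + suc (suc q)) (q + suc r))))
          (sym (trans total four))
      where
      far : 2 ≤ cutsIn ℓ (z + suc (suc q)) (q + suc r)
      far = cutsIn-≥2 _ (q + suc r) (trans (sym same) (sym (wrap z))) (1≤long-arc _ (window _))
      near : 3 ≤ cutsIn ℓ z (suc (suc q))
      near = begin
        1 + 1 + 1                                                          ≤⟨ +-mono-≤ (+-monoʳ-≤ 1 (window (suc z)))
                                                                                (≤-reflexive (sym (cut-≢ λ c → ¬c (trans c′ (trans c (at (e₂ z q))))))) ⟩
        1 + cutsIn ℓ (suc z) q + cut ℓ (suc z + q)                         ≡⟨ cong₂ (λ x y → x + cutsIn ℓ (suc z) q + y) (cut-≢ ¬a) (cutsIn-1 (suc z + q)) ⟨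
        cut ℓ z + cutsIn ℓ (suc z) q + cutsIn ℓ (suc z + q) 1              ≡⟨ +-assoc (cut ℓ z) _ _ ⟩
        cut ℓ z + (cutsIn ℓ (suc z) q + cutsIn ℓ (suc z + q) 1)            ≡⟨ cong (cut ℓ z +_) (cutsIn-+ (suc z) q 1) ⟨
        cut ℓ z + cutsIn ℓ (suc z) (q + 1)                                 ≡⟨ cutsIn-suc z (q + 1) ⟨
        cutsIn ℓ z (suc (q + 1))                                           ≡⟨ cong (λ n → cutsIn ℓ z (suc n)) (+-comm q 1) ⟩
        cutsIn ℓ z (suc (suc q))                                           ∎
        where
        open ≤-Reasoning
        e₂ : ∀ z q → suc (suc z + q) ≡ z + suc (suc q)
        e₂ = solve-∀
        c′ : ℓ (z + suc q) ≡ ℓ (suc z + q)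
        c′ = at (+-suc z q)
      e : ∀ x y → x + y + (3 + 2) ≡ 5 + (x + y) + 0
      e = solve-∀

    -- The two cases exclude each other: together they would join the chord from `suc z` to
    -- `suc z + q`.
    long≡P+Q : ∀ z → long z ≡ ind (P? z) + ind (Q? z)
    long≡P+Q z with P? z | Q? z
    ... | yes (y , _) | yes (_ , a) = contradiction (trans (sym a) (trans y (at (+-suc z q)))) (chordless (suc z))
    ... | yes (y , c) | no _        = δ-≡ (trans y c)
    ... | no _ | yes (y , a)        = δ-≡ (trans a (trans y (at (sym (+-suc z (suc q))))))
    ... | no ¬p | no ¬q             = δ-≢ λ same → [ ¬p , ¬q ]′ (long⇒P⊎Q z same)

    -- The cuts at z and z+3q and one in each of the windows after z+1 and z+2q
    -- exhaust the cycle.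
    gap : ∀ z → ℓ z ≢ ℓ (suc z) → ℓ (z + 3 * q) ≢ ℓ z → cutsIn ℓ (z + suc q) (suc r) ≡ 0
    gap z first last = n≤0⇒n≡0 (squeeze _ (cutsIn ℓ (suc z) q) _ (cutsIn ℓ (z + 2 * q) q) _
      total (cut-≢ first) (cut-≢ λ eq → last (trans eq (trans (at (sym (+-suc z (3 * q)))) (per z)))) (window _) (window _))
      where
      open ≡-Reasoning
      squeeze : ∀ a b d g h → a + (b + (d + (g + h))) ≡ 4 → a ≡ 1 → h ≡ 1 → 1 ≤ b → 1 ≤ g → d ≤ 0
      squeeze a b d g h eq refl refl 1≤b 1≤g = ≤-certificate 0 (+-mono-≤ (+-mono-≤ 1≤b 1≤g) (≤-reflexive eq)) (e b d g)
        where e : ∀ b d g → 0 + (1 + 1 + (1 + (b + (d + (g + 1))))) ≡ d + (b + g + 4) + 0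
              e = solve-∀
      e₂ : ∀ z r → z + suc (suc (suc r)) + suc r ≡ z + 2 * suc (suc r)
      e₂ = solve-∀
      e₃ : ∀ z q → z + 2 * q + q ≡ z + 3 * q
      e₃ = solve-∀
      e₄ : ∀ r → 1 + (suc (suc r) + (suc r + (suc (suc r) + 1))) ≡ suc (3 * suc (suc r))
      e₄ = solve-∀
      total : cut ℓ z + (cutsIn ℓ (suc z) q + (cutsIn ℓ (z + suc q) (suc r) + (cutsIn ℓ (z + 2 * q) q + cut ℓ (z + 3 * q)))) ≡ 4
      total = sym (begin
        4                                      ≡⟨ four ⟨
        cuts ℓ k                               ≡⟨ cutsIn-cycle per z ⟨
        cutsIn ℓ z k                           ≡⟨ cong (cutsIn ℓ z) (e₄ r) ⟨
        cutsIn ℓ z (suc (q + (suc r + (q + 1)))) ≡⟨ cutsIn-suc z (q + (suc r + (q + 1))) ⟩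
        cut ℓ z + cutsIn ℓ (suc z) (q + (suc r + (q + 1))) ≡⟨ cong (cut ℓ z +_) (begin
          cutsIn ℓ (suc z) (q + (suc r + (q + 1)))           ≡⟨ cutsIn-+ (suc z) q _ ⟩
          cutsIn ℓ (suc z) q + cutsIn ℓ (suc z + q) (suc r + (q + 1)) ≡⟨ cong (cutsIn ℓ (suc z) q +_) (begin
            cutsIn ℓ (suc z + q) (suc r + (q + 1))            ≡⟨ cong (λ i → cutsIn ℓ i (suc r + (q + 1))) (+-suc z q) ⟨
            cutsIn ℓ (z + suc q) (suc r + (q + 1))            ≡⟨ cutsIn-+ (z + suc q) (suc r) _ ⟩
            cutsIn ℓ (z + suc q) (suc r) + cutsIn ℓ (z + suc q + suc r) (q + 1) ≡⟨ cong (cutsIn ℓ (z + suc q) (suc r) +_) (begin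
              cutsIn ℓ (z + suc q + suc r) (q + 1)             ≡⟨ cong (λ i → cutsIn ℓ i (q + 1)) (e₂ z r) ⟩
              cutsIn ℓ (z + 2 * q) (q + 1)                     ≡⟨ cutsIn-+ (z + 2 * q) q 1 ⟩
              cutsIn ℓ (z + 2 * q) q + cutsIn ℓ (z + 2 * q + q) 1 ≡⟨ cong (cutsIn ℓ (z + 2 * q) q +_) (trans (cutsIn-1 _) (cong (cut ℓ) (e₃ z q))) ⟩
              cutsIn ℓ (z + 2 * q) q + cut ℓ (z + 3 * q)       ∎) ⟩
            cutsIn ℓ (z + suc q) (suc r) + (cutsIn ℓ (z + 2 * q) q + cut ℓ (z + 3 * q)) ∎) ⟩
          cutsIn ℓ (suc z) q + (cutsIn ℓ (z + suc q) (suc r) + (cutsIn ℓ (z + 2 * q) q + cut ℓ (z + 3 * q))) ∎) ⟩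
        cut ℓ z + (cutsIn ℓ (suc z) q + (cutsIn ℓ (z + suc q) (suc r) + (cutsIn ℓ (z + 2 * q) q + cut ℓ (z + 3 * q)))) ∎)

    gap-joined : ∀ z → cutsIn ℓ (z + suc q) (suc r) ≡ 0 →
      ℓ (z + suc q) ≡ ℓ (z + 2 * q) × ℓ (z + suc q) ≡ ℓ (suc (z + suc q)) × ℓ (z + (suc q + r)) ≡ ℓ (z + 2 * q)
    gap-joined z eq = all , cut≡0⇒≡ (m+n≡0⇒m≡0 _ (trans (sym (cutsIn-suc (z + suc q) r)) eq)) ,
      trans (at (sym (+-assoc z (suc q) r))) (trans (sym (cutsIn≡0⇒≡ r (z + suc q) (m+n≡0⇒m≡0 _ (trans (sym (cutsIn-+ (z + suc q) r 1))
        (trans (cong (cutsIn ℓ (z + suc q)) (+-comm r 1)) eq))))) all)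
      where
      e : ∀ z r → z + suc (suc (suc r)) + suc r ≡ z + 2 * suc (suc r)
      e = solve-∀
      all = trans (cutsIn≡0⇒≡ (suc r) (z + suc q) eq) (at (e z r))

    -- `U z` and `V (z + 2 * q)` describe one configuration: the edges on both sides of z are cut,
    -- while the whole run from z + q + 1 to z + 2q has the label of z. `U` inspects the near end of
    -- this run and `V` the far end; `gap` shows that the run is uncut in between.
    U⇒V : ∀ z → U z → V (z + 2 * q)
    U⇒V z (y , c , ¬a) = trans (sym (trans y all)) (sym w₁) , (λ eq → first (trans (sym w₁) (trans eq w₂))) , trans w₃ prev
      where
      first : ℓ z ≢ ℓ (suc z)
      first eq = chordless (suc z) (trans (sym eq) (trans y (at (+-suc z q))))
      joined = gap-joined z (gap z first ¬a)
      all = proj₁ joined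
      prev = proj₂ (proj₂ joined)
      w₁ : ℓ (z + 2 * q + suc q) ≡ ℓ z
      w₁ = trans (at (e z q)) (per z)
        where e : ∀ z q → z + 2 * q + suc q ≡ z + suc (3 * q)
              e = solve-∀
      w₂ : ℓ (z + 2 * q + suc (suc q)) ≡ ℓ (suc z)
      w₂ = trans (at (e z q)) (per (suc z))
        where e : ∀ z q → z + 2 * q + suc (suc q) ≡ suc z + suc (3 * q)
              e = solve-∀
      w₃ : ℓ (z + 2 * q + 3 * q) ≡ ℓ (z + (suc q + r))
      w₃ = trans (at (e z r)) (per (z + (suc q + r)))
        where e : ∀ z r → z + 2 * suc (suc r) + 3 * suc (suc r) ≡ z + (suc (suc (suc r)) + r) + suc (3 * suc (suc r))
              e = solve-∀

    V⇒U : ∀ z → V (z + 2 * q) → U z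
    V⇒U z (y , ¬c , _) = trans (sym y′) (sym (proj₁ joined)) , trans (proj₁ (proj₂ joined)) (at (sym (+-suc z (suc q)))) , last
      where
      w₁ : ℓ (z + 2 * q + suc q) ≡ ℓ z
      w₁ = trans (at (e z q)) (per z)
        where e : ∀ z q → z + 2 * q + suc q ≡ z + suc (3 * q)
              e = solve-∀
      w₂ : ℓ (z + 2 * q + suc (suc q)) ≡ ℓ (suc z)
      w₂ = trans (at (e z q)) (per (suc z))
        where e : ∀ z q → z + 2 * q + suc (suc q) ≡ suc z + suc (3 * q)
              e = solve-∀
      y′ : ℓ (z + 2 * q) ≡ ℓ z
      y′ = trans y w₁
      last : ℓ (z + 3 * q) ≢ ℓ z
      last eq = chordless (z + 2 * q) (trans y′ (trans (sym eq) (at (e z q))))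
        where e : ∀ z q → z + 3 * q ≡ z + 2 * q + q
              e = solve-∀
      joined = gap-joined z (gap z (λ eq → ¬c (trans w₁ (trans eq (sym w₂)))) last)

    U≡V : ∀ z → ind (U? z) ≡ ind (V? (z + 2 * q))
    U≡V z = ind-cong (U? z) (V? (z + 2 * q)) (U⇒V z) (V⇒U z)

  module OneChord (three : cuts ℓ k ≡ 3) (one : chords ℓ k q ≡ 1) where

    ¬two-chords : ∀ i → ℓ i ≡ ℓ (i + q) → ℓ (suc i) ≢ ℓ (suc i + q)
    ¬two-chords i c₁ c₂ = contradiction (sym (trans (sym (trans (sum≡ i) one)) (cong₂ (λ x y → x + (y + rest)) (first c₁) (second c₂)))) λ ()
      where
      f : ℕ → ℕ
      f j = δ (ℓ j) (ℓ (j + q))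
      sum≡ : ∀ i → ℕ∑.∑ k (λ t → f (i + t)) ≡ chords ℓ k q
      sum≡ = ℕ∑.∑-rotate k f (chord-periodic per q)
      rest = ℕ∑.∑ (suc r + (q + (q + 0))) (λ t → f (i + suc (suc t)))
      first : ℓ i ≡ ℓ (i + q) → f (i + 0) ≡ 1
      first eq = trans (cong f (+-identityʳ i)) (δ-≡ eq)
      second : ℓ (suc i) ≡ ℓ (suc i + q) → f (i + 1) ≡ 1
      second eq = trans (cong f (+-comm i 1)) (δ-≡ eq)

    -- `q + 1` consecutive uncut edges would join two consecutive chords.
    ¬uncut : ∀ z n → cutsIn ℓ z (suc q + n) ≢ 0
    ¬uncut z n eq = ¬two-chords z (cutsIn≡0⇒≡ q z (m+n≡0⇒m≡0 _ (trans (sym (cutsIn-+ z q 1)) (trans (cong (cutsIn ℓ z) (+-comm q 1)) eq′))))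
      (cutsIn≡0⇒≡ q (suc z) (m+n≡0⇒n≡0 (cut ℓ z) (trans (sym (cutsIn-suc z q)) eq′)))
      where
      eq′ : cutsIn ℓ z (suc q) ≡ 0
      eq′ = m+n≡0⇒m≡0 _ (trans (sym (cutsIn-+ z (suc q) n)) eq)

    -- Both arcs between z and z + q + 2 have more than q edges, so each contains a cut; with equal
    -- end labels each then contains two, but there are only three cuts.
    ¬long : ∀ z → ℓ z ≢ ℓ (z + suc (suc q))
    ¬long z same = <⇒≢ (≤-certificate 0 (+-mono-≤ near far) (e (cutsIn ℓ z (suc (suc q))) (cutsIn ℓ (z + suc (suc q)) (q + suc r))))
      (sym (trans (cycle-split z (suc (suc q)) (q + suc r) arc-sum) three))
      where
      e : ∀ x y → x + y + (2 + 2) ≡ 4 + (x + y) + 0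
      e = solve-∀
      near : 2 ≤ cutsIn ℓ z (suc (suc q))
      near = cutsIn-≥2 z _ same (n≢0⇒n>0 (subst (λ n → cutsIn ℓ z n ≢ 0) (+-comm (suc q) 1) (¬uncut z 1)))
      far : 2 ≤ cutsIn ℓ (z + suc (suc q)) (q + suc r)
      far = cutsIn-≥2 _ (q + suc r) (trans (sym same) (sym (wrap z)))
        (n≢0⇒n>0 (subst (λ n → cutsIn ℓ (z + suc (suc q)) n ≢ 0) (sym (+-suc q r)) (¬uncut _ r)))

-- The alternating sum over edges at distance q + 2

module Alternating (F : DecField) where

  open Linear F public

  ι : ℕ → K
  ι zero    = 𝟘
  ι (suc n) = 𝟙 ⊞ ι n

  ι-+ : ∀ m n → ι (m + n) ≡ ι m ⊞ ι n
  ι-+ zero    n = sym (⊞-identityˡ _)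
  ι-+ (suc m) n = trans (cong (𝟙 ⊞_) (ι-+ m n)) (sym (⊞-assoc _ _ _))

  ι-1 : ι 1 ≡ 𝟙
  ι-1 = ⊞-identityʳ 𝟙

  ι-∑ : ∀ n (f : ℕ → ℕ) → ι (ℕ∑.∑ n f) ≡ ∑ n (ι ∘ f)
  ι-∑ zero    f = refl
  ι-∑ (suc n) f = trans (ι-+ (f 0) _) (cong (ι (f 0) ⊞_) (ι-∑ n (f ∘ suc)))

  ∑-⊟ : ∀ n (f : ℕ → K) → ∑ n (λ i → ⊟ f i) ≡ ⊟ ∑ n f
  ∑-⊟ zero    f = sym -0#≈0#
  ∑-⊟ (suc n) f = trans (cong (⊟ f 0 ⊞_) (∑-⊟ n (f ∘ suc))) (-‿+-comm _ _)

  ∑-·ˡ : ∀ n x (f : ℕ → K) → ∑ n (λ i → x · f i) ≡ x · ∑ n f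
  ∑-·ˡ n x f = sym (*-distribˡ-sum {n} x _)

  sgn : ℕ → K
  sgn zero    = 𝟙
  sgn (suc n) = ⊟ sgn n

  even⊎sgn : ∀ n → 2 ∣ n ⊎ sgn n ≡ ⊟ 𝟙
  even⊎sgn zero          = inj₁ (divides 0 refl)
  even⊎sgn (suc zero)    = inj₂ refl
  even⊎sgn (suc (suc n)) with even⊎sgn n
  ... | inj₁ (divides h n≡2h) = inj₁ (divides (suc h) (cong (2 +_) n≡2h))
  ... | inj₂ eq               = inj₂ (trans (-‿involutive (sgn n)) eq)

  module _ (q : ℕ) (odd : sgn q ≡ ⊟ 𝟙) where

    sgn-+odd : ∀ z → sgn (z + q) ≡ ⊟ sgn z
    sgn-+odd zero    = odd
    sgn-+odd (suc z) = cong ⊟_ (sgn-+odd z)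

    sgn-+2odd : ∀ z → sgn (z + 2 * q) ≡ sgn z
    sgn-+2odd z = begin
      sgn (z + 2 * q)   ≡⟨ cong sgn (e z q) ⟩
      sgn (z + q + q)   ≡⟨ sgn-+odd (z + q) ⟩
      ⊟ sgn (z + q)     ≡⟨ cong ⊟_ (sgn-+odd z) ⟩
      ⊟ ⊟ sgn z         ≡⟨ -‿involutive (sgn z) ⟩
      sgn z             ∎
      where
      open ≡-Reasoning
      e : ∀ z q → z + 2 * q ≡ z + q + q
      e = solve-∀

    sgn-+3odd : ∀ z → sgn (z + 3 * q) ≡ ⊟ sgn z
    sgn-+3odd z = trans (cong sgn (e z q)) (trans (sgn-+odd (z + 2 * q)) (cong ⊟_ (sgn-+2odd z)))
      where
      e : ∀ z q → z + 3 * q ≡ z + 2 * q + q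
      e = solve-∀

    sgn-periodic : ∀ z → sgn (z + suc (3 * q)) ≡ sgn z
    sgn-periodic z = trans (cong sgn (+-suc z (3 * q))) (trans (cong ⊟_ (sgn-+3odd z)) (-‿involutive (sgn z)))

  module _ (r : ℕ) (ℓ : ℕ → ℕ) (per : Periodic ℓ (suc (3 * suc (suc r))))
           (tight : cuts ℓ (suc (3 * suc (suc r))) + chords ℓ (suc (3 * suc (suc r))) (suc (suc r)) ≡ 4)
           (odd : sgn (suc (suc r)) ≡ ⊟ 𝟙) where

    open ThreeBlocks r ℓ per

    private
      S : (ℕ → ℕ) → K
      S f = ∑ k (λ z → sgn z · ι (f z))

      S-cong : ∀ {f g : ℕ → ℕ} → (∀ z → f z ≡ g z) → S f ≡ S g
      S-cong eq = ∑-cong k λ z _ → cong (λ x → sgn z · ι x) (eq z)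

      S-+ : ∀ f g → S (λ z → f z + g z) ≡ S f ⊞ S g
      S-+ f g = trans (∑-cong k λ z _ → trans (cong (sgn z ·_) (ι-+ (f z) (g z))) (distribˡ _ _ _))
                      (∑-add k (λ z → sgn z · ι (f z)) (λ z → sgn z · ι (g z)))

      module _ (f : ℕ → ℕ) (f-per : ∀ z → f (z + k) ≡ f z) where

        rotated : ∀ p → ∑ k (λ z → sgn (z + p) · ι (f (z + p))) ≡ S f
        rotated p = trans (∑-cong k λ z _ → cong (λ y → sgn y · ι (f y)) (+-comm z p))
          (∑-rotate k (λ z → sgn z · ι (f z)) (λ i → cong₂ _·_ (sgn-periodic q odd i) (cong ι (f-per i))) p)

        -- Translation by the even number `2 * q` keeps every sign; translation by the odd number
        -- `3 * q`, in the next lemma, reverses every sign.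
        S-rotate₂ : S (λ z → f (z + 2 * q)) ≡ S f
        S-rotate₂ = trans (∑-cong k λ z _ → cong (_· ι (f (z + 2 * q))) (sym (sgn-+2odd q odd z))) (rotated (2 * q))

        S-rotate₃ : ⊟ S (λ z → f (z + 3 * q)) ≡ S f
        S-rotate₃ = trans (sym (∑-⊟ k λ z → sgn z · ι (f (z + 3 * q))))
          (trans (∑-cong k λ z _ → trans (-‿distribˡ-* _ _) (cong (_· ι (f (z + 3 * q))) (sym (sgn-+3odd q odd z))))
                 (rotated (3 * q)))

      shift : ∀ n z → ℓ (z + k + n) ≡ ℓ (z + n)
      shift n z = trans (cong ℓ (e z k n)) (per (z + n))
        where e : ∀ z k n → z + k + n ≡ z + n + k
              e = solve-∀

      Q-periodic : ∀ z → ind (Q? (z + k)) ≡ ind (Q? z)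
      Q-periodic z = ind-cong (Q? (z + k)) (Q? z)
        (λ (y , a) → trans (sym s₁) (trans y s₂) , trans (sym s₀) (trans a s₁))
        (λ (y , a) → trans s₁ (trans y (sym s₂)) , trans s₀ (trans a (sym s₁)))
        where
        s₀ = per z
        s₁ = per (suc z)
        s₂ = shift (suc q) (suc z)

      V-periodic : ∀ z → ind (V? (z + k)) ≡ ind (V? z)
      V-periodic z = ind-cong (V? (z + k)) (V? z)
        (λ (y , c , a) → trans (sym s₀) (trans y s₁) , (λ eq → c (trans s₁ (trans eq (sym s₂)))) , trans (sym s₃) (trans a s₀))
        (λ (y , c , a) → trans s₀ (trans y (sym s₁)) , (λ eq → c (trans (sym s₁) (trans eq s₂))) , trans s₃ (trans a (sym s₀)))
        where
        s₀ = per z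
        s₁ = shift (suc q) z
        s₂ = shift (suc (suc q)) z
        s₃ = shift (3 * q) z

    -- Tight points are sorted by their number of joined chords. Without a chord, `U` cancels `V`
    -- after a translation by `2 * q`, and then `P` cancels `Q` after the sign-reversing translation
    -- by `3 * q`. With one chord every term is 0. Two or more chords leave at most two cuts, which
    -- contradicts `cut-count`.
    alternating-long : ∑ k (λ z → sgn z · ι (long z)) ≡ 𝟘
    alternating-long = by-chords _ refl
      where
      by-chords : ∀ c → chords ℓ k q ≡ c → S long ≡ 𝟘
      by-chords zero chords≡ = begin
        S long                                           ≡⟨ S-cong long≡P+Q ⟩
        S (λ z → p z + q′ z)                             ≡⟨ S-+ p q′ ⟩
        S p ⊞ S q′                                       ≡⟨ cong₂ _⊞_ S-p (sym (S-rotate₃ q′ Q-periodic)) ⟩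
        S (λ z → q′ (z + 3 * q)) ⊞ ⊟ S (λ z → q′ (z + 3 * q)) ≡⟨ ⊟-inverseʳ _ ⟩
        𝟘                                                ∎
        where
        open ≡-Reasoning
        chordless : ∀ i → ℓ i ≢ ℓ (i + q)
        chordless i = subst (λ j → ℓ j ≢ ℓ (j + q)) (+-identityʳ i) (δ≡0⇒≢ (m+n≡0⇒m≡0 _
          (trans (ℕ∑.∑-rotate k (λ j → δ (ℓ j) (ℓ (j + q))) (Cuts.chord-periodic ℓ per q) i) chords≡)))
        open Chordless chordless (trans (sym (+-identityʳ _)) (trans (cong (cuts ℓ k +_) (sym chords≡)) tight))
        p q′ u v : ℕ → ℕ
        p z = ind (P? z)
        q′ z = ind (Q? z)
        u z = ind (U? z)
        v z = ind (V? z)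
        S-p : S p ≡ S (λ z → q′ (z + 3 * q))
        S-p = ⊞-cancelʳ (S v) _ _ (begin
          S p ⊞ S v                                  ≡⟨ S-+ p v ⟨
          S (λ z → p z + v z)                        ≡⟨ S-cong P+V≡Q+U ⟩
          S (λ z → q′ (z + 3 * q) + u z)             ≡⟨ S-+ (λ z → q′ (z + 3 * q)) u ⟩
          S (λ z → q′ (z + 3 * q)) ⊞ S u             ≡⟨ cong (S (λ z → q′ (z + 3 * q)) ⊞_) (trans (S-cong U≡V) (S-rotate₂ v V-periodic)) ⟩
          S (λ z → q′ (z + 3 * q)) ⊞ S v             ∎)
      by-chords (suc zero) chords≡ = ∑-zero k λ z _ → trans (cong (λ x → sgn z · ι x) (δ-≢ (¬long z))) (zeroʳ _)
        where
        open OneChord (suc-injective (trans (+-comm 1 _) (trans (cong (cuts ℓ k +_) (sym chords≡)) tight))) chords≡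
      by-chords (suc (suc c)) chords≡ = contradiction (Cuts.cut-count ℓ per q)
        (<⇒≱ (bound (cuts ℓ k) c (trans (cong (cuts ℓ k +_) (sym chords≡)) tight) chords≡))
        where
        bound : ∀ a c → a + suc (suc c) ≡ 4 → chords ℓ k q ≡ suc (suc c) → q * a + chords ℓ k q < k
        bound a c eq chords≡ rewrite chords≡ =
          ≤-certificate r (+-mono-≤ (*-monoʳ-≤ (1 + r) a≤2) (≤-reflexive eq)) (e a c r)
          where
          e : ∀ a c r → suc (3 * suc (suc r)) + ((1 + r) * a + (a + suc (suc c))) ≡ suc (suc (suc r) * a + suc (suc c)) + ((1 + r) * 2 + 4) + r
          e = solve-∀
          e₂ : ∀ a c → 2 + (a + suc (suc c)) ≡ a + 4 + c
          e₂ = solve-∀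
          a≤2 : a ≤ 2
          a≤2 = ≤-certificate c (≤-reflexive eq) (e₂ a c)

-- Linear combinations of partition vectors

pairs : ℕ → List (ℕ × ℕ)
pairs zero    = []
pairs (suc k) = map (_, k) (upTo k) ++ pairs k

k+kC2 : ∀ k → k + k C 2 ≡ suc k C 2
k+kC2 k = trans (cong (_+ k C 2) (sym (nC1≡n k))) (nCk+nC[k+1]≡[n+1]C[k+1] k 1)

length-pairs : ∀ k → length (pairs k) ≡ k C 2
length-pairs zero    = refl
length-pairs (suc k) = begin
  length (map (_, k) (upTo k) ++ pairs k)        ≡⟨ length-++ (map (_, k) (upTo k)) ⟩
  length (map (_, k) (upTo k)) + length (pairs k) ≡⟨ cong₂ _+_ (trans (length-map (_, k) (upTo k)) (length-upTo k)) (length-pairs k) ⟩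
  k + k C 2                                      ≡⟨ k+kC2 k ⟩
  suc k C 2                                      ∎
  where open ≡-Reasoning

∈-pairs : ∀ {i j} k → i < j → j < k → (i , j) ∈ pairs k
∈-pairs {i} {j} (suc k) i<j (s≤s j≤k) with j ≟ k
... | yes refl = ∈-++⁺ˡ (∈-map⁺ (_, k) (∈-upTo⁺ i<j))
... | no j≢k   = ∈-++⁺ʳ (map (_, k) (upTo k)) (∈-pairs k i<j (≤∧≢⇒< j≤k j≢k))

_≟×_ : DecidableEquality (ℕ × ℕ)
_≟×_ = ≡-dec _≟_ _≟_

remove : ℕ × ℕ → List (ℕ × ℕ) → List (ℕ × ℕ)
remove e = filter (λ f → ¬? (f ≟× e))

length-remove : ∀ {e es} → e ∈ es → length (remove e es) < length es
length-remove {e} {es} e∈es = filter-notAll (λ f → ¬? (f ≟× e)) es (Any.map (λ { refl f≢e → f≢e refl }) e∈es)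

∈-remove : ∀ {e f es} → f ∈ es → f ≢ e → f ∈ remove e es
∈-remove {e} = ∈-filter⁺ (λ f → ¬? (f ≟× e))

m≤n⊎excess : ∀ m n → m < n ⊎ ∃ λ o → m ≡ o + n
m≤n⊎excess m n with m <? n
... | yes m<n = inj₁ m<n
... | no ¬m<n = inj₂ (m ∸ n , sym (m∸n+n≡m (≮⇒≥ ¬m<n)))

module Combinations (F : DecField) where

  open Alternating F public

  module Combination {m k : ℕ} (ℓ : Fin m → ℕ → ℕ) (per : ∀ t → Periodic (ℓ t) k)
                     (c : Fin m → K) (Σc : sum c ≡ 𝟘) where

    -- Coordinates of a combination of partition vectors whose weights sum to 0, that is, of a
    -- direction parallel to the affine hull of these points.
    y : ℕ → ℕ → K
    y i j = c ∙ (λ t → ι (δ (ℓ t i) (ℓ t j)))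

    y-sym : ∀ i j → y i j ≡ y j i
    y-sym i j = sum-cong-≗ λ t → cong (λ x → c t · ι x) (δ-sym (ℓ t i) (ℓ t j))

    y-periodicʳ : ∀ i j → y i (j + k) ≡ y i j
    y-periodicʳ i j = sum-cong-≗ λ t → cong (λ x → c t · ι (δ (ℓ t i) x)) (per t j)

    -- If i + d wraps around the cycle, the increasing pair is (i + d - k , i).
    vanish : ∀ {Exc : ℕ → ℕ → Set} → (∀ i j → i < j → j < k → ¬ Exc i j → y i j ≡ 𝟘) →
             ∀ i d → 0 < d → d < k → i < k → (i + d < k → ¬ Exc i (i + d)) →
             (∀ o → i + d ≡ o + k → ¬ Exc o i) → y i (i + d) ≡ 𝟘
    vanish zeros i d 0<d d<k i<k exc₁ exc₂ with m≤n⊎excess (i + d) k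
    ... | inj₁ lt = zeros i (i + d) (m<m+n i 0<d) lt (exc₁ lt)
    ... | inj₂ (o , eq) = begin
      y i (i + d)  ≡⟨ cong (y i) eq ⟩
      y i (o + k)  ≡⟨ y-periodicʳ i o ⟩
      y i o        ≡⟨ y-sym i o ⟩
      y o i        ≡⟨ zeros o i (+-cancelʳ-< k o i (subst (_< i + k) eq (+-monoʳ-< i d<k))) i<k (exc₂ o eq) ⟩
      𝟘            ∎
      where open ≡-Reasoning

    ∑-exchange : ∀ n (w : ℕ → K) (f : Fin m → ℕ → K) →
      ∑ n (λ i → w i · (c ∙ (λ t → f t i))) ≡ c ∙ (λ t → ∑ n (λ i → w i · f t i))
    ∑-exchange n w f = ∙-exchange {m} {n} (w ∘ toℕ) c (λ t i → f t (toℕ i))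

    ∑y : ∀ (s : ℕ → ℕ) → ∑ k (λ i → y i (s i)) ≡ c ∙ (λ t → ι (ℕ∑.∑ k (λ i → δ (ℓ t i) (ℓ t (s i)))))
    ∑y s = begin
      ∑ k (λ i → y i (s i))                                             ≡⟨ ∑-cong k (λ i _ → sym (·-identityˡ (y i (s i)))) ⟩
      ∑ k (λ i → 𝟙 · y i (s i))                                         ≡⟨ ∑-exchange k (λ _ → 𝟙) (λ t i → ι (δ (ℓ t i) (ℓ t (s i)))) ⟩
      c ∙ (λ t → ∑ k (λ i → 𝟙 · ι (δ (ℓ t i) (ℓ t (s i)))))             ≡⟨ sum-cong-≗ (λ t → cong (c t ·_) (trans
                                                                            (∑-cong k λ i _ → ·-identityˡ (ι (δ (ℓ t i) (ℓ t (s i)))))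
                                                                            (sym (ι-∑ k λ i → δ (ℓ t i) (ℓ t (s i)))))) ⟩
      c ∙ (λ t → ι (ℕ∑.∑ k (λ i → δ (ℓ t i) (ℓ t (s i)))))               ∎
      where open ≡-Reasoning

    c∙const : ∀ x → c ∙ (λ _ → x) ≡ 𝟘
    c∙const x = trans (sym (*-distribʳ-sum x c)) (trans (cong (_· x) Σc) (zeroˡ x))

    module OnFace {q γ : ℕ} (tight : ∀ t → cuts (ℓ t) k + chords (ℓ t) k q ≡ γ) where

      -- Since the weights sum to 0, the constants `γ` and `k` drop out of the tight equation and
      -- only its linear part remains.
      cycle≡chords : ∑ k (λ i → y i (i + 1)) ≡ ∑ k (λ i → y i (i + q))
      cycle≡chords = begin
        ∑ k (λ i → y i (i + 1))       ≡⟨ ∑y (_+ 1) ⟩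
        c ∙ (λ t → ι (S₁ t))          ≡⟨ ⊞-identityʳ _ ⟨
        c ∙ (λ t → ι (S₁ t)) ⊞ 𝟘      ≡⟨ cong (c ∙ (λ t → ι (S₁ t)) ⊞_) (c∙const (ι γ)) ⟨
        c ∙ (λ t → ι (S₁ t)) ⊞ c ∙ (λ _ → ι γ)   ≡⟨ ∙-add (λ t → ι (S₁ t)) (λ _ → ι γ) ⟨
        c ∙ (λ t → ι (S₁ t) ⊞ ι γ)    ≡⟨ sum-cong-≗ (λ t → cong (c t ·_) (trans (sym (ι-+ (S₁ t) γ)) (trans (cong ι (balance t)) (ι-+ (Sq t) k)))) ⟩
        c ∙ (λ t → ι (Sq t) ⊞ ι k)    ≡⟨ ∙-add (λ t → ι (Sq t)) (λ _ → ι k) ⟩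
        c ∙ (λ t → ι (Sq t)) ⊞ c ∙ (λ _ → ι k)  ≡⟨ cong (c ∙ (λ t → ι (Sq t)) ⊞_) (c∙const (ι k)) ⟩
        c ∙ (λ t → ι (Sq t)) ⊞ 𝟘      ≡⟨ ⊞-identityʳ _ ⟩
        c ∙ (λ t → ι (Sq t))          ≡⟨ ∑y (_+ q) ⟨
        ∑ k (λ i → y i (i + q))       ∎
        where
        open ≡-Reasoning
        S₁ Sq : Fin m → ℕ
        S₁ t = ℕ∑.∑ k (λ i → δ (ℓ t i) (ℓ t (i + 1)))
        Sq t = chords (ℓ t) k q
        ∙-add : ∀ f g → c ∙ (λ t → f t ⊞ g t) ≡ c ∙ f ⊞ c ∙ g
        ∙-add f g = trans (sum-cong-≗ λ t → distribˡ (c t) (f t) (g t)) (∑-distrib-+ (λ t → c t · f t) (λ t → c t · g t))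
        balance : ∀ t → S₁ t + γ ≡ Sq t + k
        balance t = begin
          S₁ t + γ                                ≡⟨ cong (S₁ t +_) (tight t) ⟨
          S₁ t + (cuts (ℓ t) k + Sq t)            ≡⟨ rearrange (S₁ t) (cuts (ℓ t) k) (Sq t) ⟩
          Sq t + (cuts (ℓ t) k + S₁ t)            ≡⟨ cong (Sq t +_) (Cuts.cuts+joins (ℓ t) k) ⟩
          Sq t + k                                ∎
          where
          rearrange : ∀ a b d → a + (b + d) ≡ d + (b + a)
          rearrange = solve-∀

      -- In `cycle≡chords` the pair {0,1} occurs once on the left and never on the right, because 2
      -- ≤ q and q + 2 ≤ k; every other term is 0 by hypothesis.
      vanish-01 : 2 ≤ q → 2 * q ≤ k → (∀ i j → i < j → j < k → ¬ (i ≡ 0 × j ≡ 1) → y i j ≡ 𝟘) → y 0 1 ≡ 𝟘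
      vanish-01 2≤q 2q≤k zeros = begin
        y 0 1                      ≡⟨ ∑-single k 0 (λ i → y i (i + 1)) (<-trans z<s 1<k) (λ i i<k i≢0 →
                                        vanish zeros i 1 z<s 1<k i<k (λ _ (i≡0 , _) → i≢0 i≡0)
                                          (λ { o eq (refl , refl) → <⇒≱ q<k (≤-trans (≤-reflexive (sym eq)) 2≤q) })) ⟨
        ∑ k (λ i → y i (i + 1))    ≡⟨ cycle≡chords ⟩
        ∑ k (λ i → y i (i + q))    ≡⟨ ∑-zero k (λ i i<k →
                                        vanish zeros i q (<⇒≤ 2≤q) q<k i<k
                                          (λ { _ (refl , refl) → <⇒≢ 2≤q refl })
                                          (λ { o eq (refl , refl) → <⇒≱ (subst (_≤ k) (+-comm q 2) q+2≤k) (≤-reflexive (sym eq)) })) ⟩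
        𝟘                          ∎
        where
        open ≡-Reasoning
        q+2≤k : q + 2 ≤ k
        q+2≤k = ≤-certificate 0 (+-mono-≤ 2≤q 2q≤k) (e q k)
          where e : ∀ q k → k + (2 + 2 * q) ≡ q + 2 + (q + k) + 0
                e = solve-∀
        q<k : q < k
        q<k = ≤-certificate 1 q+2≤k (e q k)
          where e : ∀ q k → k + (q + 2) ≡ suc q + k + 1
                e = solve-∀
        1<k : 1 < k
        1<k = <-trans 2≤q q<k

  dependency : ∀ {m} (ℓ : Fin m → ℕ → ℕ) (es : List (ℕ × ℕ)) → suc (length es) < m →
    ∃ λ (c : Fin m → K) → (∃ λ t → c t ≢ 𝟘) × sum c ≡ 𝟘 ×
      (∀ {i j} → (i , j) ∈ es → c ∙ (λ t → ι (δ (ℓ t i) (ℓ t j))) ≡ 𝟘)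
  dependency {m} ℓ es lt = c , proj₁ (proj₂ hom) ,
    trans (sum-cong-≗ λ t → sym (·-identityʳ (c t))) (proj₂ (proj₂ hom) zero) ,
    λ e∈es → trans (cong (λ e → c ∙ (λ t → ι (δ (ℓ t (proj₁ e)) (ℓ t (proj₂ e))))) (Anyₚ.lookup-index e∈es))
      (proj₂ (proj₂ hom) (suc (Any.index e∈es)))
    where
    rows : Fin (suc (length es)) → Fin m → K
    rows zero    t = 𝟙
    rows (suc r) t = ι (δ (ℓ t (proj₁ (lookup es r))) (ℓ t (proj₂ (lookup es r))))
    hom = solve-homogeneous (suc (length es)) m rows lt
    c = proj₁ hom

-- Block sequences on the face

-- A partition into consecutive intervals is encoded by the function that gives each node the number
-- of its block, so the steps upwards are the borders of blocks.
UnitSteps : ℕ → (ℕ → ℕ) → Set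
UnitSteps n f = ∀ i → i < n → f (suc i) ≡ f i ⊎ f (suc i) ≡ suc (f i)

unitSteps-mono : ∀ {n f} → UnitSteps n f → ∀ i d → i + d ≤ n → f i ≤ f (i + d)
unitSteps-mono {f = f} us i zero    _  = ≤-reflexive (cong f (sym (+-identityʳ i)))
unitSteps-mono {n} {f} us i (suc d) le with subst (_≤ n) (+-suc i d) le
... | i+d<n = ≤-trans (unitSteps-mono us i d (<⇒≤ i+d<n)) (≤-trans ([ (≤-reflexive ∘ sym) , (λ eq → ≤-trans (n≤1+n _) (≤-reflexive (sym eq))) ]′ (us (i + d) i+d<n))
    (≤-reflexive (cong f (sym (+-suc i d)))))

unitSteps-≤ : ∀ {n f} → f 0 ≡ 0 → UnitSteps n f → ∀ i → i ≤ n → f i ≤ i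
unitSteps-≤ f0 us zero    _    = ≤-reflexive f0
unitSteps-≤ f0 us (suc i) i<n  = [ (λ eq → ≤-trans (≤-reflexive eq) (m≤n⇒m≤1+n rec)) , (λ eq → ≤-trans (≤-reflexive eq) (s≤s rec)) ]′ (us i i<n)
  where rec = unitSteps-≤ f0 us i (<⇒≤ i<n)

wrapped : (ℕ → ℕ) → (n : ℕ) → ℕ → ℕ
wrapped h n i = h (i % suc n)

wrapped-periodic : ∀ h n → Periodic (wrapped h n) (suc n)
wrapped-periodic h n i = cong h ([m+n]%n≡m%n i (suc n))

wrapped-< : ∀ h {n i} → i < suc n → wrapped h n i ≡ h i
wrapped-< h lt = cong h (m<n⇒m%n≡m lt)

module _ {n : ℕ} {f h : ℕ → ℕ} (f0 : f 0 ≡ 0) (us : UnitSteps n f)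
         (same : ∀ i → i < n → f (suc i) ≡ f i → h (suc i) ≡ h i)
         (diff : ∀ i → i < n → f (suc i) ≡ suc (f i) → h i ≢ h (suc i))
         (last : h n ≢ h 0) where

  -- `f` numbers the blocks and `h` may give equal labels to nonadjacent ones. Each step of `f`
  -- upwards is a cut, and the edge from `n` back to 0 is the additional one.
  cuts-count : cuts (wrapped h n) (suc n) ≡ suc (f n)
  cuts-count = begin
    cuts ℓ (suc n)                 ≡⟨ ℕ∑.∑-snoc n (cut ℓ) ⟩
    ℕ∑.∑ n (cut ℓ) + cut ℓ n       ≡⟨ cong₂ _+_ (telescope n ≤-refl) (Cuts.cut-≢ ℓ λ eq → last (trans (sym (wrapped-< h ≤-refl)) (trans eq (cong h (n%n≡0 (suc n)))))) ⟩
    f n + 1                        ≡⟨ +-comm (f n) 1 ⟩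
    suc (f n)                      ∎
    where
    open ≡-Reasoning
    ℓ = wrapped h n
    cut-step : ∀ i → i < n → f i + cut ℓ i ≡ f (suc i)
    cut-step i i<n with us i i<n
    ... | inj₁ eq = trans (cong (f i +_) (Cuts.cut-≡ ℓ (trans (wrapped-< h (m<n⇒m<1+n i<n)) (trans (sym (same i i<n eq)) (sym (wrapped-< h (s<s i<n)))))))
                      (trans (+-identityʳ (f i)) (sym eq))
    ... | inj₂ eq = trans (cong (f i +_) (Cuts.cut-≢ ℓ λ e → diff i i<n eq (trans (sym (wrapped-< h (m<n⇒m<1+n i<n))) (trans e (wrapped-< h (s<s i<n))))))
                      (trans (+-comm (f i) 1) (sym eq))
    telescope : ∀ j → j ≤ n → ℕ∑.∑ j (cut ℓ) ≡ f j
    telescope zero    _   = sym f0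
    telescope (suc j) j<n = trans (ℕ∑.∑-snoc j (cut ℓ)) (trans (cong (_+ cut ℓ j) (telescope j (<⇒≤ j<n))) (cut-step j j<n))

-- If i + q wraps around, it is the node o.
chord-≢ : ∀ {n q} (h : ℕ → ℕ) i → i < suc n → q < suc n → (i + q < suc n → h i ≢ h (i + q)) →
          (∀ o → i + q ≡ o + suc n → h o ≢ h i) → wrapped h n i ≢ wrapped h n (i + q)
chord-≢ {n} {q} h i i<k q<k short long eq with i + q <? suc n
... | yes lt = short lt (trans (sym (wrapped-< h i<k)) (trans eq (wrapped-< h lt)))
... | no ¬lt = long o split (begin
    h o                   ≡⟨ wrapped-< h o<k ⟨
    wrapped h n o         ≡⟨ wrapped-periodic h n o ⟨
    wrapped h n (o + suc n) ≡⟨ cong (wrapped h n) split ⟨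
    wrapped h n (i + q)   ≡⟨ eq ⟨
    wrapped h n i         ≡⟨ wrapped-< h i<k ⟩
    h i                   ∎)
  where
  open ≡-Reasoning
  o = i + q ∸ suc n
  split : i + q ≡ o + suc n
  split = sym (m∸n+n≡m (≮⇒≥ ¬lt))
  o<k : o < suc n
  o<k = +-cancelʳ-< (suc n) o (suc n) (subst (_< suc n + suc n) split (+-mono-< i<k q<k))

-- The effect on labels of merging two blocks. `pred` merges 0 and 1, and `pred₁` merges 1 and 2,
-- both renumbering the later blocks; `absorb c` merges `c` into 0 and leaves the other numbers
-- alone.
Collapses : (ℕ → ℕ) → ℕ → ℕ → Set
Collapses g c d = g c ≡ g d × (∀ x y → g x ≡ g y → x ≡ y ⊎ (x ≡ c × y ≡ d) ⊎ (x ≡ d × y ≡ c))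

absorb : ℕ → ℕ → ℕ
absorb c x with x ≟ c
... | yes _ = 0
... | no  _ = x

absorb-≡ : ∀ c → absorb c c ≡ 0
absorb-≡ c with c ≟ c
... | yes _  = refl
... | no c≢c = contradiction refl c≢c

absorb-collapses : ∀ c → Collapses (absorb c) 0 c
absorb-collapses c = trans zero-fixed (sym (absorb-≡ c)) , inj
  where
  zero-fixed : absorb c 0 ≡ 0
  zero-fixed with 0 ≟ c
  ... | yes _ = refl
  ... | no _  = refl
  inj : ∀ x y → absorb c x ≡ absorb c y → x ≡ y ⊎ (x ≡ 0 × y ≡ c) ⊎ (x ≡ c × y ≡ 0)
  inj x y eq with x ≟ c | y ≟ c
  ... | yes x≡c | yes y≡c = inj₁ (trans x≡c (sym y≡c))
  ... | yes x≡c | no _    = inj₂ (inj₂ (x≡c , sym eq))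
  ... | no _    | yes y≡c = inj₂ (inj₁ (eq , y≡c))
  ... | no _    | no _    = inj₁ eq

pred-collapses : Collapses pred 0 1
pred-collapses = refl , inj
  where
  inj : ∀ x y → pred x ≡ pred y → x ≡ y ⊎ (x ≡ 0 × y ≡ 1) ⊎ (x ≡ 1 × y ≡ 0)
  inj zero          zero          _  = inj₁ refl
  inj zero          (suc zero)    _  = inj₂ (inj₁ (refl , refl))
  inj (suc zero)    zero          _  = inj₂ (inj₂ (refl , refl))
  inj (suc x)       (suc y)       eq = inj₁ (cong suc eq)

pred₁ : ℕ → ℕ
pred₁ zero    = zero
pred₁ (suc x) = suc (pred x)

pred₁-collapses : Collapses pred₁ 1 2
pred₁-collapses = refl , inj
  where
  inj : ∀ x y → pred₁ x ≡ pred₁ y → x ≡ y ⊎ (x ≡ 1 × y ≡ 2) ⊎ (x ≡ 2 × y ≡ 1)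
  inj zero    zero    _  = inj₁ refl
  inj (suc x) (suc y) eq with proj₂ pred-collapses x y (suc-injective eq)
  ... | inj₁ x≡y                  = inj₁ (cong suc x≡y)
  ... | inj₂ (inj₁ (x≡0 , y≡1)) = inj₂ (inj₁ (cong suc x≡0 , cong suc y≡1))
  ... | inj₂ (inj₂ (x≡1 , y≡0)) = inj₂ (inj₂ (cong suc x≡1 , cong suc y≡0))

LabelInterval : (ℕ → ℕ) → ℕ → ℕ → ℕ → Set
LabelInterval f c p s = ∀ i → (f i ≡ c → p ≤ i × i < p + s) × (p ≤ i → i < p + s → f i ≡ c)

module Division (q′ : ℕ) where

  q : ℕ
  q = suc q′

  /-unique : ∀ {x} d → d * q ≤ x → x < suc d * q → x / q ≡ d
  /-unique {x} d lo hi = ≤-antisym (≤-pred (m<n*o⇒m/o<n {x} {suc d} {q} hi))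
    (≤-trans (≤-reflexive (sym (m*n/n≡m d q))) (/-monoˡ-≤ q lo))

  /-lower : ∀ x → x / q * q ≤ x
  /-lower x = m/n*n≤m x q

  /-upper : ∀ x → x < suc (x / q) * q
  /-upper x = subst (_< suc (x / q) * q) (sym (m≡m%n+[m/n]*n x q)) (+-monoˡ-< (x / q * q) (m%n<n x q))

  /-suc : ∀ x → suc x / q ≡ x / q ⊎ suc x / q ≡ suc (x / q)
  /-suc x with suc x <? suc (x / q) * q
  ... | yes lt = inj₁ (/-unique (x / q) (m≤n⇒m≤1+n (/-lower x)) lt)
  ... | no ¬lt = inj₂ (/-unique (suc (x / q)) (≮⇒≥ ¬lt) (≤-trans (s≤s (/-upper x)) (s≤s (m≤n+m _ q′))))

  /-+q : ∀ x → (x + q) / q ≡ suc (x / q)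
  /-+q x = /-unique (suc (x / q))
    (≤-trans (+-monoʳ-≤ q (/-lower x)) (≤-reflexive (+-comm q x)))
    (subst (_< suc (suc (x / q)) * q) (+-comm q x) (+-monoʳ-< q (/-upper x)))

  <⇒/≤ : ∀ {x} d → x < suc d * q → x / q ≤ d
  <⇒/≤ {x} d lt = ≤-pred (m<n*o⇒m/o<n {x} {suc d} {q} lt)

  ≤⇒≤/ : ∀ {x} d → d * q ≤ x → d ≤ x / q
  ≤⇒≤/ d le = ≤-trans (≤-reflexive (sym (m*n/n≡m d q))) (/-monoˡ-≤ q le)

  -- The first block is S = [0, s); a gap of length g is filled with blocks of
  -- size q, the last one possibly shorter; the blocks after it end at multiples of q.
  fam : ℕ → ℕ → ℕ → ℕ
  fam s g i with i <? s | i <? s + g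
  ... | yes _ | _     = 0
  ... | no _  | yes _ = suc ((i ∸ s) / q)
  ... | no _  | no _  = suc (pred i / q)

  fam-S : ∀ {s g i} → i < s → fam s g i ≡ 0
  fam-S {s} {g} {i} i<s with i <? s
  ... | yes _   = refl
  ... | no ¬i<s = contradiction i<s ¬i<s

  fam-gap : ∀ {s g} x → x < g → fam s g (s + x) ≡ suc (x / q)
  fam-gap {s} {g} x x<g with s + x <? s | s + x <? s + g
  ... | yes lt | _      = contradiction lt (m+n≮m s x)
  ... | no _   | yes _  = cong (λ y → suc (y / q)) (m+n∸m≡n s x)
  ... | no _   | no ¬lt = contradiction (+-monoʳ-< s x<g) ¬lt

  fam-rest : ∀ {s g} y → s + g ≤ suc y → fam s g (suc y) ≡ suc (y / q)
  fam-rest {s} {g} y le with suc y <? s | suc y <? s + g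
  ... | yes lt | _      = contradiction (≤-trans (m≤m+n s g) le) (<⇒≱ lt)
  ... | no _   | yes lt = contradiction le (<⇒≱ lt)
  ... | no _   | no _   = refl

  data Zone (s g : ℕ) : ℕ → Set where
    inS   : ∀ {i} → i < s → Zone s g i
    inGap : ∀ x → x < g → Zone s g (s + x)
    rest  : ∀ y → s + g ≤ suc y → Zone s g (suc y)

  zone : ∀ s g → 0 < g → ∀ i → Zone s g i
  zone s g 0<g i with i <? s | i <? s + g
  ... | yes lt  | _      = inS lt
  ... | no ¬i<s | yes lt = subst (Zone s g) (m+[n∸m]≡n (≮⇒≥ ¬i<s))
    (inGap (i ∸ s) (+-cancelˡ-< s (i ∸ s) g (subst (_< s + g) (sym (m+[n∸m]≡n (≮⇒≥ ¬i<s))) lt)))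
  zone s g 0<g zero    | no _ | no ¬lt = contradiction (≤-trans 0<g (m≤n+m g s)) ¬lt
  zone s g 0<g (suc y) | no _ | no ¬lt = rest y (≮⇒≥ ¬lt)

  -- `bq<g` and `g≤` make the gap consist of exactly `b + 1` blocks. `<s+g` and `s≤q` put the first
  -- node after the gap into block `b + 2`, so that the numbering neither repeats nor skips a block
  -- there.
  record Admissible (b s g : ℕ) : Set where
    field
      1≤s  : 1 ≤ s
      s≤q  : s ≤ q
      bq<g : b * q < g
      g≤   : g ≤ suc b * q
      <s+g : suc b * q < s + g

  module Family {b s g : ℕ} (adm : Admissible b s g) where

    open Admissible adm

    f : ℕ → ℕ
    f = fam s g

    0<g : 0 < g
    0<g = ≤-<-trans z≤n bq<g

    zoneOf : ∀ i → Zone s g i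
    zoneOf = zone s g 0<g

    f0 : f 0 ≡ 0
    f0 = fam-S {s} {g} 1≤s

    gap-value : ∀ x → x < g → f (s + x) ≤ suc b
    gap-value x x<g = ≤-trans (≤-reflexive (fam-gap x x<g)) (s≤s (<⇒/≤ b (<-≤-trans x<g g≤)))

    rest-value : ∀ y → s + g ≤ suc y → suc (suc b) ≤ f (suc y)
    rest-value y le = ≤-trans (s≤s (≤⇒≤/ (suc b) (≤-pred (≤-trans <s+g le)))) (≤-reflexive (sym (fam-rest y le)))

    f≡0⇒< : ∀ i → f i ≡ 0 → i < s
    f≡0⇒< i eq with zoneOf i
    ... | inS lt      = lt
    ... | inGap x x<g = contradiction (trans (sym (fam-gap x x<g)) eq) λ ()
    ... | rest y le   = contradiction (trans (sym (fam-rest y le)) eq) λ ()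

    unitSteps : ∀ n → UnitSteps n f
    unitSteps n i _ with zoneOf i
    ... | inS {i} i<s with <-≤-connex (suc i) s
    ...   | inj₁ lt = inj₁ (trans (fam-S {s} {g} lt) (sym (fam-S {s} {g} i<s)))
    ...   | inj₂ ge = inj₂ (trans (cong f (trans (≤-antisym i<s ge) (sym (+-identityʳ s))))
                       (trans (fam-gap 0 0<g) (cong suc (sym (fam-S {s} {g} i<s)))))
    unitSteps n _ _ | rest y le =
      Sum.map (λ eq → trans (next le) (trans (cong suc eq) (sym (fam-rest y le))))
              (λ eq → trans (next le) (trans (cong suc eq) (cong suc (sym (fam-rest y le))))) (/-suc y)
      where
      next : s + g ≤ suc y → f (suc (suc y)) ≡ suc (suc y / q)
      next le = fam-rest (suc y) (m≤n⇒m≤1+n le)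
    unitSteps n _ _ | inGap x x<g with <-≤-connex (suc x) g
    ...   | inj₁ lt =
      Sum.map (λ eq → trans next (trans (cong suc eq) (sym (fam-gap x x<g))))
              (λ eq → trans next (trans (cong suc eq) (cong suc (sym (fam-gap x x<g))))) (/-suc x)
      where
      next : f (suc (s + x)) ≡ suc (suc x / q)
      next = trans (cong f (sym (+-suc s x))) (fam-gap (suc x) lt)
    ...   | inj₂ ge = inj₂ (trans (fam-rest (s + x) (subst (s + g ≤_) (+-suc s x) (+-monoʳ-≤ s ge)))
        (trans (cong suc (trans (/-unique (suc b) lo hi) (cong suc (sym (/-unique b b*q≤x (<-≤-trans x<g g≤))))))
               (cong suc (sym (fam-gap x x<g)))))
      where
      g≡ : g ≡ suc x
      g≡ = ≤-antisym ge x<g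
      b*q≤x : b * q ≤ x
      b*q≤x = ≤-pred (subst (b * q <_) g≡ bq<g)
      lo : suc b * q ≤ s + x
      lo = ≤-pred (subst (suc b * q <_) (trans (cong (s +_) g≡) (+-suc s x)) <s+g)
      hi : s + x < suc (suc b) * q
      hi = +-mono-≤-< s≤q (<-≤-trans x<g g≤)

    -- No block has more than `q` nodes, and blocks are numbered in order.
    short-chord : ∀ i → f i < f (i + q)
    short-chord i with zoneOf i
    ... | inS {i} i<s = ≤-trans (s≤s (≤-reflexive (fam-S {s} {g} i<s)))
      (n≢0⇒n>0 λ eq → <⇒≱ (f≡0⇒< (i + q) eq) (≤-trans s≤q (m≤n+m q i)))
    ... | rest y le = ≤-reflexive (trans (cong suc (trans (fam-rest y le) (sym (/-+q y))))
      (sym (fam-rest (y + q) (≤-trans le (s≤s (m≤m+n y q))))))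
    ... | inGap x x<g with <-≤-connex (x + q) g
    ...   | inj₁ lt = ≤-reflexive (trans (cong suc (trans (fam-gap x x<g) (sym (/-+q x))))
      (trans (sym (fam-gap (x + q) lt)) (cong f (sym (+-assoc s x q)))))
    ...   | inj₂ ge = ≤-trans (s≤s (gap-value x x<g)) (subst (λ j → suc (suc b) ≤ f j) shape (rest-value (s + x + q′)
      (≤-trans (+-monoʳ-≤ s ge) (≤-reflexive (trans (sym (+-assoc s x q)) (+-suc (s + x) q′))))))
      where
      shape : suc (s + x + q′) ≡ s + x + q
      shape = sym (+-suc (s + x) q′)

    interval-gap : b ≡ 0 → LabelInterval f 1 s g
    interval-gap refl i with zoneOf i
    ... | inS i<s      = (λ eq → contradiction (trans (sym (fam-S {s} {g} i<s)) eq) λ ()) ,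
                         λ le _ → contradiction le (<⇒≱ i<s)
    ... | inGap x x<g  = (λ _ → m≤m+n s x , +-monoʳ-< s x<g) ,
                         λ _ _ → ≤-antisym (gap-value x x<g) (subst (1 ≤_) (sym (fam-gap x x<g)) (s≤s z≤n))
    ... | rest y le    = (λ eq → contradiction eq (<⇒≢ (rest-value y le) ∘ sym)) ,
                         λ _ lt → contradiction le (<⇒≱ lt)

    module _ {m′ : ℕ} (b+2≤m : suc (suc b) ≤ suc m′) where

      private
        m n : ℕ
        m = suc m′
        n = m * q

      end-value : f n ≡ m
      end-value = trans (fam-rest (q′ + m′ * q) le) (cong suc (/-unique m′ (m≤n+m (m′ * q) q′) ≤-refl))
        where
        le : s + g ≤ suc (q′ + m′ * q)
        le = ≤-trans (+-mono-≤ s≤q g≤) (*-monoˡ-≤ q b+2≤m)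

      2q≤n : 2 * q ≤ n
      2q≤n = *-monoˡ-≤ q (≤-trans (s≤s (s≤s z≤n)) b+2≤m)

      -- For a chord that wraps around to `o`, the bound `2 * q ≤ n` gives `o + q ≤ i`; so `i` lies
      -- beyond the end of the chord that starts at `o`, which already has a larger number than `o`.
      long-chord : ∀ o i → i < suc n → i + q ≡ o + suc n → f o < f i
      long-chord o i i<k eq = <-≤-trans (short-chord o) (≤-trans (unitSteps-mono (unitSteps n) (o + q) (i ∸ (o + q)) (subst (_≤ n) (sym i≡) (≤-pred i<k)))
          (≤-reflexive (cong f i≡)))
        where
        o+q≤i : o + q ≤ i
        o+q≤i = ≤-certificate 1 (+-mono-≤ (≤-reflexive (sym eq)) 2q≤n) (e i o q n)
          where e : ∀ i o q n → i + (o + suc n + 2 * q) ≡ o + q + (i + q + n) + 1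
                e = solve-∀
        i≡ : o + q + (i ∸ (o + q)) ≡ i
        i≡ = m+[n∸m]≡n o+q≤i

      tight : cuts (wrapped f n) (suc n) + chords (wrapped f n) (suc n) q ≡ suc m
      tight = trans (cong₂ _+_ (cuts-count f0 (unitSteps n) (λ _ _ → id) (λ i _ eq eq′ → m≢1+m+n (f i) (trans eq′ (trans eq (cong suc (sym (+-identityʳ (f i)))))))
          (λ eq → contradiction (trans (sym end-value) (trans eq f0)) λ ()))
          (ℕ∑.∑-zero (suc n) λ i i<k → δ-≢ (chord-≢ f i i<k q<k (λ _ → <⇒≢ (short-chord i)) (λ o eq → <⇒≢ (long-chord o i i<k eq)))))
        (trans (+-identityʳ _) (cong suc end-value))
        where
        q<k : q < suc n
        q<k = s≤s (≤-trans (m≤m+n q _) 2q≤n)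

      module _ (3+b≤m : suc (suc (suc b)) ≤ m) (q≤g : q ≤ g) where

        merged : ℕ → ℕ
        merged = absorb (suc (suc b)) ∘ f

        -- The merge of block 0 with the block after the gap must not join a chord or remove a cut.
        -- A chord going forward from block 0 ends no later than in the gap, because `q ≤ g`. By
        -- `3+b≤m` at least one full block follows the merged one, so a chord arriving in block 0
        -- around the cycle starts beyond it, and the edge from `n` to 0 stays cut.
        merged-tight : cuts (wrapped merged n) (suc n) + chords (wrapped merged n) (suc n) q ≡ suc m
        merged-tight = trans (cong₂ _+_ (cuts-count f0 (unitSteps n) (λ _ _ → cong (absorb (suc (suc b)))) diff last)
            (ℕ∑.∑-zero (suc n) λ i i<k → δ-≢ (chord-≢ merged i i<k q<k (λ _ → short i) (λ o eq → long o i i<k eq))))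
          (trans (+-identityʳ _) (cong suc end-value))
          where
          q<k : q < suc n
          q<k = s≤s (≤-trans (m≤m+n q _) 2q≤n)
          inj = proj₂ (absorb-collapses (suc (suc b)))
          diff : ∀ i → i < n → f (suc i) ≡ suc (f i) → merged i ≢ merged (suc i)
          diff i _ eq same with inj (f i) (f (suc i)) same
          ... | inj₁ e                = m≢1+m+n (f i) (trans e (trans eq (cong suc (sym (+-identityʳ (f i))))))
          ... | inj₂ (inj₁ (e₀ , e₁)) = contradiction (trans (sym e₁) (trans eq (cong suc e₀))) λ ()
          ... | inj₂ (inj₂ (_ , e₀))  = contradiction (trans (sym eq) e₀) λ ()
          last : merged n ≢ merged 0
          last same with inj (f n) (f 0) same
          ... | inj₁ e               = contradiction (trans (sym end-value) (trans e f0)) λ ()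
          ... | inj₂ (inj₁ (e , _))  = contradiction (trans (sym end-value) e) λ ()
          ... | inj₂ (inj₂ (e , _))  = <⇒≢ 3+b≤m (trans (sym e) end-value)
          separated : ∀ {i j} → f i < f j → (f i ≡ 0 → f j ≢ suc (suc b)) → merged i ≢ merged j
          separated {i} {j} lt apart same with inj (f i) (f j) same
          ... | inj₁ e                = <⇒≢ lt e
          ... | inj₂ (inj₁ (e₀ , e₁)) = apart e₀ e₁
          ... | inj₂ (inj₂ (_ , e₀))  = contradiction (subst (f i <_) e₀ lt) λ ()
          short : ∀ i → merged i ≢ merged (i + q)
          short i = separated (short-chord i) λ e₀ e₁ → <⇒≢ (s≤s (≤-trans (bound (f≡0⇒< i e₀)) ≤-refl)) e₁
            where
            bound : i < s → f (i + q) ≤ suc b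
            bound i<s = ≤-trans (≤-reflexive (cong f (sym (m+[n∸m]≡n s≤i+q)))) (gap-value (i + q ∸ s)
              (+-cancelˡ-< s _ _ (subst (_< s + g) (sym (m+[n∸m]≡n s≤i+q)) (+-mono-<-≤ i<s q≤g))))
              where
              s≤i+q : s ≤ i + q
              s≤i+q = ≤-trans s≤q (m≤n+m q i)
          long : ∀ o i → i < suc n → i + q ≡ o + suc n → merged o ≢ merged i
          long o i i<k eq = separated (long-chord o i i<k eq) λ _ e₁ → <⇒≢ (far i beyond) (sym e₁)
            where
            beyond : suc (suc b) * q < i
            beyond = ≤-certificate o (+-mono-≤ (≤-reflexive (sym eq)) (*-monoˡ-≤ q 3+b≤m)) (e i o b q n)
              where e : ∀ i o b q n → i + (o + suc n + suc (suc (suc b)) * q) ≡ suc (suc (suc b) * q) + (i + q + n) + o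
                    e = solve-∀
            far : ∀ i → suc (suc b) * q < i → suc (suc b) < f i
            far (suc y) (s≤s le) = ≤-trans (s≤s (≤⇒≤/ (suc (suc b)) le)) (≤-reflexive (sym (fam-rest y (≤-trans (+-mono-≤ s≤q g≤) (m≤n⇒m≤1+n le)))))

    interval-S : LabelInterval f 0 0 s
    interval-S i = (λ eq → z≤n , f≡0⇒< i eq) , λ _ → fam-S {s} {g}

    interval-T : ∀ t → s + g + t ≡ suc (suc (suc b) * q) → LabelInterval f (suc (suc b)) (s + g) t
    interval-T t end i with zoneOf i
    ... | inS i<s      = (λ eq → contradiction (trans (sym (fam-S {s} {g} i<s)) eq) λ ()) ,
                         λ le _ → contradiction (≤-trans (m≤m+n s g) le) (<⇒≱ i<s)
    ... | inGap x x<g  = (λ eq → contradiction eq (<⇒≢ (s≤s (gap-value x x<g)))) ,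
                         λ le _ → contradiction (+-cancelˡ-≤ s g x le) (<⇒≱ x<g)
    ... | rest y le    = (λ eq → le , subst (suc y <_) (sym end) (s<s (subst (λ d → y < suc d * q) (suc-injective (trans (sym (fam-rest y le)) eq)) (/-upper y)))) ,
                         λ _ lt → trans (fam-rest y le) (cong suc (/-unique (suc b) (≤-pred (≤-trans <s+g le)) (≤-pred (subst (suc y <_) end lt))))

  -- The first block consists of the `q + 1` nodes 0 to `q`, since `pred` sends both 0 and 1 to 0;
  -- all others have `q` nodes. On the cycle this gives `m` cuts and the single chord {0,q}.
  shifted : ℕ → ℕ
  shifted i = pred i / q

  module OneChordFace {m″ : ℕ} where

    private
      m n : ℕ
      m = suc (suc m″)
      n = m * q

    shifted-tight : cuts (wrapped shifted n) (suc n) + chords (wrapped shifted n) (suc n) q ≡ suc m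
    shifted-tight = trans (cong₂ _+_ (cuts-count (/-unique 0 z≤n z<s) us (λ _ _ → id) (λ i _ eq eq′ → m≢1+m+n (shifted i) (trans eq′ (trans eq (cong suc (sym (+-identityʳ (shifted i)))))))
        (λ eq → contradiction (trans (sym end) (trans eq (/-unique 0 z≤n z<s))) λ ()))
        (trans (ℕ∑.∑-single (suc n) 0 (λ i → δ (wrapped shifted n i) (wrapped shifted n (i + q))) z<s other) (δ-≡ chord)))
      (trans (+-comm _ 1) (cong (2 +_) end))
      where
      us : UnitSteps n shifted
      us zero    _ = inj₁ refl
      us (suc y) _ = /-suc y
      end : shifted n ≡ suc m″
      end = /-unique (suc m″) (m≤n+m (suc m″ * q) q′) ≤-refl
      q≤n : q ≤ n
      q≤n = m≤m+n q _
      chord : wrapped shifted n 0 ≡ wrapped shifted n q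
      chord = trans (/-unique 0 z≤n z<s) (sym (trans (wrapped-< shifted (s≤s q≤n)) (/-unique 0 z≤n (≤-reflexive (sym (+-identityʳ q))))))
      other : ∀ i → i < suc n → i ≢ 0 → δ (wrapped shifted n i) (wrapped shifted n (i + q)) ≡ 0
      other zero    _   0≢0 = contradiction refl 0≢0
      other (suc y) i<k _   = δ-≢ (chord-≢ shifted (suc y) i<k (s≤s q≤n)
        (λ _ eq → m≢1+m+n (y / q) (trans eq (trans (/-+q y) (cong suc (sym (+-identityʳ (y / q)))))))
        (λ o eq → <⇒≢ (begin-strict
          pred o / q       ≤⟨ /-monoˡ-≤ q (pred[n]≤n {o}) ⟩
          o / q            <⟨ n<1+n _ ⟩
          suc (o / q)      ≡⟨ /-+q o ⟨
          (o + q) / q      ≤⟨ /-monoˡ-≤ q (o+q≤y o eq) ⟩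
          y / q            ∎)))
        where
        open ≤-Reasoning
        o+q≤y : ∀ o → suc y + q ≡ o + suc n → o + q ≤ y
        o+q≤y o eq = ≤-certificate (m″ * q) (≤-reflexive (sym eq)) (e y o q m″)
          where e : ∀ y o q m → y + (o + suc (suc (suc m) * q)) ≡ o + q + (suc y + q) + m * q
                e = solve-∀

  -- The common refinement of two faces that differ in the block of node l.
  module Refinement {l r : ℕ} (1≤l : 1 ≤ l) (l<q : l < q) (1≤r : 1 ≤ r) (r<q : r < q) (q≤l+r : q ≤ l + r) where

    -- In both partitions the first two blocks cover the nodes 0 to l + r; node l ends the first
    -- block here and begins the second one in `right`. The third block ends at 2q, and `q ≤ l + r`
    -- keeps its size at most q.
    left : Admissible 0 (suc l) r
    left = record { 1≤s = s≤s z≤n ; s≤q = l<q ; bq<g = 1≤r ; g≤ = ≤-trans (<⇒≤ r<q) (≤-reflexive (sym (+-identityʳ q)))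
                  ; <s+g = s≤s (≤-trans (≤-reflexive (+-identityʳ q)) q≤l+r) }

    right : Admissible 0 l (suc r)
    right = record { 1≤s = 1≤l ; s≤q = <⇒≤ l<q ; bq<g = z<s ; g≤ = ≤-trans r<q (≤-reflexive (sym (+-identityʳ q)))
                   ; <s+g = ≤-trans (s≤s (≤-trans (≤-reflexive (+-identityʳ q)) q≤l+r)) (≤-reflexive (sym (+-suc l r))) }

    private
      module Left = Family left
      module Right = Family right

    refined : ℕ → ℕ
    refined i with <-cmp i l
    ... | tri< _ _ _ = 0
    ... | tri≈ _ _ _ = 1
    ... | tri> _ _ _ = suc (Left.f i)

    left-positive : ∀ i → l < i → Left.f i ≢ 0
    left-positive i l<i eq = <⇒≱ (Left.f≡0⇒< i eq) l<i

    pred-refined : ∀ i → pred (refined i) ≡ Left.f i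
    pred-refined i with <-cmp i l
    ... | tri< i<l _ _ = sym (fam-S {suc l} {r} (m<n⇒m<1+n i<l))
    ... | tri≈ _ i≡l _ = sym (fam-S {suc l} {r} (s≤s (≤-reflexive i≡l)))
    ... | tri> _ _ _   = refl

    agree : ∀ i → l < i → Left.f i ≡ Right.f i
    agree i l<i with Left.zoneOf i
    ... | inS i<sl     = contradiction (≤-pred i<sl) (<⇒≱ l<i)
    ... | inGap x x<r  = trans (trans (fam-gap {suc l} {r} x x<r) (cong suc (m<n⇒m/n≡0 (<-trans x<r r<q))))
      (sym (trans (cong Right.f (sym (+-suc l x))) (trans (fam-gap {l} {suc r} (suc x) (s≤s x<r)) (cong suc (m<n⇒m/n≡0 (≤-<-trans x<r r<q))))))
    ... | rest y le    = trans (fam-rest {suc l} {r} y le) (sym (fam-rest {l} {suc r} y (≤-trans (≤-reflexive (+-suc l r)) le)))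

    pred₁-refined : ∀ i → pred₁ (refined i) ≡ Right.f i
    pred₁-refined i with <-cmp i l
    ... | tri< i<l _ _ = sym (fam-S {l} {suc r} i<l)
    ... | tri≈ _ i≡l _ = sym (trans (cong Right.f (trans i≡l (sym (+-identityʳ l)))) (trans (fam-gap {l} {suc r} 0 z<s) (cong suc (m<n⇒m/n≡0 {0} {q} z<s))))
    ... | tri> _ _ l<i = trans (suc-pred (Left.f i) {{≢-nonZero (left-positive i l<i)}}) (agree i l<i)

    interval₀ : LabelInterval refined 0 0 l
    interval₀ i with <-cmp i l
    ... | tri< i<l _ _  = (λ _ → z≤n , i<l) , λ _ _ → refl
    ... | tri≈ ¬i<l _ _ = (λ ()) , λ _ i<l → contradiction i<l ¬i<l
    ... | tri> ¬i<l _ _ = (λ ()) , λ _ i<l → contradiction i<l ¬i<l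

    interval₁ : LabelInterval refined 1 l 1
    interval₁ i with <-cmp i l
    ... | tri< i<l _ _   = (λ ()) , λ l≤i _ → contradiction l≤i (<⇒≱ i<l)
    ... | tri≈ _ refl _  = (λ _ → ≤-refl , ≤-reflexive (+-comm 1 i)) , λ _ _ → refl
    ... | tri> _ _ l<i   = (λ eq → contradiction (suc-injective eq) (left-positive i l<i)) ,
                           λ _ i<l+1 → contradiction (subst (i <_) (+-comm l 1) i<l+1) (<⇒≱ (s≤s l<i))

    interval₂ : LabelInterval refined 2 (suc l) r
    interval₂ i with <-cmp i l
    ... | tri< i<l _ _   = (λ ()) , λ l<i _ → contradiction i<l (<⇒≯ l<i)
    ... | tri≈ _ i≡l _   = (λ ()) , λ l<i _ → contradiction (sym i≡l) (<⇒≢ l<i)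
    ... | tri> _ _ l<i   = (λ eq → proj₁ (Left.interval-gap refl i) (suc-injective eq)) ,
                           λ l<i lt → cong suc (proj₂ (Left.interval-gap refl i) l<i lt)

-- Affine functionals on the face

collapse-δ : ∀ {g c d} → c ≢ d → Collapses g c d → ∀ x y →
  δ (g x) (g y) ≡ δ x y + (δ x c * δ y d + δ x d * δ y c)
collapse-δ {g} {c} {d} c≢d (gc≡gd , inj) x y with g x ≟ g y
... | no neq rewrite δ-≢ (neq ∘ cong g) = sym (cong₂ _+_
    (vanish λ { refl refl → neq gc≡gd }) (vanish λ { refl refl → neq (sym gc≡gd) }))
  where
  vanish : ∀ {a b} → (x ≡ a → y ≢ b) → δ x a * δ y b ≡ 0
  vanish {a} {b} apart with x ≟ a
  ... | yes x≡a = trans (+-identityʳ _) (δ-≢ (apart x≡a))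
  ... | no _    = refl
... | yes eq with inj x y eq
...   | inj₁ refl = sym (cong₂ (λ u v → u + v) (δ-≡ {x} refl) (cong₂ _+_ (apart c d c≢d) (apart d c (c≢d ∘ sym))))
  where
  apart : ∀ a b → a ≢ b → δ x a * δ x b ≡ 0
  apart a b a≢b with x ≟ a
  ... | yes refl = trans (+-identityʳ _) (δ-≢ a≢b)
  ... | no _     = refl
...   | inj₂ (inj₁ (refl , refl)) rewrite δ-≢ c≢d | δ-≡ {c} refl | δ-≡ {d} refl = refl
...   | inj₂ (inj₂ (refl , refl)) rewrite δ-≢ (c≢d ∘ sym) | δ-≡ {c} refl | δ-≡ {d} refl = refl

module Functionals (F : DecField) where

  open Combinations F public

  ι-* : ∀ m n → ι (m * n) ≡ ι m · ι n
  ι-* zero    n = sym (zeroˡ (ι n))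
  ι-* (suc m) n = trans (ι-+ n (m * n)) (trans (cong₂ _⊞_ (sym (·-identityˡ (ι n))) (ι-* m n)) (sym (distribʳ (ι n) 𝟙 (ι m))))

  ∑∑ : ℕ → ℕ → (ℕ → ℕ → K) → K
  ∑∑ m n f = ∑ m (λ i → ∑ n (f i))

  ∑∑-cong : ∀ m n {f g : ℕ → ℕ → K} → (∀ i j → i < m → j < n → f i j ≡ g i j) → ∑∑ m n f ≡ ∑∑ m n g
  ∑∑-cong m n eq = ∑-cong m λ i i<m → ∑-cong n λ j j<n → eq i j i<m j<n

  ∑∑-add : ∀ m n (f g : ℕ → ℕ → K) → ∑∑ m n (λ i j → f i j ⊞ g i j) ≡ ∑∑ m n f ⊞ ∑∑ m n g
  ∑∑-add m n f g = trans (∑-cong m λ i _ → ∑-add n (f i) (g i)) (∑-add m (λ i → ∑ n (f i)) (λ i → ∑ n (g i)))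

  ∑-restrict : ∀ {f c p s k} → LabelInterval f c p s → p + s ≤ k → ∀ (X : ℕ → K) →
    ∑ k (λ i → ι (δ (f i) c) · X i) ≡ ∑ s (λ i → X (p + i))
  ∑-restrict {f} {c} {p} {s} {k} interval p+s≤k X = begin
    ∑ k Y                                ≡⟨ cong (λ n → ∑ n Y) (m+[n∸m]≡n p+s≤k) ⟨
    ∑ (p + s + (k ∸ (p + s))) Y          ≡⟨ ∑-interval p s (k ∸ (p + s)) Y
                                             (λ i i<p → outside i λ eq → <⇒≱ i<p (proj₁ (proj₁ (interval i) eq)))
                                             (λ i le _ → outside i λ eq → <⇒≱ (proj₂ (proj₁ (interval i) eq)) le) ⟩
    ∑ s (λ i → Y (p + i))                ≡⟨ ∑-cong s (λ i i<s → trans (cong (λ n → ι n · X (p + i))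
                                             (δ-≡ (proj₂ (interval (p + i)) (m≤m+n p i) (+-monoʳ-< p i<s))))
                                             (trans (cong (_· X (p + i)) ι-1) (·-identityˡ (X (p + i))))) ⟩
    ∑ s (λ i → X (p + i))                ∎
    where
    open ≡-Reasoning
    Y : ℕ → K
    Y i = ι (δ (f i) c) · X i
    outside : ∀ i → f i ≢ c → Y i ≡ 𝟘
    outside i neq = trans (cong (λ n → ι n · X i) (δ-≢ neq)) (zeroˡ (X i))

  -- A linear functional evaluated at the partition with labels `h`. The coefficients sit on ordered
  -- pairs, so an unordered pair carries the sum of two entries, `sym-part a`.
  Φ : ℕ → (ℕ → ℕ → K) → (ℕ → ℕ) → K
  Φ k a h = ∑∑ k k (λ i j → a i j · ι (δ (h i) (h j)))

  Φ-cong : ∀ k a {h h′ : ℕ → ℕ} → (∀ i → i < k → h i ≡ h′ i) → Φ k a h ≡ Φ k a h′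
  Φ-cong k a eq = ∑∑-cong k k λ i j i<k j<k → cong (λ n → a i j · ι n) (cong₂ δ (eq i i<k) (eq j j<k))

  sym-part : (ℕ → ℕ → K) → ℕ → ℕ → K
  sym-part a i j = a i j ⊞ a j i

  -- A merge joins exactly the pairs with one node in each of the two blocks, and intervals make
  -- these pairs a rectangle. Two tight partitions that differ by a merge thus yield a vanishing
  -- rectangle sum.
  Φ-merge : ∀ k a {f g c d pᶜ sᶜ pᵈ sᵈ} → c ≢ d → Collapses g c d →
    LabelInterval f c pᶜ sᶜ → pᶜ + sᶜ ≤ k → LabelInterval f d pᵈ sᵈ → pᵈ + sᵈ ≤ k →
    Φ k a (g ∘ f) ≡ Φ k a f ⊞ ∑∑ sᶜ sᵈ (λ i j → sym-part a (pᶜ + i) (pᵈ + j))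
  Φ-merge k a {f} {g} {c} {d} {pᶜ} {sᶜ} {pᵈ} {sᵈ} c≢d collapses intervalᶜ leᶜ intervalᵈ leᵈ = begin
    Φ k a (g ∘ f)                                                ≡⟨ ∑∑-cong k k (λ i j _ _ → split i j) ⟩
    ∑∑ k k (λ i j → a i j · ι (δ (f i) (f j)) ⊞ (W i j (a i j) ⊞ W j i (a i j)))
      ≡⟨ ∑∑-add k k (λ i j → a i j · ι (δ (f i) (f j))) (λ i j → W i j (a i j) ⊞ W j i (a i j)) ⟩
    Φ k a f ⊞ ∑∑ k k (λ i j → W i j (a i j) ⊞ W j i (a i j))     ≡⟨ cong (Φ k a f ⊞_) cross ⟩
    Φ k a f ⊞ ∑∑ sᶜ sᵈ (λ i j → sym-part a (pᶜ + i) (pᵈ + j))   ∎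
    where
    open ≡-Reasoning
    W : ℕ → ℕ → K → K
    W i j x = ι (δ (f i) c) · (ι (δ (f j) d) · x)
    rotate : ∀ x y z → x · (y · z) ≡ y · (z · x)
    rotate x y z = trans (·-comm x (y · z)) (·-assoc y z x)
    weight : ∀ x i j → x · ι (δ (f i) c * δ (f j) d) ≡ W i j x
    weight x i j = trans (cong (x ·_) (ι-* (δ (f i) c) (δ (f j) d))) (rotate x _ _)
    split : ∀ i j → a i j · ι (δ (g (f i)) (g (f j))) ≡ a i j · ι (δ (f i) (f j)) ⊞ (W i j (a i j) ⊞ W j i (a i j))
    split i j = begin
      a i j · ι (δ (g (f i)) (g (f j)))   ≡⟨ cong (λ n → a i j · ι n) (collapse-δ c≢d collapses (f i) (f j)) ⟩
      a i j · ι (δ (f i) (f j) + (u + v)) ≡⟨ cong (a i j ·_) (trans (ι-+ (δ (f i) (f j)) (u + v)) (cong (ι (δ (f i) (f j)) ⊞_) (ι-+ u v))) ⟩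
      a i j · (ι (δ (f i) (f j)) ⊞ (ι u ⊞ ι v))  ≡⟨ trans (distribˡ (a i j) _ _) (cong (a i j · ι (δ (f i) (f j)) ⊞_) (distribˡ (a i j) _ _)) ⟩
      a i j · ι (δ (f i) (f j)) ⊞ (a i j · ι u ⊞ a i j · ι v)
        ≡⟨ cong (a i j · ι (δ (f i) (f j)) ⊞_) (cong₂ _⊞_ (weight (a i j) i j)
             (trans (cong (λ n → a i j · ι n) (*-comm (δ (f i) d) (δ (f j) c))) (weight (a i j) j i))) ⟩
      a i j · ι (δ (f i) (f j)) ⊞ (W i j (a i j) ⊞ W j i (a i j))  ∎
      where
      u = δ (f i) c * δ (f j) d
      v = δ (f i) d * δ (f j) c
    W-⊞ : ∀ i j x y → W i j x ⊞ W i j y ≡ W i j (x ⊞ y)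
    W-⊞ i j x y = trans (sym (distribˡ (ι (δ (f i) c)) _ _)) (cong (ι (δ (f i) c) ·_) (sym (distribˡ (ι (δ (f j) d)) x y)))
    cross : ∑∑ k k (λ i j → W i j (a i j) ⊞ W j i (a i j)) ≡ ∑∑ sᶜ sᵈ (λ i j → sym-part a (pᶜ + i) (pᵈ + j))
    cross = begin
      ∑∑ k k (λ i j → W i j (a i j) ⊞ W j i (a i j))               ≡⟨ ∑∑-add k k (λ i j → W i j (a i j)) (λ i j → W j i (a i j)) ⟩
      ∑∑ k k (λ i j → W i j (a i j)) ⊞ ∑∑ k k (λ i j → W j i (a i j)) ≡⟨ cong (∑∑ k k (λ i j → W i j (a i j)) ⊞_) (∑-swap k k (λ i j → W j i (a i j))) ⟩
      ∑∑ k k (λ i j → W i j (a i j)) ⊞ ∑∑ k k (λ i j → W i j (a j i)) ≡⟨ ∑∑-add k k (λ i j → W i j (a i j)) (λ i j → W i j (a j i)) ⟨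
      ∑∑ k k (λ i j → W i j (a i j) ⊞ W i j (a j i))               ≡⟨ ∑∑-cong k k (λ i j _ _ → W-⊞ i j (a i j) (a j i)) ⟩
      ∑∑ k k (λ i j → W i j (sym-part a i j))                      ≡⟨ ∑-cong k (λ i _ → ∑-·ˡ k (ι (δ (f i) c)) (λ j → ι (δ (f j) d) · sym-part a i j)) ⟩
      ∑ k (λ i → ι (δ (f i) c) · ∑ k (λ j → ι (δ (f j) d) · sym-part a i j))
        ≡⟨ ∑-restrict intervalᶜ leᶜ (λ i → ∑ k (λ j → ι (δ (f j) d) · sym-part a i j)) ⟩
      ∑ sᶜ (λ i → ∑ k (λ j → ι (δ (f j) d) · sym-part a (pᶜ + i) j))
        ≡⟨ ∑-cong sᶜ (λ i _ → ∑-restrict intervalᵈ leᵈ (sym-part a (pᶜ + i))) ⟩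
      ∑∑ sᶜ sᵈ (λ i j → sym-part a (pᶜ + i) (pᵈ + j))               ∎

  Periodic₂ : (ℕ → ℕ → K) → ℕ → Set
  Periodic₂ a k = (∀ i j → a (i + k) j ≡ a i j) × (∀ i j → a i (j + k) ≡ a i j)

  shift : ℕ → (ℕ → ℕ → K) → ℕ → ℕ → K
  shift p a i j = a (p + i) (p + j)

  module Facets (q′ m′ : ℕ) where

    open Division q′

    m n k : ℕ
    m = suc m′
    n = m * q
    k = suc n

    Tight : (ℕ → ℕ) → Set
    Tight ℓ = cuts ℓ k + chords ℓ k q ≡ suc m

    -- The bound `ℓ i < k` makes `ℓ` a labelling by nodes, as `Labelling` demands.
    Vanishes : K → (ℕ → ℕ → K) → Set
    Vanishes α a = ∀ ℓ → Periodic ℓ k → (∀ i → ℓ i < k) → Tight ℓ → α ⊞ Φ k a ℓ ≡ 𝟘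

    -- The face is invariant under rotation of the cycle; iterated, this carries every equation
    -- found at node 0 to an arbitrary node.
    Vanishes-suc : ∀ α a → Periodic₂ a k → Vanishes α a → Vanishes α (shift 1 a)
    Vanishes-suc α a (perˡ , perʳ) vanishes ℓ per small tight = begin
      α ⊞ Φ k (shift 1 a) ℓ                         ≡⟨ cong (α ⊞_) (∑∑-cong k k λ i j _ _ → cong (λ x → a (suc i) (suc j) · ι x) (sym (cong₂ δ (back i) (back j)))) ⟩
      α ⊞ ∑∑ k k (λ i j → G (suc i) (suc j))        ≡⟨ cong (α ⊞_) (∑-cong k λ i _ → ∑-rotate₁ k (G (suc i)) (wrapʳ (suc i))) ⟩
      α ⊞ ∑ k (λ i → ∑ k (G (suc i)))               ≡⟨ cong (α ⊞_) (∑-rotate₁ k (λ i → ∑ k (G i)) (∑-cong k λ j _ → wrapˡ j)) ⟩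
      α ⊞ Φ k a ℓ′                                  ≡⟨ vanishes ℓ′ per′ (λ i → small (i + n)) tight′ ⟩
      𝟘                                             ∎
      where
      open ≡-Reasoning
      -- `n` is -1 modulo `k`, so this is the labelling turned by one node.
      ℓ′ : ℕ → ℕ
      ℓ′ i = ℓ (i + n)
      G : ℕ → ℕ → K
      G i j = a i j · ι (δ (ℓ′ i) (ℓ′ j))
      back : ∀ i → ℓ′ (suc i) ≡ ℓ i
      back i = trans (cong ℓ (sym (+-suc i n))) (per i)
      per′ : Periodic ℓ′ k
      per′ i = trans (cong ℓ (e i k n)) (per (i + n))
        where e : ∀ i k n → i + k + n ≡ i + n + k
              e = solve-∀
      wrapʳ : ∀ i → G i k ≡ G i 0
      wrapʳ i = cong₂ _·_ (perʳ i 0) (cong (λ x → ι (δ (ℓ′ i) x)) (per′ 0))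
      wrapˡ : ∀ j → G k j ≡ G 0 j
      wrapˡ j = cong₂ _·_ (perˡ 0 j) (cong (λ x → ι (δ x (ℓ′ j))) (per′ 0))
      tight′ : Tight ℓ′
      tight′ = trans (cong₂ _+_
        (trans (ℕ∑.∑-cong k λ i _ → cong (cut ℓ) (+-comm i n)) (ℕ∑.∑-rotate k (cut ℓ) (Cuts.cut-periodic ℓ per) n))
        (trans (ℕ∑.∑-cong k λ i _ → trans (cong (λ j → δ (ℓ (i + n)) (ℓ j)) (e i q n)) (cong (λ j → δ (ℓ j) (ℓ (j + q))) (+-comm i n)))
               (ℕ∑.∑-rotate k (λ i → δ (ℓ i) (ℓ (i + q))) (Cuts.chord-periodic ℓ per q) n))) tight
        where e : ∀ i q n → i + q + n ≡ i + n + q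
              e = solve-∀

    shift-periodic : ∀ p a → Periodic₂ a k → Periodic₂ (shift p a) k
    shift-periodic p a (perˡ , perʳ) =
      (λ i j → trans (cong (λ x → a x (p + j)) (sym (+-assoc p i k))) (perˡ (p + i) (p + j))) ,
      (λ i j → trans (cong (a (p + i)) (sym (+-assoc p j k))) (perʳ (p + i) (p + j)))

    Vanishes-ext : ∀ α a b → (∀ i j → a i j ≡ b i j) → Vanishes α a → Vanishes α b
    Vanishes-ext α a b eq vanishes ℓ per small tight = trans
      (cong (α ⊞_) (∑∑-cong k k λ i j _ _ → cong (_· ι (δ (ℓ i) (ℓ j))) (sym (eq i j)))) (vanishes ℓ per small tight)

    Vanishes-shift : ∀ p α a → Periodic₂ a k → Vanishes α a → Vanishes α (shift p a)
    Vanishes-shift zero    α a per vanishes = vanishes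
    Vanishes-shift (suc p) α a per vanishes = Vanishes-ext α (shift 1 (shift p a)) (shift (suc p) a) (λ i j → cong₂ a (+-suc p i) (+-suc p j))
      (Vanishes-suc α (shift p a) (shift-periodic p a per) (Vanishes-shift p α a per vanishes))

    vanishes-on : ∀ α a → Vanishes α a → ∀ h → (∀ i → i < k → h i < k) → Tight (wrapped h n) → α ⊞ Φ k a h ≡ 𝟘
    vanishes-on α a vanishes h small tight = trans (cong (α ⊞_) (Φ-cong k a λ i i<k → sym (wrapped-< h i<k)))
      (vanishes (wrapped h n) (wrapped-periodic h n) (λ i → small (i % k) (m%n<n i k)) tight)

    module Equations (α : K) (a : ℕ → ℕ → K) (vanishes : Vanishes α a) where

      B : ℕ → ℕ → K
      B = sym-part a

      private
        same-value : ∀ {x y} → α ⊞ x ≡ 𝟘 → α ⊞ y ≡ 𝟘 → x ≡ y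
        same-value {x} {y} ex ey = ⊞-cancelˡ α x y (trans ex (sym ey))

        on-family : ∀ {b s g} → Admissible b s g → suc (suc b) ≤ m → α ⊞ Φ k a (fam s g) ≡ 𝟘
        on-family {b} {s} {g} adm b+2≤m = vanishes-on α a vanishes (fam s g)
          (λ i i<k → ≤-<-trans (unitSteps-≤ Fam.f0 (Fam.unitSteps n) i (≤-pred i<k)) i<k) (Fam.tight b+2≤m)
          where module Fam = Family adm

        k-bound : ∀ {x} → 2 ≤ m → x ≤ q + q → x ≤ k
        k-bound 2≤m le = ≤-trans le (m≤n⇒m≤1+n (≤-trans (≤-reflexive (cong (q +_) (sym (+-identityʳ q)))) (*-monoˡ-≤ q 2≤m)))

      -- Both partitions of `Refinement` are tight, and they arise from `refined` by merging the
      -- singleton {l} with its left or with its right neighbour. The two merges must therefore add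
      -- the same amount.
      node-equation : 2 ≤ m → ∀ {l r} → 1 ≤ l → l < q → 1 ≤ r → r < q → q ≤ l + r →
        ∑ l (λ i → B i l) ≡ ∑ r (λ j → B l (suc l + j))
      node-equation 2≤m {l} {r} 1≤l l<q 1≤r r<q q≤l+r = begin
        ∑ l (λ i → B i l)                    ≡⟨ ∑-cong l (λ i _ → trans (cong (B i) (sym (+-identityʳ l))) (sym (⊞-identityʳ _))) ⟩
        ∑∑ l 1 (λ i j → B i (l + j))         ≡⟨ ⊞-cancelˡ (Φ k a refined) _ _ (trans (sym to-left) (trans left≡right to-right)) ⟩
        ∑∑ 1 r (λ i j → B (l + i) (suc l + j)) ≡⟨ trans (⊞-identityʳ _) (∑-cong r λ j _ → cong (λ x → B x (suc l + j)) (+-identityʳ l)) ⟩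
        ∑ r (λ j → B l (suc l + j))          ∎
        where
        open ≡-Reasoning
        open Refinement 1≤l l<q 1≤r r<q q≤l+r
        left≡right : Φ k a (fam (suc l) r) ≡ Φ k a (fam l (suc r))
        left≡right = same-value (on-family left 2≤m) (on-family right 2≤m)
        l+1≤ : l + 1 ≤ k
        l+1≤ = k-bound 2≤m (≤-trans (≤-reflexive (+-comm l 1)) (≤-trans l<q (m≤m+n q q)))
        to-left : Φ k a (fam (suc l) r) ≡ Φ k a refined ⊞ ∑∑ l 1 (λ i j → B i (l + j))
        to-left = trans (Φ-cong k a λ i _ → sym (pred-refined i))
          (Φ-merge k a (λ ()) pred-collapses interval₀ (≤-trans (m≤m+n l 1) l+1≤) interval₁ l+1≤)
        to-right : Φ k a (fam l (suc r)) ≡ Φ k a refined ⊞ ∑∑ 1 r (λ i j → B (l + i) (suc l + j))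
        to-right = trans (Φ-cong k a λ i _ → sym (pred₁-refined i))
          (Φ-merge k a (λ ()) pred₁-collapses interval₁ l+1≤ interval₂ (k-bound 2≤m (+-mono-≤ l<q (<⇒≤ r<q))))

      rectangle : ∀ {b s g t} → Admissible b s g → suc (suc (suc b)) ≤ m → q ≤ g → s + g + t ≡ suc (suc (suc b) * q) →
        ∑∑ s t (λ i j → B i (s + g + j)) ≡ 𝟘
      rectangle {b} {s} {g} {t} adm b+3≤m q≤g end = ⊞-cancelˡ (Φ k a f) _ _ (begin
        Φ k a f ⊞ ∑∑ s t (λ i j → B i (s + g + j))  ≡⟨ Φ-merge k a (λ ()) (absorb-collapses (suc (suc b))) interval-S s≤k (interval-T t end) end≤k ⟨
        Φ k a (merged b+2≤m b+3≤m q≤g)              ≡⟨ same-value (vanishes-on α a vanishes (merged b+2≤m b+3≤m q≤g) small (merged-tight b+2≤m b+3≤m q≤g)) (on-family adm b+2≤m) ⟩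
        Φ k a f                                     ≡⟨ ⊞-identityʳ _ ⟨
        Φ k a f ⊞ 𝟘                                 ∎)
        where
        open ≡-Reasoning
        open Family adm
        b+2≤m : suc (suc b) ≤ m
        b+2≤m = ≤-trans (n≤1+n _) b+3≤m
        end≤k : s + g + t ≤ k
        end≤k = ≤-trans (≤-reflexive end) (s≤s (*-monoˡ-≤ q b+2≤m))
        s≤k : 0 + s ≤ k
        s≤k = ≤-trans (≤-trans (m≤m+n s g) (m≤m+n (s + g) t)) end≤k
        absorb-≤ : ∀ c x → absorb c x ≤ x
        absorb-≤ c x with x ≟ c
        ... | yes _ = z≤n
        ... | no _  = ≤-refl
        small : ∀ i → i < k → merged b+2≤m b+3≤m q≤g i < k
        small i i<k = ≤-<-trans (absorb-≤ (suc (suc b)) (f i)) (≤-<-trans (unitSteps-≤ f0 (unitSteps n) i (≤-pred i<k)) i<k)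

      on-shifted : 2 ≤ m → α ⊞ Φ k a shifted ≡ 𝟘
      on-shifted (s≤s (s≤s {n = m″} _)) = vanishes-on α a vanishes shifted small (OneChordFace.shifted-tight {m″})
        where
        small : ∀ i → i < k → shifted i < k
        small i i<k = ≤-<-trans (≤-trans (m/n≤m (pred i) q) (pred[n]≤n {i})) i<k

      -- Merging the block {0} of `fam 1 q` with the next block, the nodes 1 to q, gives `shifted`:
      -- one cut is traded for the chord {0,q}, and both partitions are tight.
      window-equation : 2 ≤ m → ∑ q (λ j → B 0 (suc j)) ≡ 𝟘
      window-equation 2≤m = trans (sym (⊞-identityʳ _)) (⊞-cancelˡ (Φ k a (fam 1 q)) _ _ (begin
        Φ k a (fam 1 q) ⊞ ∑∑ 1 q (λ i j → B i (suc j))  ≡⟨ Φ-merge k a (λ ()) pred-collapses interval-S (s≤s z≤n) (interval-gap refl) q<k ⟨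
        Φ k a (pred ∘ fam 1 q)                          ≡⟨ Φ-cong k a (λ i _ → pred-fam i) ⟩
        Φ k a shifted                                   ≡⟨ same-value (on-shifted 2≤m) (on-family adm 2≤m) ⟩
        Φ k a (fam 1 q)                                 ≡⟨ ⊞-identityʳ _ ⟨
        Φ k a (fam 1 q) ⊞ 𝟘                             ∎))
        where
        open ≡-Reasoning
        adm : Admissible 0 1 q
        adm = record { 1≤s = ≤-refl ; s≤q = s≤s z≤n ; bq<g = z<s ; g≤ = ≤-reflexive (sym (+-identityʳ q))
                     ; <s+g = ≤-reflexive (cong suc (+-identityʳ q)) }
        open Family adm using (interval-S; interval-gap)
        q<k : q < k
        q<k = s≤s (m≤m+n q (m′ * q))
        pred-fam : ∀ i → pred (fam 1 q i) ≡ shifted i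
        pred-fam zero    = sym (/-unique 0 z≤n z<s)
        pred-fam (suc y) with <-≤-connex y q
        ... | inj₁ lt = cong pred (fam-gap {1} y lt)
        ... | inj₂ ge = cong pred (fam-rest {1} y (s≤s ge))

      constant-zero : 2 ≤ m → (∀ i j → i < k → j < k → a i j ≡ 𝟘) → α ≡ 𝟘
      constant-zero 2≤m zeros = begin
        α                          ≡⟨ ⊞-identityʳ α ⟨
        α ⊞ 𝟘                      ≡⟨ cong (α ⊞_) (∑-zero k λ i i<k → ∑-zero k λ j j<k →
                                        trans (cong (_· ι (δ (shifted i) (shifted j))) (zeros i j i<k j<k)) (zeroˡ _)) ⟨
        α ⊞ Φ k a shifted          ≡⟨ on-shifted 2≤m ⟩
        𝟘                          ∎
        where open ≡-Reasoning

-- The coefficients of a functional that vanishes on the face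

module Coefficients (F : DecField) (r m″ : ℕ) where

  open Functionals F
  open Division (suc r)

  private
    m n k : ℕ
    m = suc (suc m″)
    n = m * q
    k = suc n

  module _ (B : ℕ → ℕ → K) (B-sym : ∀ i j → B i j ≡ B j i) (B-periodic : ∀ i j → B i (j + k) ≡ B i j)
    (node : ∀ p {l r} → 1 ≤ l → l < q → 1 ≤ r → r < q → q ≤ l + r →
       ∑ l (λ i → B (p + i) (p + l)) ≡ ∑ r (λ j → B (p + l) (p + (suc l + j))))
    (window : ∀ p → ∑ q (λ j → B (p + 0) (p + suc j)) ≡ 𝟘)
    (rectangle : ∀ p {b s g t} → Admissible b s g → suc (suc (suc b)) ≤ m → q ≤ g → s + g + t ≡ suc (suc (suc b) * q) →
       ∑∑ s t (λ i j → B (p + i) (p + (s + g + j))) ≡ 𝟘)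
    (B01 : B 0 1 ≡ 𝟘)
    (exception : m ≡ 3 → q ≡ 3 ⊎ 2 ∣ q) where

    D : ℕ → ℕ → K
    D d p = B p (p + d)

    at : ∀ {i i′ j j′} → i ≡ i′ → j ≡ j′ → B i j ≡ B i′ j′
    at = cong₂ B

    D-periodic : ∀ d p → D d (p + k) ≡ D d p
    D-periodic d p = begin
      B (p + k) (p + k + d)   ≡⟨ at refl (e p k d) ⟩
      B (p + k) (p + d + k)   ≡⟨ B-periodic (p + k) (p + d) ⟩
      B (p + k) (p + d)       ≡⟨ B-sym (p + k) (p + d) ⟩
      B (p + d) (p + k)       ≡⟨ B-periodic (p + d) p ⟩
      B (p + d) p             ≡⟨ B-sym (p + d) p ⟩
      B p (p + d)             ∎
      where
      open ≡-Reasoning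
      e : ∀ p k d → p + k + d ≡ p + d + k
      e = solve-∀

    D-complement : ∀ {d d′} → d + d′ ≡ k → ∀ p → D d p ≡ D d′ (p + d)
    D-complement {d} {d′} eq p = begin
      B p (p + d)               ≡⟨ B-sym p (p + d) ⟩
      B (p + d) p               ≡⟨ B-periodic (p + d) p ⟨
      B (p + d) (p + k)         ≡⟨ at refl (trans (cong (p +_) (sym eq)) (sym (+-assoc p d d′))) ⟩
      B (p + d) (p + d + d′)    ∎
      where open ≡-Reasoning

    periods : ∀ d c p → D d (p + c * k) ≡ D d p
    periods d zero    p = cong (D d) (+-identityʳ p)
    periods d (suc c) p = trans (cong (D d) (e p k (c * k))) (trans (D-periodic d (p + c * k)) (periods d c p))
      where e : ∀ p k x → p + (k + x) ≡ p + x + k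
            e = solve-∀

    -- D d is periodic, so what holds after a fixed translation holds everywhere.
    unshift : ∀ d c {z} → (∀ p → D d (p + c) ≡ z) → ∀ p → D d p ≡ z
    unshift d c eq p = trans (sym (periods d c p)) (trans (cong (D d) (e p c n)) (eq (p + c * n)))
      where e : ∀ p c n → p + c * suc n ≡ p + c * n + c
            e = solve-∀

    neg-unique : ∀ {x y z} → x ⊞ y ≡ 𝟘 → y ⊞ z ≡ 𝟘 → x ≡ z
    neg-unique {x} {y} {z} xy yz = begin
      x              ≡⟨ ⊞-identityʳ x ⟨
      x ⊞ 𝟘          ≡⟨ cong (x ⊞_) yz ⟨
      x ⊞ (y ⊞ z)    ≡⟨ ⊞-assoc x y z ⟨
      x ⊞ y ⊞ z      ≡⟨ cong (_⊞ z) xy ⟩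
      𝟘 ⊞ z          ≡⟨ ⊞-identityˡ z ⟩
      z              ∎
      where open ≡-Reasoning

    other-zero : ∀ {x y} → x ⊞ y ≡ 𝟘 → x ≡ 𝟘 → y ≡ 𝟘
    other-zero {x} {y} xy x≡0 = trans (sym (⊞-identityˡ y)) (trans (cong (_⊞ y) (sym x≡0)) xy)

    first-zero : ∀ {x y} → x ⊞ y ≡ 𝟘 → y ≡ 𝟘 → x ≡ 𝟘
    first-zero {x} {y} xy = other-zero (trans (⊞-comm y x) xy)

    2≤m : 2 ≤ m
    2≤m = s≤s (s≤s z≤n)

    -- With l = q - 1 the left side of `node` is the same for every r from 1 to q - 1. Comparing r =
    -- d - 1 with r = d leaves one term, at distance d.
    interior : ∀ d → 2 ≤ d → d < q → ∀ p → D d p ≡ 𝟘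
    interior (suc zero) (s≤s ())
    interior (suc (suc e)) _ (s≤s (s≤s e<r)) = unshift d (suc r) λ p → begin
      D d (p + suc r)                      ≡⟨ at refl (shape p r e) ⟩
      B (p + suc r) (p + (q + suc e))      ≡⟨ ⊞-identityˡ _ ⟨
      𝟘 ⊞ B (p + suc r) (p + (q + suc e))  ≡⟨ ⊞-cancelˡ (row p (suc e)) _ _ (trans (cong (row p (suc e) ⊞_) (⊞-identityˡ _))
                                                (trans (sym (∑-snoc (suc e) (λ j → B (p + suc r) (p + (q + j)))))
                                                (trans (trans (sym (eq p (suc (suc e)) (s≤s z≤n) (s≤s (s≤s e<r)))) (eq p (suc e) (s≤s z≤n) (s≤s (m≤n⇒m≤1+n e<r)))) (sym (⊞-identityʳ _))))) ⟩
      𝟘                                    ∎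
      where
      open ≡-Reasoning
      d = suc (suc e)
      row : ℕ → ℕ → K
      row p r′ = ∑ r′ (λ j → B (p + suc r) (p + (q + j)))
      shape : ∀ p r e → p + suc r + suc (suc e) ≡ p + (suc (suc r) + suc e)
      shape = solve-∀
      eq : ∀ p r′ → 1 ≤ r′ → r′ < q → ∑ (suc r) (λ i → B (p + i) (p + suc r)) ≡ row p r′
      eq p r′ 1≤r′ r′<q = node p {suc r} {r′} (s≤s z≤n) ≤-refl 1≤r′ r′<q (≤-trans (≤-reflexive (+-comm 1 (suc r))) (+-monoʳ-≤ (suc r) 1≤r′))

    -- This is `node` with l = 1 and r = q - 1: on the right only the first term has distance 1, and
    -- the others vanish by `interior`. All edges of the cycle thus share the coefficient of {0,1}.
    edge-step : ∀ p → D 1 p ≡ D 1 (suc p)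
    edge-step p = begin
      B p (p + 1)                                       ≡⟨ at (sym (+-identityʳ p)) refl ⟩
      B (p + 0) (p + 1)                                 ≡⟨ ⊞-identityʳ _ ⟨
      ∑ 1 (λ i → B (p + i) (p + 1))                     ≡⟨ node p {1} {suc r} ≤-refl (s≤s (s≤s z≤n)) (s≤s z≤n) ≤-refl ≤-refl ⟩
      ∑ (suc r) (λ j → B (p + 1) (p + (2 + j)))         ≡⟨ cong (B (p + 1) (p + 2) ⊞_) (∑-zero r λ j j<r → trans (at refl (e p j)) (interior (suc (suc j)) (s≤s (s≤s z≤n)) (s≤s (s≤s j<r)) (p + 1))) ⟩
      B (p + 1) (p + 2) ⊞ 𝟘                             ≡⟨ ⊞-identityʳ _ ⟩
      B (p + 1) (p + 2)                                 ≡⟨ at (+-comm p 1) (e′ p) ⟩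
      B (suc p) (suc p + 1)                             ∎
      where
      open ≡-Reasoning
      e : ∀ p j → p + (2 + suc j) ≡ p + 1 + suc (suc j)
      e = solve-∀
      e′ : ∀ p → p + 2 ≡ suc p + 1
      e′ = solve-∀

    edge-zero : ∀ p → D 1 p ≡ 𝟘
    edge-zero zero    = B01
    edge-zero (suc p) = trans (sym (edge-step p)) (edge-zero p)

    chord-zero : ∀ p → D q p ≡ 𝟘
    chord-zero p = begin
      B p (p + q)                                           ≡⟨ at (sym (+-identityʳ p)) refl ⟩
      B (p + 0) (p + q)                                     ≡⟨ ⊞-identityˡ _ ⟨
      𝟘 ⊞ B (p + 0) (p + q)                                 ≡⟨ cong (_⊞ B (p + 0) (p + q)) (∑-zero (suc r) short) ⟨
      ∑ (suc r) (λ j → B (p + 0) (p + suc j)) ⊞ B (p + 0) (p + q) ≡⟨ ∑-snoc (suc r) (λ j → B (p + 0) (p + suc j)) ⟨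
      ∑ q (λ j → B (p + 0) (p + suc j))                     ≡⟨ window p ⟩
      𝟘                                                     ∎
      where
      open ≡-Reasoning
      short : ∀ j → j < suc r → B (p + 0) (p + suc j) ≡ 𝟘
      short zero    _         = trans (at (+-identityʳ p) refl) (edge-zero p)
      short (suc j) (s≤s j<r) = trans (at (+-identityʳ p) refl) (interior (suc (suc j)) (s≤s (s≤s z≤n)) (s≤s (s≤s j<r)) p)

    short-zero : ∀ d → 1 ≤ d → d ≤ q → ∀ p → D d p ≡ 𝟘
    short-zero (suc zero)    _ _   = edge-zero
    short-zero (suc (suc e)) _ d≤q with m≤n⇒m<n∨m≡n d≤q
    ... | inj₁ d<q  = interior (suc (suc e)) (s≤s (s≤s z≤n)) d<q
    ... | inj₂ refl = chord-zero

    -- β blocks of size q between the two merged pieces of sizes s and t.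
    full-rectangle : ∀ β → 1 ≤ β → suc (suc β) ≤ m → ∀ p s t → s + t ≡ suc q →
      ∑∑ s t (λ i j → B (p + i) (p + (s + β * q + j))) ≡ 𝟘
    full-rectangle β 1≤β β+2≤m p zero t eq = refl
    full-rectangle β 1≤β β+2≤m p s@(suc _) zero eq = ∑-zero s λ _ _ → refl
    full-rectangle (suc b) _ β+2≤m p (suc s) (suc t) eq = rectangle p adm β+2≤m (m≤m+n q (b * q)) end
      where
      adm : Admissible b (suc s) (suc b * q)
      adm = record { 1≤s = s≤s z≤n ; s≤q = ≤-trans (m≤m+n (suc s) t) (≤-reflexive (suc-injective (trans (sym (+-suc (suc s) t)) eq)))
                   ; bq<g = m<n+m (b * q) z<s ; g≤ = ≤-refl ; <s+g = m<n+m (suc b * q) z<s }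
      end : suc s + suc b * q + suc t ≡ suc (suc (suc b) * q)
      end = trans (e s b q t) (cong (_+ suc b * q) eq)
        where e : ∀ s b q t → suc s + suc b * q + suc t ≡ suc s + suc t + suc b * q
              e = solve-∀

    -- The rectangle of `suc s` rows and `t` columns at `p` and that of `s` rows and `suc t` columns
    -- at `suc p` overlap in `M`. What remains is the first row of one and the last column of the
    -- other.
    row-column : ∀ β → 1 ≤ β → suc (suc β) ≤ m → ∀ p s t → s + t ≡ q →
      ∑ t (λ j → B p (p + (suc s + β * q + j))) ≡ ∑ s (λ i → B (suc p + i) (suc p + (s + β * q + t)))
    row-column β 1≤β β+2≤m p s t eq = ⊞-cancelʳ M _ _ (begin
      row ⊞ M             ≡⟨ cong (_⊞ M) (∑-cong t λ j _ → cong (λ x → B x (p + (suc s + β * q + j))) (sym (+-identityʳ p))) ⟩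
      ∑ t (λ j → B (p + 0) (p + (suc s + β * q + j))) ⊞ M ≡⟨ full-rectangle β 1≤β β+2≤m p (suc s) t (cong suc eq) ⟩
      𝟘                   ≡⟨ full-rectangle β 1≤β β+2≤m (suc p) s (suc t) (trans (+-suc s t) (cong suc eq)) ⟨
      ∑∑ s (suc t) (λ i j → B (suc p + i) (suc p + (s + β * q + j)))
                          ≡⟨ trans (∑-cong s λ i _ → ∑-snoc t (λ j → B (suc p + i) (suc p + (s + β * q + j))))
                               (∑-add s (λ i → ∑ t (λ j → B (suc p + i) (suc p + (s + β * q + j)))) (λ i → B (suc p + i) (suc p + (s + β * q + t)))) ⟩
      ∑∑ s t (λ i j → B (suc p + i) (suc p + (s + β * q + j))) ⊞ column
                          ≡⟨ cong (_⊞ column) (∑∑-cong s t λ i j _ _ → at (sym (+-suc p i)) (sym (+-suc p (s + β * q + j)))) ⟩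
      M ⊞ column          ≡⟨ ⊞-comm M column ⟩
      column ⊞ M          ∎)
      where
      open ≡-Reasoning
      row column M : K
      row = ∑ t (λ j → B p (p + (suc s + β * q + j)))
      column = ∑ s (λ i → B (suc p + i) (suc p + (s + β * q + t)))
      M = ∑∑ s t (λ i j → B (p + suc i) (p + (suc s + β * q + j)))

    -- The difference of `row-column` for two consecutive values of `s`: the row loses its first
    -- entry while the column, which stays at the same node, gains its last one.
    flip : ∀ β → 1 ≤ β → suc (suc β) ≤ m → ∀ c c′ → 1 ≤ c → 1 ≤ c′ → c + c′ ≡ suc q → ∀ p →
      D (β * q + c) p ⊞ D (β * q + c′) (p + c) ≡ 𝟘
    flip β 1≤β β+2≤m (suc c) (suc c′) _ _ eq p = ⊞-cancelʳ col _ _ (begin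
      D (β * q + suc c) p ⊞ D (β * q + suc c′) (p + suc c) ⊞ col
        ≡⟨ cong₂ (λ x y → x ⊞ y ⊞ col) (at refl (e₁ p c (β * q))) (at (+-suc p c) (e₂ p c c′ (β * q))) ⟩
      head ⊞ L ⊞ col        ≡⟨ trans (⊞-assoc head L col) (cong (head ⊞_) (⊞-comm L col)) ⟩
      head ⊞ (col ⊞ L)      ≡⟨ cong (head ⊞_) (∑-snoc c (λ i → B (suc p + i) (suc p + (suc c + β * q + c′)))) ⟨
      head ⊞ ∑ (suc c) (λ i → B (suc p + i) (suc p + (suc c + β * q + c′)))
                          ≡⟨ cong (head ⊞_) (row-column β 1≤β β+2≤m p (suc c) c′ (suc-injective (trans (cong suc (sym (+-suc c c′))) eq))) ⟨
      head ⊞ ∑ c′ (λ j → B p (p + (suc (suc c) + β * q + j)))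
                          ≡⟨ cong (head ⊞_) (∑-cong c′ λ j _ → at refl (e₃ p c (β * q) j)) ⟩
      ∑ (suc c′) (λ j → B p (p + (suc c + β * q + j)))
                          ≡⟨ row-column β 1≤β β+2≤m p c (suc c′) (suc-injective eq) ⟩
      ∑ c (λ i → B (suc p + i) (suc p + (c + β * q + suc c′)))
                          ≡⟨ ∑-cong c (λ i _ → cong (B (suc p + i)) (cong (suc p +_) (+-suc (c + β * q) c′))) ⟩
      col                   ≡⟨ ⊞-identityˡ col ⟨
      𝟘 ⊞ col               ∎)
      where
      open ≡-Reasoning
      head L col : K
      head = B p (p + (suc c + β * q + 0))
      L = B (suc p + c) (suc p + (suc c + β * q + c′))
      col = ∑ c (λ i → B (suc p + i) (suc p + (suc c + β * q + c′)))
      e₁ : ∀ p c x → p + (x + suc c) ≡ p + (suc c + x + 0)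
      e₁ = solve-∀
      e₂ : ∀ p c c′ x → p + suc c + (x + suc c′) ≡ suc p + (suc c + x + c′)
      e₂ = solve-∀
      e₃ : ∀ p c x j → p + (suc (suc c) + x + j) ≡ p + (suc c + x + suc j)
      e₃ = solve-∀

    -- For β ≥ 2 the gap may also have length βq - 1: it still holds β blocks and at least q nodes.
    -- The rectangle across this gap has one more column on its left than the rectangle across βq
    -- nodes, and that column is the difference.
    column-sum : ∀ β → 2 ≤ β → suc (suc β) ≤ m → ∀ s → 1 ≤ s → s < q → ∀ p →
      ∑ (suc s) (λ i → B (p + i) (p + (s + β * q))) ≡ 𝟘
    column-sum (suc zero) (s≤s ())
    column-sum (suc (suc b)) _ β+2≤m s 1≤s s<q p = first-zero (begin
      ∑ (suc s) (λ i → B (p + i) (p + (s + β * q))) ⊞ ∑∑ (suc s) t (λ i j → B (p + i) (p + (suc s + β * q + j)))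
        ≡⟨ cong₂ _⊞_ (∑-cong (suc s) λ i _ → cong (λ x → B (p + i) (p + x)) (e₁ s r (suc b * q)))
                     (∑∑-cong (suc s) t λ i j _ _ → cong (λ x → B (p + i) (p + x)) (e₂ s r (suc b * q) j)) ⟩
      ∑ (suc s) (λ i → B (p + i) (p + (suc s + g + 0))) ⊞ ∑∑ (suc s) t (λ i j → B (p + i) (p + (suc s + g + suc j)))
        ≡⟨ ∑-add (suc s) (λ i → B (p + i) (p + (suc s + g + 0))) (λ i → ∑ t (λ j → B (p + i) (p + (suc s + g + suc j)))) ⟨
      ∑∑ (suc s) (suc t) (λ i j → B (p + i) (p + (suc s + g + j)))  ≡⟨ rectangle p adm β+2≤m q≤g end ⟩
      𝟘 ∎) (full-rectangle β (s≤s z≤n) β+2≤m p (suc s) t (cong suc s+t≡q))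
      where
      open ≡-Reasoning
      β g t : ℕ
      β = suc (suc b)
      g = suc r + suc b * q
      t = q ∸ s
      s+t≡q : s + t ≡ q
      s+t≡q = m+[n∸m]≡n (<⇒≤ s<q)
      e₁ : ∀ s r x → s + (suc (suc r) + x) ≡ suc s + (suc r + x) + 0
      e₁ = solve-∀
      e₂ : ∀ s r x j → suc s + (suc (suc r) + x) + j ≡ suc s + (suc r + x) + suc j
      e₂ = solve-∀
      adm : Admissible (suc b) (suc s) g
      adm = record { 1≤s = s≤s z≤n ; s≤q = s<q ; bq<g = m<n+m (suc b * q) z<s ; g≤ = n≤1+n _
                   ; <s+g = s≤s (+-monoˡ-≤ g 1≤s) }
      q≤g : q ≤ g
      q≤g = ≤-trans (m≤m+n q (b * q)) (m≤n+m (suc b * q) (suc r))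
      end : suc s + g + suc t ≡ suc (suc (suc (suc b)) * q)
      end = trans (e s r t (suc b * q)) (cong (λ x → suc (suc (suc r) + (x + suc b * q))) s+t≡q)
        where e : ∀ s r t x → suc s + (suc r + x) + suc t ≡ suc (suc (suc r) + (s + t + x))
              e = solve-∀

    -- The column sums for s at p and for s - 1 at p + 1 run along the same column and differ only
    -- in row p.
    long-interior : ∀ β → 2 ≤ β → suc (suc β) ≤ m → ∀ s → 2 ≤ s → s < q → ∀ p → D (β * q + s) p ≡ 𝟘
    long-interior β 2≤β β+2≤m (suc zero) (s≤s ())
    long-interior β 2≤β β+2≤m (suc (suc s)) _ s<q p = first-zero
      (trans (cong (_⊞ ∑ (suc (suc s)) (λ i → B (p + suc i) (p + (suc (suc s) + β * q)))) (at (sym (+-identityʳ p)) (cong (p +_) (+-comm (β * q) (suc (suc s))))))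
             (column-sum β 2≤β β+2≤m (suc (suc s)) (s≤s z≤n) s<q p))
      (trans (∑-cong (suc (suc s)) λ i _ → cong₂ B (+-suc p i) (+-suc p (suc s + β * q))) (column-sum β 2≤β β+2≤m (suc s) (s≤s z≤n) (<-trans (n<1+n _) s<q) (suc p)))

    long-corner : ∀ β → 2 ≤ β → suc (suc β) ≤ m → ∀ p → D (β * q + 1) p ⊞ D (β * q) (p + 1) ≡ 𝟘
    long-corner β 2≤β β+2≤m p = trans
      (cong₂ _⊞_ (at (sym (+-identityʳ p)) (cong (p +_) (+-comm (β * q) 1)))
                 (trans (at refl (+-assoc p 1 (β * q))) (sym (⊞-identityʳ (B (p + 1) (p + (1 + β * q)))))))
      (column-sum β 2≤β β+2≤m 1 ≤-refl (s≤s (s≤s z≤n)) p)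

    flip-corner : ∀ β → 1 ≤ β → suc (suc β) ≤ m → ∀ p → D (β * q + 1) p ⊞ D (β * q + q) (p + 1) ≡ 𝟘
    flip-corner β 1≤β β+2≤m = flip β 1≤β β+2≤m 1 q ≤-refl (s≤s z≤n) refl

    module LargeCycle (4≤m : 4 ≤ m) where

      κ : ℕ → K
      κ = D (1 * q + 1)

      -- `flip-corner` at β and `long-corner` at β + 1 both contain the coefficient at distance (β +
      -- 1)q, so the coefficients at distances βq + 1 and (β + 1)q + 1 are negatives of the same
      -- number.
      corner-constant : ∀ β → suc (suc (suc β)) ≤ m → ∀ p → D (suc β * q + 1) p ≡ κ p
      corner-constant zero    _     p = refl
      corner-constant (suc β) β+4≤m p = trans
        (sym (neg-unique (flip-corner (suc β) (s≤s z≤n) (<⇒≤ β+4≤m) p)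
          (trans (⊞-comm _ _) (trans (cong (λ x → D (suc (suc β) * q + 1) p ⊞ D x (p + 1)) (+-comm (suc β * q) q))
            (long-corner (suc (suc β)) (s≤s (s≤s z≤n)) β+4≤m p)))))
        (corner-constant β (<⇒≤ β+4≤m) p)

      -- Write b and c for `suc β` and `suc γ`. Since k = (b + c + 1)q + 1, an edge at distance bq +
      -- 1 has distance cq + q when seen from its other end, and `flip-corner` takes it from there
      -- to distance cq + 1 at the node p + bq.
      corner-negates : ∀ β γ → suc β + suc γ + 1 ≡ m → ∀ p → κ p ⊞ κ (p + suc β * q) ≡ 𝟘
      corner-negates β γ eq p = begin
        κ p ⊞ κ p′                                  ≡⟨ ⊞-comm _ _ ⟩
        κ p′ ⊞ κ p                                  ≡⟨ cong₂ _⊞_ (corner-constant γ γ-bound p′) (corner-constant β β-bound p) ⟨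
        D (suc γ * q + 1) p′ ⊞ D (suc β * q + 1) p  ≡⟨ cong (D (suc γ * q + 1) p′ ⊞_) (trans (D-complement complement p) (cong (D (suc γ * q + q)) (sym (+-assoc p (suc β * q) 1)))) ⟩
        D (suc γ * q + 1) p′ ⊞ D (suc γ * q + q) (p′ + 1)  ≡⟨ flip-corner (suc γ) (s≤s z≤n) γ-bound p′ ⟩
        𝟘                                           ∎
        where
        open ≡-Reasoning
        p′ = p + suc β * q
        e₁ : ∀ β γ → suc β + suc γ + 1 ≡ suc (suc (suc β)) + γ
        e₁ = solve-∀
        e₂ : ∀ β γ → suc β + suc γ + 1 ≡ suc (suc (suc γ)) + β
        e₂ = solve-∀
        β-bound : suc (suc (suc β)) ≤ m
        β-bound = ≤-trans (m≤m+n _ γ) (≤-reflexive (trans (sym (e₁ β γ)) eq))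
        γ-bound : suc (suc (suc γ)) ≤ m
        γ-bound = ≤-trans (m≤m+n _ β) (≤-reflexive (trans (sym (e₂ β γ)) eq))
        e₃ : ∀ β γ q → suc β * q + 1 + (suc γ * q + q) ≡ suc ((suc β + suc γ + 1) * q)
        e₃ = solve-∀
        complement : suc β * q + 1 + (suc γ * q + q) ≡ k
        complement = trans (e₃ β γ q) (cong (λ x → suc (x * q)) eq)

      -- Translation by q negates `κ`, so translation by 2q preserves it; but m ≥ 4 lets
      -- `corner-negates` apply to 2q as well, where it negates.
      κ-zero : ∀ p → κ p ≡ 𝟘
      κ-zero p = self-negative (trans (cong (κ p ⊞_) κp≡) (corner-negates 1 (m ∸ 4) shape₂ p))
        where
        shape₁ : 1 + suc (m ∸ 3) + 1 ≡ m
        shape₁ = trans (+-comm (1 + suc (m ∸ 3)) 1) (m+[n∸m]≡n (<⇒≤ 4≤m))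
        shape₂ : 2 + suc (m ∸ 4) + 1 ≡ m
        shape₂ = trans (+-comm (2 + suc (m ∸ 4)) 1) (m+[n∸m]≡n 4≤m)
        κp≡ : κ p ≡ κ (p + 2 * q)
        κp≡ = neg-unique (corner-negates 0 (m ∸ 3) shape₁ p)
          (trans (cong (λ x → κ (p + 1 * q) ⊞ κ x) (e p q)) (corner-negates 0 (m ∸ 3) shape₁ (p + 1 * q)))
          where e : ∀ p q → p + 2 * q ≡ p + 1 * q + 1 * q
                e = solve-∀

      corner-zero : ∀ β → 1 ≤ β → suc (suc β) ≤ m → ∀ p → D (β * q + 1) p ≡ 𝟘
      corner-zero (suc β) _ le p = trans (corner-constant β le p) (κ-zero p)

      four-zero : ∀ β → 1 ≤ β → suc (suc β) ≤ m → ∀ c → 1 ≤ c → c ≤ q → ∀ p → D (β * q + c) p ≡ 𝟘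
      four-zero β 1≤β β+2≤m (suc zero) _ _ p = corner-zero β 1≤β β+2≤m p
      four-zero β 1≤β β+2≤m c@(suc (suc c″)) _ c≤q with m≤n⇒m<n∨m≡n c≤q | m≤n⇒m<n∨m≡n 1≤β
      ... | inj₂ refl | _ = unshift (β * q + q) 1 λ p → other-zero (flip-corner β 1≤β β+2≤m p) (corner-zero β 1≤β β+2≤m p)
      ... | inj₁ c<q | inj₁ 2≤β = long-interior β 2≤β β+2≤m c (s≤s (s≤s z≤n)) c<q
      ... | inj₁ c<q | inj₂ refl = λ p → trans (D-complement complement p)
        (long-interior m″ (≤-pred (≤-pred 4≤m)) ≤-refl (suc c*) 2≤ c*<q (p + (1 * q + c)))
        where
        c* : ℕ
        c* = q ∸ c
        c+c*≡q : c + c* ≡ q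
        c+c*≡q = m+[n∸m]≡n c≤q
        2≤ : 2 ≤ suc c*
        2≤ = s≤s (m<n⇒0<n∸m c<q)
        c*<q : suc c* < q
        c*<q = ≤-trans (s≤s (s≤s (m≤n+m c* c″))) (≤-reflexive c+c*≡q)
        complement : 1 * q + c + (m″ * q + suc c*) ≡ k
        complement = trans (e q c m″ c*) (cong (λ x → suc (q + (x + m″ * q))) c+c*≡q)
          where e : ∀ q c m x → 1 * q + c + (m * q + suc x) ≡ suc (q + (c + x + m * q))
                e = solve-∀

    module SmallCycle (m≡3 : m ≡ 3) where

      1+2≤m : 3 ≤ m
      1+2≤m = ≤-reflexive (sym m≡3)

      E : ℕ → ℕ → K
      E c = D (1 * q + c)

      flip₁ : ∀ c c′ → 1 ≤ c → 1 ≤ c′ → c + c′ ≡ suc q → ∀ p → E c p ⊞ E c′ (p + c) ≡ 𝟘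
      flip₁ = flip 1 ≤-refl 1+2≤m

      module _ {c c′} (1≤c : 1 ≤ c) (1≤c′ : 1 ≤ c′) (c+c′ : c + c′ ≡ suc q) where

        c′+c : c′ + c ≡ suc q
        c′+c = trans (+-comm c′ c) c+c′

        period-q+1 : ∀ p → E c (p + suc q) ≡ E c p
        period-q+1 p = sym (trans (neg-unique (flip₁ c c′ 1≤c 1≤c′ c+c′ p) (flip₁ c′ c 1≤c′ 1≤c c′+c (p + c)))
          (cong (E c) (trans (+-assoc p c c′) (cong (p +_) c+c′))))

        -- 3 (q + 1) = k + 2.
        period-2 : ∀ p → E c (p + 2) ≡ E c p
        period-2 p = begin
          E c (p + 2)                           ≡⟨ D-periodic (1 * q + c) (p + 2) ⟨
          E c (p + 2 + k)                       ≡⟨ cong (E c) (trans (cong (λ x → p + 2 + suc (x * q)) m≡3) (e p q)) ⟩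
          E c (p + suc q + suc q + suc q)       ≡⟨ trans (period-q+1 (p + suc q + suc q)) (trans (period-q+1 (p + suc q)) (period-q+1 p)) ⟩
          E c p                                 ∎
          where
          open ≡-Reasoning
          e : ∀ p q → p + 2 + suc (3 * q) ≡ p + suc q + suc q + suc q
          e = solve-∀

        period-even : ∀ h p → E c (p + h * 2) ≡ E c p
        period-even zero    p = cong (E c) (+-identityʳ p)
        period-even (suc h) p = trans (cong (E c) (e p (h * 2))) (trans (period-2 (p + h * 2)) (period-even h p))
          where e : ∀ p x → p + (2 + x) ≡ p + x + 2
                e = solve-∀

        complement₁ : ∀ p → E c p ≡ E c′ (p + (1 * q + c))
        complement₁ = D-complement (trans (e c c′ q) (trans (cong (λ x → x + 2 * q) c+c′) (cong (λ x → suc (x * q)) (sym m≡3))))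
          where e : ∀ c c′ q → 1 * q + c + (1 * q + c′) ≡ c + c′ + 2 * q
                e = solve-∀

      -- Viewed from its other end, `E c p` is `E c′` at p + c + q. For even q the period 2 removes
      -- the q, and `flip₁` says that the same coefficient is the negative of `E c p`.
      even-zero : 2 ∣ q → ∀ c c′ → 1 ≤ c → 1 ≤ c′ → c + c′ ≡ suc q → ∀ p → E c p ≡ 𝟘
      even-zero (divides h q≡2h) c c′ 1≤c 1≤c′ c+c′ p = self-negative (trans (cong (E c p ⊞_) same) (flip₁ c c′ 1≤c 1≤c′ c+c′ p))
        where
        same : E c p ≡ E c′ (p + c)
        same = begin
          E c p                       ≡⟨ complement₁ 1≤c 1≤c′ c+c′ p ⟩
          E c′ (p + (1 * q + c))      ≡⟨ cong (E c′) (trans (e p q c) (cong (p + c +_) q≡2h)) ⟩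
          E c′ (p + c + h * 2)        ≡⟨ period-even 1≤c′ 1≤c (c′+c 1≤c 1≤c′ c+c′) h (p + c) ⟩
          E c′ (p + c)                ∎
          where
          open ≡-Reasoning
          e : ∀ p q c → p + (1 * q + c) ≡ p + c + q
          e = solve-∀

      module Three (q≡3 : q ≡ 3) where

        1≤3 : 1 ≤ 3
        1≤3 = s≤s z≤n

        4≡ : 4 ≡ suc q
        4≡ = cong suc (sym q≡3)

        -- For q = 3 the class c = 2 is its own partner under `flip₁`, with translation 2, which is
        -- a period.
        E₂-zero : ∀ p → E 2 p ≡ 𝟘
        E₂-zero p = self-negative (trans (cong (E 2 p ⊞_) (sym (period-2 {2} {2} (s≤s z≤n) (s≤s z≤n) 4≡ p)))
          (flip₁ 2 2 (s≤s z≤n) (s≤s z≤n) 4≡ p))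

        E₃≡E₁ : ∀ p → E 3 p ≡ E 1 p
        E₃≡E₁ p = sym (begin
          E 1 p                   ≡⟨ complement₁ {1} {3} ≤-refl 1≤3 4≡ p ⟩
          E 3 (p + (1 * q + 1))   ≡⟨ cong (λ x → E 3 (p + (1 * x + 1))) q≡3 ⟩
          E 3 (p + 4)             ≡⟨ period-even {3} {1} 1≤3 ≤-refl 4≡ 2 p ⟩
          E 3 p                   ∎)
          where open ≡-Reasoning

        -- `flip₁` and the complement still admit `E 1` equal to `E 3` with alternating signs. The
        -- rectangle with one row and q columns decides: it says that `E 1`, `E 2` and `E 3` at p
        -- sum to 0.
        E₁-zero : ∀ p → E 1 p ≡ 𝟘
        E₁-zero p = self-negative (begin
          E 1 p ⊞ E 1 p                       ≡⟨ cong (E 1 p ⊞_) (E₃≡E₁ p) ⟨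
          E 1 p ⊞ E 3 p                       ≡⟨ cong (E 1 p ⊞_) (trans (cong (_⊞ E 3 p) (E₂-zero p)) (⊞-identityˡ _)) ⟨
          E 1 p ⊞ (E 2 p ⊞ E 3 p)             ≡⟨ cong (λ x → E 1 p ⊞ (E 2 p ⊞ x)) (⊞-identityʳ _) ⟨
          ∑ 3 (λ j → E (suc j) p)             ≡⟨ cong (λ x → ∑ x (λ j → E (suc j) p)) q≡3 ⟨
          ∑ q (λ j → E (suc j) p)             ≡⟨ ∑-cong q (λ j _ → at (sym (+-identityʳ p)) (cong (p +_) (+-suc (1 * q) j))) ⟩
          ∑ q (λ j → B (p + 0) (p + (1 + 1 * q + j)))  ≡⟨ ⊞-identityʳ _ ⟨
          ∑∑ 1 q (λ i j → B (p + i) (p + (1 + 1 * q + j)))  ≡⟨ full-rectangle 1 ≤-refl 1+2≤m p 1 q refl ⟩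
          𝟘                                   ∎)
          where open ≡-Reasoning

        three-zero : ∀ c → 1 ≤ c → c ≤ q → ∀ p → E c p ≡ 𝟘
        three-zero c 1≤c c≤q = go c 1≤c (subst (c ≤_) q≡3 c≤q)
          where
          go : ∀ c → 1 ≤ c → c ≤ 3 → ∀ p → E c p ≡ 𝟘
          go (suc zero)             _ _ p = E₁-zero p
          go (suc (suc zero))       _ _ p = E₂-zero p
          go (suc (suc (suc zero))) _ _ p = trans (E₃≡E₁ p) (E₁-zero p)
          go (suc (suc (suc (suc _)))) _ (s≤s (s≤s (s≤s ())))

    long-zero : ∀ β → 1 ≤ β → suc (suc β) ≤ m → ∀ c → 1 ≤ c → c ≤ q → ∀ p → D (β * q + c) p ≡ 𝟘
    long-zero β 1≤β β+2≤m c 1≤c c≤q with m≤n⇒m<n∨m≡n (≤-trans (s≤s (s≤s 1≤β)) β+2≤m)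
    ... | inj₁ 4≤m = LargeCycle.four-zero 4≤m β 1≤β β+2≤m c 1≤c c≤q
    ... | inj₂ 3≡m = subst (λ β → ∀ p → D (β * q + c) p ≡ 𝟘) (≤-antisym 1≤β (≤-pred (≤-pred (subst (suc (suc β) ≤_) (sym 3≡m) β+2≤m))))
      ([ (λ q≡3 → SmallCycle.Three.three-zero (sym 3≡m) q≡3 c 1≤c c≤q)
       , (λ 2∣q → SmallCycle.even-zero (sym 3≡m) 2∣q c (suc (q ∸ c)) 1≤c (s≤s z≤n) (trans (+-suc c (q ∸ c)) (cong suc (m+[n∸m]≡n c≤q)))) ]′
       (exception (sym 3≡m)))

    -- Here d = βq + c with 1 ≤ c ≤ q, hence the division of d - 1 rather than d. The case β = 0 is
    -- short, 1 ≤ β ≤ m - 2 is long, and beyond (m - 1)q the edge is short when seen from its other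
    -- end.
    all-zero : ∀ d → 1 ≤ d → d < k → ∀ p → D d p ≡ 𝟘
    all-zero (suc d′) _ (s≤s d<k) with <-≤-connex d′ q
    ... | inj₁ d′<q = short-zero (suc d′) (s≤s z≤n) d′<q
    ... | inj₂ q≤d′ with <-≤-connex d′ (suc m″ * q)
    ...   | inj₁ lt = subst (λ d → ∀ p → D d p ≡ 𝟘) shape
      (long-zero (d′ / q) (m≥n⇒m/n>0 q≤d′) (s≤s (m<n*o⇒m/o<n {d′} {suc m″} {q} lt)) (suc (d′ % q)) (s≤s z≤n) (m%n<n d′ q))
      where
      shape : d′ / q * q + suc (d′ % q) ≡ suc d′
      shape = trans (+-suc _ _) (cong suc (trans (+-comm _ (d′ % q)) (sym (m≡m%n+[m/n]*n d′ q))))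
    ...   | inj₂ ge = λ p → trans (D-complement (m+[n∸m]≡n (m≤n⇒m≤1+n d<k)) p)
      (short-zero (k ∸ suc d′) (m<n⇒0<n∸m (s≤s d<k)) (≤-trans (∸-monoʳ-≤ n ge) (≤-reflexive (m+n∸n≡m q (suc m″ * q)))) (p + suc d′))

  module _ (exception : m ≡ 3 → q ≡ 3 ⊎ 2 ∣ q) where

    open Facets (suc r) (suc m″) using (Vanishes; Vanishes-shift; module Equations)

    vanishing-functional : ∀ α A → Periodic₂ A k → Vanishes α A →
      (∀ i j → j ≤ i → i < k → A i j ≡ 𝟘) → A 0 1 ≡ 𝟘 → α ≡ 𝟘 × (∀ i j → i < k → j < k → A i j ≡ 𝟘)
    vanishing-functional α A per@(perˡ , perʳ) vanishes lower A01 = At.constant-zero 0 m≥2 A-zero , A-zero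
      where
      open ≡-Reasoning
      m≥2 : 2 ≤ m
      m≥2 = s≤s (s≤s z≤n)
      module At (p : ℕ) = Equations α (shift p A) (Vanishes-shift p α A per vanishes)

      B : ℕ → ℕ → K
      B = sym-part A

      B-zero : ∀ e → 1 ≤ e → e < k → ∀ p → B p (p + e) ≡ 𝟘
      B-zero = all-zero B (λ i j → ⊞-comm (A i j) (A j i)) (λ i j → cong₂ _⊞_ (perʳ i j) (perˡ j i))
        (λ p → At.node-equation p m≥2) (λ p → At.window-equation p m≥2) At.rectangle
        (trans (cong₂ _⊞_ A01 (lower 1 0 z≤n (s≤s (s≤s z≤n)))) (⊞-identityʳ 𝟘)) exception

      A-zero : ∀ i j → i < k → j < k → A i j ≡ 𝟘
      A-zero i j i<k j<k with <-≤-connex i j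
      ... | inj₂ j≤i = lower i j j≤i i<k
      ... | inj₁ i<j = begin
        A i j                      ≡⟨ ⊞-identityʳ _ ⟨
        A i j ⊞ 𝟘                  ≡⟨ cong (A i j ⊞_) (lower j i (<⇒≤ i<j) j<k) ⟨
        B i j                      ≡⟨ cong (B i) (m+[n∸m]≡n (<⇒≤ i<j)) ⟨
        B i (i + (j ∸ i))          ≡⟨ B-zero (j ∸ i) (m<n⇒0<n∸m i<j) (≤-<-trans (m∸n≤m j i) j<k) i ⟩
        𝟘                          ∎

-- The face in terms of the given definitions

ℚ-field : DecField
ℚ-field = record
  { isCommutativeRing = ℚₚ.+-*-isCommutativeRing
  ; _≟ᴷ_ = ℚₚ._≟_
  ; inverse = λ x x≢0 → (ℚ.1/ x) {{ℚ.≢-nonZero x≢0}} , ℚₚ.*-inverseˡ x {{ℚ.≢-nonZero x≢0}}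
  ; 2≢0 = λ ()
  }

open Functionals ℚ-field using (module Combination; module Facets; ι; sgn; sum; _∙_; ∑; even⊎sgn; alternating-long; dependency; ∑-single; ∑-cong; sum-cong-≗; sum-zero; sum-combine; sum-remove; zeroʳ; ·-identityˡ; ·-identityʳ; ⊞-identityʳ; _·_; _⊞_; Φ; Φ-cong; Periodic₂; LinearlyIndependent; extract-independent)

sumℚ≡sum : ∀ {n} (f : Fin n → ℚ) → sumℚ f ≡ sum f
sumℚ≡sum {zero}  f = refl
sumℚ≡sum {suc n} f = cong (f zero ℚ.+_) (sumℚ≡sum (f ∘ suc))

sumℤ-cong : ∀ {n} {f g : Fin n → ℤ} → (∀ i → f i ≡ g i) → sumℤ f ≡ sumℤ g
sumℤ-cong {zero}  eq = refl
sumℤ-cong {suc n} eq = cong₂ ℤ._+_ (eq zero) (sumℤ-cong (eq ∘ suc))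

sumℤ-minus : ∀ {n} (f g : Fin n → ℕ) → sumℤ (λ i → pos (f i) ℤ.- pos (g i)) ≡ pos (ℕ∑.sum f) ℤ.- pos (ℕ∑.sum g)
sumℤ-minus {zero}  f g = refl
sumℤ-minus {suc n} f g = trans (cong (λ x → pos (f zero) ℤ.- pos (g zero) ℤ.+ x) (sumℤ-minus (f ∘ suc) (g ∘ suc)))
  (interchange (pos (f zero)) (pos (g zero)) (pos (ℕ∑.sum (f ∘ suc))) (pos (ℕ∑.sum (g ∘ suc))))
  where
  interchange : ∀ a b c d → a ℤ.- b ℤ.+ (c ℤ.- d) ≡ a ℤ.+ c ℤ.- (b ℤ.+ d)
  interchange = ℤSolver.solve-∀

difference-≡ : ∀ {a b c d} → a + d ≡ c + b → pos a ℤ.- pos b ≡ pos c ℤ.- pos d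
difference-≡ {a} {b} {c} {d} eq = begin
  pos a ℤ.- pos b                              ≡⟨ e₁ (pos a) (pos b) (pos d) ⟩
  pos a ℤ.+ pos d ℤ.- (pos b ℤ.+ pos d)            ≡⟨ cong (λ x → x ℤ.- (pos b ℤ.+ pos d)) (cong pos eq) ⟩
  pos c ℤ.+ pos b ℤ.- (pos b ℤ.+ pos d)            ≡⟨ e₂ (pos c) (pos b) (pos d) ⟩
  pos c ℤ.- pos d                              ∎
  where
  open ≡-Reasoning
  e₁ : ∀ a b d → a ℤ.- b ≡ a ℤ.+ d ℤ.- (b ℤ.+ d)
  e₁ = ℤSolver.solve-∀
  e₂ : ∀ c b d → c ℤ.+ b ℤ.- (b ℤ.+ d) ≡ c ℤ.- d
  e₂ = ℤSolver.solve-∀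

≡-difference : ∀ {a b c d} → pos a ℤ.- pos b ≡ pos c ℤ.- pos d → a + d ≡ c + b
≡-difference {a} {b} {c} {d} eq = ℤₚ.+-injective (begin
  pos a ℤ.+ pos d                              ≡⟨ e₁ (pos a) (pos b) (pos d) ⟩
  pos a ℤ.- pos b ℤ.+ (pos b ℤ.+ pos d)            ≡⟨ cong (ℤ._+ (pos b ℤ.+ pos d)) eq ⟩
  pos c ℤ.- pos d ℤ.+ (pos b ℤ.+ pos d)            ≡⟨ e₂ (pos c) (pos b) (pos d) ⟩
  pos c ℤ.+ pos b                              ∎)
  where
  open ≡-Reasoning
  e₁ : ∀ a b d → a ℤ.+ d ≡ a ℤ.- b ℤ.+ (b ℤ.+ d)
  e₁ = ℤSolver.solve-∀
  e₂ : ∀ c b d → c ℤ.- d ℤ.+ (b ℤ.+ d) ≡ c ℤ.+ b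
  e₂ = ℤSolver.solve-∀

≤-difference : ∀ {a b c d} → a + d ≤ c + b → pos a ℤ.- pos b ℤ.≤ pos c ℤ.- pos d
≤-difference {a} {b} {c} {d} le = ℤₚ.≤-trans (ℤₚ.≤-reflexive (e₁ (pos a) (pos b) (pos d)))
  (ℤₚ.≤-trans (ℤₚ.+-monoˡ-≤ (ℤ.- (pos b ℤ.+ pos d)) (ℤ.+≤+ le)) (ℤₚ.≤-reflexive (e₂ (pos c) (pos b) (pos d))))
  where
  e₁ : ∀ a b d → a ℤ.- b ≡ a ℤ.+ d ℤ.- (b ℤ.+ d)
  e₁ = ℤSolver.solve-∀
  e₂ : ∀ c b d → c ℤ.+ b ℤ.- (b ℤ.+ d) ≡ c ℤ.- d
  e₂ = ℤSolver.solve-∀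

module Bridge (k′ : ℕ) where

  k : ℕ
  k = suc k′

  label : Labelling k → ℕ → ℕ
  label L i = toℕ (L (i mod k))

  mod-cong : ∀ {i j} → i % k ≡ j % k → i mod k ≡ j mod k
  mod-cong {i} {j} eq = Finₚ.toℕ-injective {k}
    (trans (Finₚ.toℕ-fromℕ< (m%n<n i k)) (trans eq (sym (Finₚ.toℕ-fromℕ< (m%n<n j k)))))

  toℕ-mod : ∀ (i : Fin k) → toℕ i mod k ≡ i
  toℕ-mod i = Finₚ.toℕ-injective (trans (Finₚ.toℕ-fromℕ< (m%n<n (toℕ i) k)) (m<n⇒m%n≡m (Finₚ.toℕ<n i)))

  label-periodic : ∀ L → Periodic (label L) k
  label-periodic L i = cong (toℕ ∘ L) (mod-cong {i + k} {i} ([m+n]%n≡m%n i k))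

  label-toℕ : ∀ L (i : Fin k) → label L (toℕ i) ≡ toℕ (L i)
  label-toℕ L i = cong (toℕ ∘ L) (toℕ-mod i)

  xℤ-label : ∀ (L : Labelling k) i j → xℤ L i j ≡ pos (δ (toℕ (L i)) (toℕ (L j)))
  xℤ-label L i j with L i Finₚ.≟ L j
  ... | yes eq = cong pos (sym (δ-≡ (cong (toℕ {k}) eq)))
  ... | no neq = cong pos (sym (δ-≢ (neq ∘ Finₚ.toℕ-injective)))

  xℚ-label : ∀ (L : Labelling k) i j → xℚ L i j ≡ ι (δ (toℕ (L i)) (toℕ (L j)))
  xℚ-label L i j with L i Finₚ.≟ L j
  ... | yes eq = cong ι (sym (δ-≡ (cong (toℕ {k}) eq)))
  ... | no neq = cong ι (sym (δ-≢ (neq ∘ Finₚ.toℕ-injective)))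

  joins : Labelling k → ℕ
  joins L = ℕ∑.∑ k (λ i → δ (label L i) (label L (i + 1)))

  chordLHS-label : ∀ q L → chordLHS q L ≡ pos (joins L) ℤ.- pos (chords (label L) k q)
  chordLHS-label q L = trans
    (sumℤ-cong {k} λ i → cong₂ (λ x y → x ℤ.- y) (entry i 1) (entry i q))
    (sumℤ-minus {k} (λ i → δ (label L (toℕ i)) (label L (toℕ i + 1))) (λ i → δ (label L (toℕ i)) (label L (toℕ i + q))))
    where
    entry : ∀ (i : Fin k) n → xℤ L i (i ⊕ n) ≡ pos (δ (label L (toℕ i)) (label L (toℕ i + n)))
    entry i n = trans (xℤ-label L i (i ⊕ n)) (cong (λ x → pos (δ x (label L (toℕ i + n)))) (sym (label-toℕ L i)))

  joins+ : ∀ q L x → cuts (label L) k + chords (label L) k q ≡ x → joins L + x ≡ k + chords (label L) k q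
  joins+ q L x refl = trans (e (joins L) (cuts (label L) k) (chords (label L) k q))
    (cong (_+ chords (label L) k q) (Cuts.cuts+joins (label L) k))
    where
    e : ∀ a b c → a + (b + c) ≡ b + a + c
    e = solve-∀

  OnFace⇒tight : ∀ q L → OnFace k q L → cuts (label L) k + chords (label L) k q ≡ ⌈ k / q ⌉
  OnFace⇒tight q L on = sym (+-cancelˡ-≡ (joins L) _ _
    (trans (≡-difference {joins L} {chords (label L) k q} {k} (trans (sym (chordLHS-label q L)) on)) (sym (joins+ q L _ refl))))

  tight⇒OnFace : ∀ q L → cuts (label L) k + chords (label L) k q ≡ ⌈ k / q ⌉ → OnFace k q L
  tight⇒OnFace q L eq = trans (chordLHS-label q L) (difference-≡ {joins L} (joins+ q L _ eq))

  valid-bound : ∀ q L → ⌈ k / q ⌉ ≤ cuts (label L) k + chords (label L) k q → chordLHS q L ℤ.≤ chordRHS k q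
  valid-bound q L le = subst (ℤ._≤ chordRHS k q) (sym (chordLHS-label q L))
    (≤-difference {joins L} (subst (joins L + ⌈ k / q ⌉ ≤_) (joins+ q L _ refl) (+-monoʳ-≤ (joins L) le)))

  labels : ∀ {m} → (Fin m → Labelling k) → Fin m → ℕ → ℕ
  labels Ls t = label (Ls t)

  -- This bounds dimensions from above. The edges in `es` and the condition on the weights are fewer
  -- than `m` equations, so they have a nontrivial solution, and `closure` extends its vanishing to
  -- all edges.
  no-affine-independence : ∀ {m} (Ls : Fin m → Labelling k) (es : List (ℕ × ℕ)) → suc (length es) < m →
    (∀ c → sum c ≡ 0ℚ → (∀ {i j} → (i , j) ∈ es → c ∙ (λ t → ι (δ (labels Ls t i) (labels Ls t j))) ≡ 0ℚ) →
       ∀ i j → i < j → j < k → c ∙ (λ t → ι (δ (labels Ls t i) (labels Ls t j))) ≡ 0ℚ) →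
    ¬ AffinelyIndependent (λ t → xvec (Ls t))
  no-affine-independence Ls es lt closure independent with dependency (labels Ls) es lt
  ... | c , (t , cₜ≢0) , Σc , kill = cₜ≢0 (independent c (trans (sumℚ≡sum c) Σc) edge t)
    where
    entry : ∀ L (i j : Fin k) → xℚ L i j ≡ ι (δ (label L (toℕ i)) (label L (toℕ j)))
    entry L i j = trans (xℚ-label L i j) (sym (cong₂ (λ x y → ι (δ x y)) (label-toℕ L i) (label-toℕ L j)))
    edge : ∀ e → sumℚ (λ t → c t ℚ.* xvec (Ls t) e) ≡ 0ℚ
    edge (i , j , i<j) = begin
      sumℚ (λ t → c t ℚ.* xℚ (Ls t) i j)      ≡⟨ sumℚ≡sum (λ t → c t ℚ.* xℚ (Ls t) i j) ⟩
      sum (λ t → c t ℚ.* xℚ (Ls t) i j)       ≡⟨ sum-cong-≗ (λ t → cong (c t ℚ.*_) (entry (Ls t) i j)) ⟩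
      c ∙ (λ t → ι (δ (labels Ls t (toℕ i)) (labels Ls t (toℕ j))))  ≡⟨ closure c Σc kill (toℕ i) (toℕ j) i<j (Finₚ.toℕ<n j) ⟩
      0ℚ                                      ∎
      where open ≡-Reasoning

  module Face {m q : ℕ} (2≤q : 2 ≤ q) (2q≤k : 2 * q ≤ k) (Ls : Fin m → Labelling k) (on : ∀ t → OnFace k q (Ls t)) where

    q<k : q < k
    q<k = ≤-certificate 1 (+-mono-≤ 2≤q 2q≤k) (e q k)
      where e : ∀ q k → k + (2 + 2 * q) ≡ suc q + (q + k) + 1
            e = solve-∀

    1<k : 1 < k
    1<k = <-trans 2≤q q<k

    tight : ∀ t → cuts (labels Ls t) k + chords (labels Ls t) k q ≡ ⌈ k / q ⌉
    tight t = OnFace⇒tight q (Ls t) (on t)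

    module Weights (c : Fin m → ℚ) (Σc : sum c ≡ 0ℚ) where
      open Combination {m} {k} (labels Ls) (label-periodic ∘ Ls) c Σc public
      open OnFace {q} tight public

    bounded-by : ∀ b → 1 < b → b < k →
      (∀ c (Σc : sum c ≡ 0ℚ) → let open Weights c Σc in
         (∀ i j → i < j → j < k → ¬ (i ≡ 0 × (j ≡ 1 ⊎ j ≡ b)) → y i j ≡ 0ℚ) → y 0 b ≡ 0ℚ) →
      m ≡ k C 2 → ¬ AffinelyIndependent (λ t → xvec (Ls t))
    bounded-by b 1<b b<k extra m≡ = no-affine-independence Ls es
      (subst (suc (length es) <_) (trans (length-pairs k) (sym m≡)) (≤-<-trans (length-remove b∈) (length-remove {0 , 1} 01∈))) closure
      where
      01∈ = ∈-pairs k z<s 1<k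
      b∈ = ∈-remove {0 , 1} {0 , b} (∈-pairs k (<-trans z<s 1<b) b<k) λ { refl → <-irrefl refl 1<b }
      es = remove (0 , b) (remove (0 , 1) (pairs k))
      closure : ∀ c → sum c ≡ 0ℚ → _ → _
      closure c Σc kill = all
        where
        open Weights c Σc
        zeros : ∀ i j → i < j → j < k → ¬ (i ≡ 0 × (j ≡ 1 ⊎ j ≡ b)) → y i j ≡ 0ℚ
        zeros i j i<j j<k other = kill (∈-remove (∈-remove (∈-pairs k i<j j<k)
          λ { refl → other (refl , inj₁ refl) }) λ { refl → other (refl , inj₂ refl) })
        zeros₁ : ∀ i j → i < j → j < k → ¬ (i ≡ 0 × j ≡ 1) → y i j ≡ 0ℚ
        zeros₁ i j i<j j<k other with i ≟ 0 | j ≟ b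
        ... | yes refl | yes refl = extra c Σc zeros
        ... | yes refl | no j≢b   = zeros 0 j i<j j<k λ { (_ , inj₁ j≡1) → other (refl , j≡1) ; (_ , inj₂ j≡b) → j≢b j≡b }
        ... | no i≢0   | _        = zeros i j i<j j<k (i≢0 ∘ proj₁)
        all : ∀ i j → i < j → j < k → y i j ≡ 0ℚ
        all i j i<j j<k with i ≟ 0 | j ≟ 1
        ... | yes refl | yes refl = vanish-01 2≤q 2q≤k zeros₁
        ... | yes refl | no j≢1   = zeros₁ 0 j i<j j<k (j≢1 ∘ proj₂)
        ... | no i≢0   | _        = zeros₁ i j i<j j<k (i≢0 ∘ proj₁)

  module _ {q : ℕ} (2≤q : 2 ≤ q) (2q≤k : 2 * q ≤ k) where

    -- The equation of the face can be solved for the coordinate at {0,1}, so that one edge is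
    -- dropped.
    face-upper-bound : ¬ FaceHasAffIndep k q (suc (k C 2))
    face-upper-bound (Ls , on , independent) = no-affine-independence Ls es
      (s≤s (subst (suc (length es) ≤_) (length-pairs k) (length-remove {0 , 1} 01∈))) closure independent
      where
      open Face 2≤q 2q≤k Ls on
      01∈ = ∈-pairs k z<s 1<k
      es = remove (0 , 1) (pairs k)
      closure : ∀ c → sum c ≡ 0ℚ → _ → _
      closure c Σc kill = all
        where
        open Weights c Σc
        zeros : ∀ i j → i < j → j < k → ¬ (i ≡ 0 × j ≡ 1) → y i j ≡ 0ℚ
        zeros i j i<j j<k other = kill (∈-remove (∈-pairs k i<j j<k) λ { refl → other (refl , refl) })
        all : ∀ i j → i < j → j < k → y i j ≡ 0ℚ
        all i j i<j j<k with i ≟ 0 | j ≟ 1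
        ... | yes refl | yes refl = vanish-01 2≤q 2q≤k zeros
        ... | yes refl | no j≢1   = zeros 0 j i<j j<k (j≢1 ∘ proj₂)
        ... | no i≢0   | _        = zeros i j i<j j<k (i≢0 ∘ proj₁)

  -- Unless q divides k - 1, rounding up k / q leaves no room for a chord.
  chord-on-face : ∀ q → 2 ≤ q → ∀ L → OnFace k q L → label L 0 ≡ label L q → q ∣ k′
  chord-on-face (suc q′) 2≤q L on joined = divides (⌈ k / suc q′ ⌉ ∸ 1) (+-cancelˡ-≡ (suc q′) k′ _ (begin-equality
    suc q′ + k′                                ≡⟨ e₁ q′ k′ ⟩
    k + q′                                     ≡⟨ ≤-antisym k+q′≤ (m/n*n≤m (k + q′) (suc q′)) ⟩
    ⌈ k / suc q′ ⌉ * suc q′                    ≡⟨ cong (_* suc q′) (m+[n∸m]≡n 1≤ceil) ⟨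
    suc q′ + (⌈ k / suc q′ ⌉ ∸ 1) * suc q′     ∎))
    where
    open ≤-Reasoning
    a = cuts (label L) k
    s = chords (label L) k (suc q′)
    tight : a + s ≡ ⌈ k / suc q′ ⌉
    tight = OnFace⇒tight (suc q′) L on
    1≤s : 1 ≤ s
    1≤s = ≤-trans (≤-reflexive (sym (δ-≡ joined))) (m≤m+n _ _)
    1≤ceil : 1 ≤ ⌈ k / suc q′ ⌉
    1≤ceil = subst (1 ≤_) tight (≤-trans 1≤s (m≤n+m s a))
    e₁ : ∀ q k → suc q + k ≡ suc k + q
    e₁ = solve-∀
    e₂ : ∀ q k a s → (a + s) * suc q + (k + q * 1) ≡ k + q + (suc q * a + s + q * s) + 0
    e₂ = solve-∀
    k+q′≤ : k + q′ ≤ ⌈ k / suc q′ ⌉ * suc q′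
    k+q′≤ = subst (λ x → k + q′ ≤ x * suc q′) tight
      (≤-certificate 0 (+-mono-≤ (Cuts.cut-count (label L) (label-periodic L) (suc q′)) (*-monoʳ-≤ q′ 1≤s)) (e₂ q′ k a s))

  non-divisor : ∀ {q} → 2 ≤ q → 2 * q ≤ k → ¬ q ∣ k′ → ¬ FaceHasAffIndep k q (k C 2)
  non-divisor {q} 2≤q 2q≤k q∤k′ (Ls , on , independent) = bounded-by q 2≤q q<k
    (λ c Σc _ → sum-zero λ t → trans (cong (λ x → c t ℚ.* ι x) (δ-≢ λ joined → q∤k′ (chord-on-face q 2≤q (Ls t) (on t) joined)))
                                     (zeroʳ (c t)))
    refl independent
    where open Face 2≤q 2q≤k Ls on

-- Necessity of the parity condition

module _ (r : ℕ) where

  private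
    q : ℕ
    q = suc (suc r)

  open Bridge (3 * q)

  ceil-three : ⌈ k / q ⌉ ≡ 4
  ceil-three = trans (cong (_/ q) (e r)) (m*n/n≡m 4 q)
    where e : ∀ r → suc (3 * suc (suc r)) + suc r ≡ 4 * suc (suc r)
          e = solve-∀

  odd-three-blocks : q ≢ 3 → ¬ 2 ∣ q → ¬ FaceHasAffIndep k q (k C 2)
  odd-three-blocks q≢3 2∤q (Ls , on , independent) = bounded-by (suc (suc q)) (s≤s (s≤s z≤n)) q+2<k extra refl independent
    where
    2q≤k : 2 * q ≤ k
    2q≤k = ≤-certificate (suc q) (z≤n {0}) (e q)
      where e : ∀ q → suc (3 * q) + 0 ≡ 2 * q + 0 + suc q
            e = solve-∀
    q+2<k : suc (suc q) < k
    q+2<k = ≤-certificate (2 + 2 * r) (z≤n {0}) (e r)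
      where e : ∀ r → suc (3 * suc (suc r)) + 0 ≡ suc (suc (suc (suc (suc r)))) + 0 + (2 + 2 * r)
            e = solve-∀
    open Face (s≤s (s≤s z≤n)) 2q≤k Ls on
    odd : sgn q ≡ ℚ.- 1ℚ
    odd = [ (λ 2∣q → contradiction 2∣q 2∤q) , id ]′ (even⊎sgn q)
    extra : ∀ c (Σc : sum c ≡ 0ℚ) → let open Weights c Σc in
      (∀ i j → i < j → j < k → ¬ (i ≡ 0 × (j ≡ 1 ⊎ j ≡ suc (suc q))) → y i j ≡ 0ℚ) → y 0 (suc (suc q)) ≡ 0ℚ
    extra c Σc zeros = begin
      y 0 (suc (suc q))                                   ≡⟨ ·-identityˡ _ ⟨
      sgn 0 ℚ.* y 0 (suc (suc q))                         ≡⟨ ∑-single k 0 (λ z → sgn z ℚ.* y z (z + suc (suc q))) z<s (λ z z<k z≢0 →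
                                                               trans (cong (sgn z ℚ.*_) (other z z<k z≢0)) (zeroʳ (sgn z))) ⟨
      ∑ k (λ z → sgn z ℚ.* y z (z + suc (suc q)))         ≡⟨ ∑-exchange k sgn (λ t z → ι (δ (labels Ls t z) (labels Ls t (z + suc (suc q))))) ⟩
      c ∙ (λ t → ∑ k (λ z → sgn z ℚ.* ι (δ (labels Ls t z) (labels Ls t (z + suc (suc q))))))
        ≡⟨ sum-zero (λ t → trans (cong (c t ℚ.*_) (alternating-long r (labels Ls t) (label-periodic (Ls t)) (trans (tight t) ceil-three) odd))
                                 (zeroʳ (c t))) ⟩
      0ℚ                                                  ∎
      where
      open ≡-Reasoning
      open Weights c Σc
      other : ∀ z → z < k → z ≢ 0 → y z (z + suc (suc q)) ≡ 0ℚ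
      other z z<k z≢0 = vanish zeros z (suc (suc q)) z<s q+2<k z<k (λ _ → z≢0 ∘ proj₁)
        (λ { o eq (refl , inj₁ refl) → <⇒≢ (≤-certificate (2 * r + 1) (z≤n {0}) (e₁ r)) eq
           -- The edge {0,q+2} would be met a second time, from its other end z = q + 2, only if 2(q
           -- + 2) = 3q + 1, that is, q = 3.
           ; o eq (refl , inj₂ refl) → q≢3 (sym (+-cancelˡ-≡ (1 + 2 * q) 3 q (trans (e₂ q) (trans eq (e₃ q))))) })
        where
        e₁ : ∀ r → suc (3 * suc (suc r)) + 0 ≡ suc (suc (suc (suc (suc (suc r))))) + 0 + (2 * r + 1)
        e₁ = solve-∀
        e₂ : ∀ q → 1 + 2 * q + 3 ≡ suc (suc q) + suc (suc q)
        e₂ = solve-∀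
        e₃ : ∀ q → 0 + suc (3 * q) ≡ 1 + 2 * q + q
        e₃ = solve-∀

-- Homogeneous coordinates and normalised functionals

lowerPairs : ℕ → List (ℕ × ℕ)
lowerPairs zero    = []
lowerPairs (suc k) = map (k ,_) (upTo (suc k)) ++ lowerPairs k

length-lowerPairs : ∀ k → length (lowerPairs k) ≡ k + k C 2
length-lowerPairs zero    = refl
length-lowerPairs (suc k) = begin
  length (map (k ,_) (upTo (suc k)) ++ lowerPairs k)           ≡⟨ length-++ (map (k ,_) (upTo (suc k))) ⟩
  length (map (k ,_) (upTo (suc k))) + length (lowerPairs k)   ≡⟨ cong₂ _+_ (trans (length-map (k ,_) (upTo (suc k))) (length-upTo (suc k))) (length-lowerPairs k) ⟩
  suc k + (k + k C 2)                                          ≡⟨ cong (suc k +_) (k+kC2 k) ⟩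
  suc k + suc k C 2                                            ∎
  where open ≡-Reasoning

∈-lowerPairs : ∀ {i j} k → j ≤ i → i < k → (i , j) ∈ lowerPairs k
∈-lowerPairs {i} {j} (suc k) j≤i (s≤s i≤k) with i ≟ k
... | yes refl = ∈-++⁺ˡ (∈-map⁺ (k ,_) (∈-upTo⁺ (s≤s j≤i)))
... | no i≢k   = ∈-++⁺ʳ (map (k ,_) (upTo (suc k))) (∈-lowerPairs k j≤i (≤∧≢⇒< i≤k i≢k))

k*k≡ : ∀ k → k + (k C 2 + k C 2) ≡ k * k
k*k≡ zero    = refl
k*k≡ (suc k) = begin
  suc k + (suc k C 2 + suc k C 2)          ≡⟨ cong (λ x → suc k + (x + x)) (k+kC2 k) ⟨
  suc k + (k + k C 2 + (k + k C 2))        ≡⟨ e₁ k (k C 2) ⟩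
  k + (k C 2 + k C 2) + suc (k + k)        ≡⟨ cong (_+ suc (k + k)) (k*k≡ k) ⟩
  k * k + suc (k + k)                      ≡⟨ e₂ k ⟩
  suc k * suc k                            ∎
  where
  open ≡-Reasoning
  e₁ : ∀ k c → suc k + (k + c + (k + c)) ≡ k + (c + c) + suc (k + k)
  e₁ = solve-∀
  e₂ : ∀ k → k * k + suc (k + k) ≡ suc k * suc k
  e₂ = solve-∀

counterexample⊎all : ∀ {n} (P Q : Fin n → Set) → (∀ t → Dec (P t)) → (∀ t → Dec (Q t)) →
  (∃ λ t → P t × ¬ Q t) ⊎ (∀ t → P t → Q t)
counterexample⊎all P Q P? Q? with Finₚ.any? (λ t → P? t ×-dec ¬? (Q? t))
... | yes found = inj₁ found
... | no none   = inj₂ λ t p → decidable-stable (Q? t) λ ¬q → none (t , p , ¬q)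

module Coordinates (k′ : ℕ) where

  open Bridge k′

  -- The leading 1 makes affine functionals linear. All k² ordered pairs serve as positions, so that
  -- a coefficient matrix can be indexed by residues; the duplicates this creates are what
  -- `redundant` sets to 0, besides {0,1}.
  coordinates : Labelling k → Fin (suc (k * k)) → ℚ
  coordinates L zero    = 1ℚ
  coordinates L (suc t) = xℚ L (quotient {k} k t) (remainder {k} k t)

  unit : ∀ {n} → Fin n → Fin n → ℚ
  unit e x with x Finₚ.≟ e
  ... | yes _ = 1ℚ
  ... | no  _ = 0ℚ

  ∙-unit : ∀ {n} (d : Fin (suc n) → ℚ) e → d ∙ unit e ≡ d e
  ∙-unit d e = begin
    d ∙ unit e                                                      ≡⟨ sum-remove {i = e} (λ x → d x · unit e x) ⟩
    d e · unit e e ⊞ sum (λ j → d (punchIn e j) · unit e (punchIn e j)) ≡⟨ cong₂ _⊞_ diagonal (sum-zero off) ⟩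
    d e ⊞ 0ℚ                                                        ≡⟨ ⊞-identityʳ (d e) ⟩
    d e                                                             ∎
    where
    open ≡-Reasoning
    diagonal : d e · unit e e ≡ d e
    diagonal with e Finₚ.≟ e
    ... | yes _  = ·-identityʳ (d e)
    ... | no e≢e = contradiction refl e≢e
    off : ∀ j → d (punchIn e j) · unit e (punchIn e j) ≡ 0ℚ
    off j with punchIn e j Finₚ.≟ e
    ... | yes eq = contradiction eq (Finₚ.punchInᵢ≢i e j)
    ... | no _   = zeroʳ (d (punchIn e j))

  position : ℕ × ℕ → Fin (suc (k * k))
  position (i , j) = suc (combine (i mod k) (j mod k))

  redundant : List (ℕ × ℕ)
  redundant = (0 , 1) ∷ lowerPairs k

  normalisation : Fin (length redundant) → Fin (suc (k * k)) → ℚ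
  normalisation e = unit (position (lookup redundant e))

  module _ (d : Fin (suc (k * k)) → ℚ) where

    α : ℚ
    α = d zero

    a : ℕ → ℕ → ℚ
    a i j = d (position (i , j))

    a-periodic : Periodic₂ a k
    a-periodic = (λ i j → cong (λ x → d (suc (combine x (j mod k)))) (mod-cong {i + k} {i} ([m+n]%n≡m%n i k)))
               , (λ i j → cong (λ x → d (suc (combine (i mod k) x))) (mod-cong {j + k} {j} ([m+n]%n≡m%n j k)))

    ∙-coordinates : ∀ L → d ∙ coordinates L ≡ α ⊞ Φ k a (label L)
    ∙-coordinates L = cong₂ _⊞_ (·-identityʳ α) (trans
      (sum-combine k k (λ t → d (suc t) · xℚ L (quotient {k} k t) (remainder {k} k t)))
      (sum-cong-≗ {k} λ i → sum-cong-≗ {k} λ j → entry i j))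
      where
      entry : ∀ i j → d (suc (combine i j)) · xℚ L (quotient {k} k (combine i j)) (remainder {k} k (combine i j)) ≡
                      a (toℕ i) (toℕ j) · ι (δ (label L (toℕ i)) (label L (toℕ j)))
      entry i j = cong₂ _·_
        (cong₂ (λ x y → d (suc (combine x y))) (sym (toℕ-mod i)) (sym (toℕ-mod j)))
        (trans (cong₂ (xℚ L) (cong proj₁ (Finₚ.remQuot-combine i j)) (cong proj₂ (Finₚ.remQuot-combine i j)))
               (trans (xℚ-label L i j) (sym (cong₂ (λ x y → ι (δ x y)) (label-toℕ L i) (label-toℕ L j)))))

    functional-zero : α ≡ 0ℚ → (∀ i j → i < k → j < k → a i j ≡ 0ℚ) → ∀ e → d e ≡ 0ℚ
    functional-zero α≡0 a≡0 zero    = α≡0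
    functional-zero α≡0 a≡0 (suc t) = begin
      d (suc t)                                                ≡⟨ cong (d ∘ suc) (Finₚ.combine-remQuot {k} k t) ⟨
      d (suc (combine i j))                                    ≡⟨ cong₂ (λ x y → d (suc (combine x y))) (toℕ-mod i) (toℕ-mod j) ⟨
      a (toℕ i) (toℕ j)                                        ≡⟨ a≡0 (toℕ i) (toℕ j) (Finₚ.toℕ<n i) (Finₚ.toℕ<n j) ⟩
      0ℚ                                                       ∎
      where
      open ≡-Reasoning
      i = quotient {k} k t
      j = remainder {k} k t

    normal-zero : (∀ e → d ∙ normalisation e ≡ 0ℚ) → ∀ {i j} → (i , j) ∈ redundant → a i j ≡ 0ℚ
    normal-zero normal e∈ = trans (cong (λ e → d (position e)) (Anyₚ.lookup-index e∈))
      (trans (sym (∙-unit d (position (lookup redundant (Any.index e∈))))) (normal (Any.index e∈)))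

  -- The added coordinates carry no information: diagonal entries equal the leading 1, and the
  -- matrix is symmetric.
  coordinates-independent : ∀ {s} (Ls : Fin s → Labelling k) →
    LinearlyIndependent (coordinates ∘ Ls) → AffinelyIndependent (λ t → xvec (Ls t))
  coordinates-independent Ls independent μ Σμ edges =
    independent μ λ { zero → total ; (suc t) → entry (quotient {k} k t) (remainder {k} k t) }
    where
    total : μ ∙ (λ _ → 1ℚ) ≡ 0ℚ
    total = trans (sum-cong-≗ λ t → ·-identityʳ (μ t)) (trans (sym (sumℚ≡sum μ)) Σμ)
    edge : ∀ i j → i Fin.< j → μ ∙ (λ t → xℚ (Ls t) i j) ≡ 0ℚ
    edge i j i<j = trans (sym (sumℚ≡sum (λ t → μ t ℚ.* xℚ (Ls t) i j))) (edges (i , j , i<j))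
    entry : ∀ i j → μ ∙ (λ t → xℚ (Ls t) i j) ≡ 0ℚ
    entry i j with Finₚ.<-cmp i j
    ... | tri< i<j _ _  = edge i j i<j
    ... | tri≈ _ refl _ = trans (sum-cong-≗ λ t → cong (μ t ·_) (trans (xℚ-label (Ls t) i i) (cong ι (δ-≡ {toℕ (Ls t i)} refl)))) total
    ... | tri> _ _ j<i  = trans (sum-cong-≗ λ t → cong (μ t ·_) (trans (xℚ-label (Ls t) i j)
                            (trans (cong ι (δ-sym (toℕ (Ls t i)) (toℕ (Ls t j)))) (sym (xℚ-label (Ls t) j i))))) (edge j i j<i)

  periodic-multiple : ∀ {ℓ} → Periodic ℓ k → ∀ i c → ℓ (i + c * k) ≡ ℓ i
  periodic-multiple {ℓ} per i zero    = cong ℓ (+-identityʳ i)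
  periodic-multiple {ℓ} per i (suc c) = trans (cong ℓ (e i k (c * k))) (trans (per (i + c * k)) (periodic-multiple per i c))
    where e : ∀ i k x → i + (k + x) ≡ i + x + k
          e = solve-∀

  -- Surjectivity of the enumeration is asked only up to pointwise equality, which suffices because
  -- cuts, chords and `Φ` depend on the values of the labels alone.
  realise : ∀ {N} (enumerate : Fin N → Labelling k) → (∀ L → ∃ λ t → ∀ i → enumerate t i ≡ L i) → ∀ ℓ → Periodic ℓ k → (∀ i → ℓ i < k) → ∃ λ t → ∀ i → label (enumerate t) i ≡ ℓ i
  realise enumerate complete ℓ per small = proj₁ (complete L) , λ i → begin
    label (enumerate (proj₁ (complete L))) i   ≡⟨ cong toℕ (proj₂ (complete L) (i mod k)) ⟩
    toℕ (L (i mod k))                       ≡⟨ Finₚ.toℕ-fromℕ< (small (toℕ (i mod k))) ⟩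
    ℓ (toℕ (i mod k))                       ≡⟨ cong ℓ (Finₚ.toℕ-fromℕ< (m%n<n i k)) ⟩
    ℓ (i % k)                               ≡⟨ periodic-multiple per (i % k) (i / k) ⟨
    ℓ (i % k + i / k * k)                   ≡⟨ cong ℓ (m≡m%n+[m/n]*n i k) ⟨
    ℓ i                                     ∎
    where
    open ≡-Reasoning
    L : Labelling k
    L v = fromℕ< (small (toℕ v))

-- The facet for k = mq + 1

module Facet (r m″ : ℕ) {N : ℕ} (enumerate : Fin N → Labelling (suc (suc (suc m″) * suc (suc r))))
             (complete : ∀ (L : Labelling (suc (suc (suc m″) * suc (suc r)))) → ∃ λ t → ∀ i → enumerate t i ≡ L i) where

  q m : ℕ
  q = suc (suc r)
  m = suc (suc m″)

  open Bridge (m * q)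
  open Coordinates (m * q)
  open Facets (suc r) (suc m″) using (Vanishes)

  ceil : ⌈ k / q ⌉ ≡ suc m
  ceil = trans (cong (_/ q) (e r (m * q))) (m*n/n≡m (suc m) q)
    where e : ∀ r x → suc x + suc r ≡ suc (suc r) + x
          e = solve-∀

  2≤q : 2 ≤ q
  2≤q = s≤s (s≤s z≤n)

  2q≤k : 2 * q ≤ k
  2q≤k = m≤n⇒m≤1+n (*-monoˡ-≤ q {2} {m} (s≤s (s≤s z≤n)))

  valid : Valid k q
  valid L = valid-bound q L (subst (_≤ c + s) (sym ceil) (*-cancelʳ-< q m (c + s) (begin
    k                   ≤⟨ Cuts.cut-count (label L) (label-periodic L) q ⟩
    q * c + s           ≤⟨ +-monoʳ-≤ (q * c) (m≤n*m s q) ⟩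
    q * c + q * s       ≡⟨ trans (sym (*-distribˡ-+ q c s)) (*-comm q (c + s)) ⟩
    (c + s) * q         ∎)))
    where
    open ≤-Reasoning
    c = cuts (label L) k
    s = chords (label L) k q

  FacePoint : Set
  FacePoint = Σ (Fin N) λ t → OnFace k q (enumerate t)

  V : FacePoint → Fin (suc (k * k)) → ℚ
  V (t , _) = coordinates (enumerate t)

  -- A search through the finitely many labellings; it supplies the face point that the greedy
  -- extraction asks for.
  on-face-or-killed : ∀ d → (∃ λ p → d ∙ V p ≢ 0ℚ) ⊎ (∀ t → OnFace k q (enumerate t) → d ∙ coordinates (enumerate t) ≡ 0ℚ)
  on-face-or-killed d = Sum.map₁ (λ (t , on , ≢0) → (t , on) , ≢0)
    (counterexample⊎all (λ t → OnFace k q (enumerate t)) (λ t → d ∙ coordinates (enumerate t) ≡ 0ℚ) (λ t → chordLHS q (enumerate t) ℤₚ.≟ chordRHS k q) (λ t → d ∙ coordinates (enumerate t) ℚₚ.≟ 0ℚ))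

  kills⇒Vanishes : ∀ d → (∀ t → OnFace k q (enumerate t) → d ∙ coordinates (enumerate t) ≡ 0ℚ) → Vanishes (α d) (a d)
  kills⇒Vanishes d kills ℓ per small tight with realise enumerate complete ℓ per small
  ... | t , eq = begin
    α d ⊞ Φ k (a d) ℓ                          ≡⟨ cong (α d ⊞_) (Φ-cong k (a d) λ i _ → sym (eq i)) ⟩
    α d ⊞ Φ k (a d) (label (enumerate t))       ≡⟨ ∙-coordinates d (enumerate t) ⟨
    d ∙ coordinates (enumerate t)               ≡⟨ kills t (tight⇒OnFace q (enumerate t) tight′) ⟩
    0ℚ                                         ∎
    where
    open ≡-Reasoning
    tight′ : cuts (label (enumerate t)) k + chords (label (enumerate t)) k q ≡ ⌈ k / q ⌉
    tight′ = trans (cong₂ _+_ (ℕ∑.∑-cong k λ i _ → cong₂ (λ x y → 1 ∸ δ x y) (eq i) (eq (suc i)))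
                              (ℕ∑.∑-cong k λ i _ → cong₂ δ (eq i) (eq (i + q)))) (trans tight (sym ceil))

  module _ (exception : m ≡ 3 → q ≡ 3 ⊎ 2 ∣ q) where

    separate : ∀ d → (∃ λ i → d i ≢ 0ℚ) → (∀ e → d ∙ normalisation e ≡ 0ℚ) → ∃ λ p → d ∙ V p ≢ 0ℚ
    separate d (i₀ , dᵢ≢0) normal with on-face-or-killed d
    ... | inj₁ found = found
    ... | inj₂ kills = contradiction (functional-zero d (proj₁ zeros) (proj₂ zeros) i₀) dᵢ≢0
      where
      zeros : α d ≡ 0ℚ × (∀ i j → i < k → j < k → a d i j ≡ 0ℚ)
      zeros = Coefficients.vanishing-functional ℚ-field r m″ exception (α d) (a d) (a-periodic d) (kills⇒Vanishes d kills)
        (λ i j j≤i i<k → normal-zero d normal (there (∈-lowerPairs k j≤i i<k))) (normal-zero d normal (here refl))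

    face-lower-bound : FaceHasAffIndep k q (k C 2)
    face-lower-bound = from-extraction (extract-independent V normalisation separate (k C 2) count)
      where
      -- The 1 + k + `k C 2` normalisations and the `k C 2` points exactly exhaust the 1 + k²
      -- coordinates.
      count : length redundant + k C 2 ≤ suc (k * k)
      count = s≤s (≤-reflexive (trans (cong (_+ k C 2) (length-lowerPairs k)) (trans (+-assoc k (k C 2) (k C 2)) (k*k≡ k))))
      from-extraction : (∃ λ (g : Fin (k C 2) → FacePoint) → LinearlyIndependent (V ∘ g)) → FaceHasAffIndep k q (k C 2)
      from-extraction (g , independent) = enumerate ∘ proj₁ ∘ g , proj₂ ∘ g , coordinates-independent (enumerate ∘ proj₁ ∘ g) independent

    1≤kC2 : 1 ≤ k C 2
    1≤kC2 = ≤-trans (s≤s z≤n) (≤-trans (m≤m+n (m * q) ((m * q) C 2)) (≤-reflexive (k+kC2 (m * q))))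

    facet : InducesFacet k q
    facet = valid , subst (FaceHasAffIndep k q) (sym N≡) face-lower-bound ,
            (λ has → face-upper-bound 2≤q 2q≤k (subst (FaceHasAffIndep k q ∘ suc) N≡ has))
      where
      N≡ : suc (k C 2 ∸ 1) ≡ k C 2
      N≡ = m+[n∸m]≡n 1≤kC2

theorem1 : (q k : ℕ) → 2 ≤ q → 2 * q ≤ k →
    InducesFacet k q ⇔ ((q ∣ k ∸ 1) × (k ≡ 3 * q + 1 → (q ≡ 3 ⊎ 2 ∣ q)))
theorem1 (suc zero) _ (s≤s ()) _
theorem1 q@(suc (suc r)) (suc k′) 2≤q 2q≤k = mk⇔ necessary sufficient
  where
  k = suc k′
  1≤kC2 : 1 ≤ k C 2
  1≤kC2 = ≤-trans (≤-pred (≤-trans 2≤q (≤-trans (m≤m+n q (q + 0)) 2q≤k))) (≤-trans (m≤m+n k′ (k′ C 2)) (≤-reflexive (k+kC2 k′)))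
  necessary : InducesFacet k q → (q ∣ k′) × (k ≡ 3 * q + 1 → (q ≡ 3 ⊎ 2 ∣ q))
  -- Divisibility and equality are decidable, so each condition follows once its failure is refuted.
  necessary (_ , has , _) = decidable-stable (q ∣? k′) (λ q∤k′ → Bridge.non-divisor k′ 2≤q 2q≤k q∤k′ has′) , parity
    where
    has′ : FaceHasAffIndep k q (k C 2)
    has′ = subst (FaceHasAffIndep k q) (m+[n∸m]≡n 1≤kC2) has
    parity : k ≡ 3 * q + 1 → q ≡ 3 ⊎ 2 ∣ q
    parity eq with q ≟ 3 | 2 ∣? q
    ... | yes q≡3 | _       = inj₁ q≡3
    ... | no _    | yes 2∣q = inj₂ 2∣q
    ... | no q≢3  | no 2∤q  = contradiction (subst (λ k → FaceHasAffIndep k q (k C 2)) (trans eq (+-comm (3 * q) 1)) has′)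
                                (odd-three-blocks r q≢3 2∤q)
  sufficient : (q ∣ k′) × (k ≡ 3 * q + 1 → (q ≡ 3 ⊎ 2 ∣ q)) → InducesFacet k q
  -- The quotients 0 and 1 mean k = 1 and k = q + 1, both below 2q; so the quotient m is at least 2.
  sufficient (divides zero          refl , _) = contradiction (≤-trans (m≤m+n q (q + 0)) 2q≤k) (<⇒≱ 2≤q)
  sufficient (divides (suc zero)    refl , _) = contradiction 2q≤k (<⇒≱ (≤-certificate r (z≤n {0}) (e r)))
    where e : ∀ r → 2 * suc (suc r) + 0 ≡ suc (suc (1 * suc (suc r))) + 0 + r
          e = solve-∀
  -- All functions from nodes to nodes are enumerated by `finToFun`; the premise of the parity
  -- condition is supplied from m = 3.
  sufficient (divides (suc (suc m″)) refl , parity) = Facet.facet r m″ (finToFun {suc (suc (suc m″) * q)} {suc (suc (suc m″) * q)}) (λ L → funToFin L , Finₚ.finToFun-funToFin L) λ m≡3 → parity (trans (cong (λ m → suc (m * q)) m≡3) (+-comm 1 (3 * q)))
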